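{- Let $e>1$ be an odd integer and let $\gamma$ be an $e$-core partition. Then, as formal power series in $x$, \begin{align*} \sum_{w\ge 0} N_e^\gamma(w)x^w &= \frac{1}{(1-x)^{(e-1)/2}};\\ \sum_{w\ge 0} M_e^\gamma(w)x^w &= \frac{1}{(1-x)^{(e+1)/2}};\\ \sum_{w\ge 0} Z_e^\gamma(w)x^w &= \frac{1}{(1+x)(1-x)^{(e+1)/2}};\\ \sum_{w\ge 0} T_e^\gamma(w)x^w &= \frac{1}{(1+x)(1-x)^{(e+3)/2}}. \end{align*} In particular, all four counting functions depend only on $e$ and $w$ and not on $\gamma$.
   Context: Write a partition as $\lambda=(\lambda_1\ge\lambda_2\ge\dots\ge\lambda_\ell>0)$, $|\lambda|=\sum\lambda_j$. The $e$-core of $\lambda$ is obtained by repeatedly removing rim hooks of length $e$ until none remain; an $e$-core partition is a partition equal to its own $e$-core. The $e$-weight of $\lambda$ is $(|\lambda|-|\gamma|)/e$, where $\gamma$ is its $e$-core. The odd sequence of $\lambda$ is the tuple $O(\lambda)=(n_0,n_1,\dots,n_{e-1})$ of non-negative integers, where $n_i$ is the number of parts $\lambda_j$ such that $\lambda_j$ is odd and $\lambda_j-j\equiv i\pmod e$. For $w\ge0$, let $S_e^\gamma(w)$ be the set of odd sequences of partitions with $e$-core $\gamma$ and $e$-weight $w$. Define - $T_e^\gamma(w)=|S_e^\gamma(w)|$; - $Z_e^\gamma(w)$ = the number of $(n_0,\dots,n_{e-1})\in S_e^\gamma(w)$ with $n_i=0$ for some $i$; - $M_e^\gamma(w)$ =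 the number of new odd sequences, i.e. those $\theta\in S_e^\gamma(w)$ with $\theta\notin S_e^\gamma(w')$ for all $0\le w'<w$; - $N_e^\gamma(w)$ = the number of new odd sequences in $S_e^\gamma(w)$ (in the sense just defined) that contain a zero entry. -}

module Defs where

open import Data.Fin.Base using (Fin; toℕ)
open import Data.Integer.Base as ℤ using (ℤ; +_; 0ℤ; 1ℤ; _%ℕ_)
import Data.Integer.Properties as ℤ
open import Data.List.Base using (List; []; _∷_; length; lookup; filter; allFin)
open import Data.List.Membership.Propositional using (_∈_)
open import Data.List.Relation.Unary.All using (All)
open import Data.List.Relation.Unary.Linked using (Linked)
open import Data.List.Relation.Unary.Unique.Propositional using (Unique)
open import Data.Nat.Base
open import Data.Nat.Divisibility using (_∣_; _∣?_)
open import Data.Nat.ListAction using (sum)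
import Data.Nat.Properties as ℕ
open import Data.Product.Base using (_×_; _,_; ∃-syntax)
open import Data.Vec.Base as Vec using (Vec; tabulate)
open import Function.Bundles using (_⇔_)
open import Level using (0ℓ)
open import Relation.Binary.Construct.Closure.ReflexiveTransitive using (Star)
open import Relation.Binary.PropositionalEquality using (_≡_; _≗_)
open import Relation.Nullary using (¬_; ¬?; _×-dec_)
open import Relation.Unary using (Pred; _⊆_; _∖_; _∩_; Decidable)
open import Algebra.Properties.Semiring.Sum ℤ.+-*-semiring using (sum⁺-syntax)

Odd : Pred ℕ 0ℓ
Odd n = ¬ (2 ∣ n)

odd? : Decidable Odd
odd? n = ¬? (2 ∣? n)

record Partition : Set where
  field
    parts      : List ℕ
    positive   : All (0 <_) parts
    decreasing : Linked _≥_ parts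

open Partition public

size : Partition → ℕ
size p = sum (parts p)

-- Rows and columns of Young diagrams are numbered from 0; rows beyond the
-- last part have length 0.
row : List ℕ → ℕ → ℕ
row []       _       = 0
row (x ∷ _)  zero    = x
row (_ ∷ xs) (suc i) = row xs i

Cell : Set
Cell = ℕ × ℕ

Diagram : Partition → Pred Cell 0ℓ
Diagram p (i , j) = j < row (parts p) i

Rim : Partition → Pred Cell 0ℓ
Rim p (i , j) = Diagram p (i , j) × ¬ Diagram p (suc i , suc j)

-- Two cells sharing an edge.
Adjacent : Cell → Cell → Set
Adjacent (i , j) (i′ , j′) = ∣ i - i′ ∣ + ∣ j - j′ ∣ ≡ 1

Connected : Pred Cell 0ℓ → Set
Connected C = ∀ {c d} → C c → C d → Star (λ a b → C a × C b × Adjacent a b) c d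

-- q is obtained from p by removing a rim hook of length e: the removed cells
-- form a connected subset of the rim of p, and what remains is a diagram.
record RemoveRimHook (e : ℕ) (p q : Partition) : Set where
  field
    contained : Diagram q ⊆ Diagram p
    inRim     : (Diagram p ∖ Diagram q) ⊆ Rim p
    connected : Connected (Diagram p ∖ Diagram q)
    hookSize  : size p ≡ size q + e

-- γ is the e-core of p.
IsCoreOf : ℕ → Partition → Partition → Set
IsCoreOf e γ p = Star (RemoveRimHook e) p γ × (∀ q → ¬ RemoveRimHook e γ q)

IsCore : ℕ → Pred Partition 0ℓ
IsCore e γ = IsCoreOf e γ γ

HasSize : {A : Set} → Pred A 0ℓ → ℕ → Set
HasSize {A} P n =
  ∃[ xs ] (Unique xs × (∀ (x : A) → x ∈ xs ⇔ P x) × length xs ≡ n)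

PowerSeries : Set
PowerSeries = ℕ → ℤ

infixl 6 _⊕_ _⊖_
infixl 7 _⊛_
infixr 8 _^ˢ_
infix  4 _≐1/_

one X : PowerSeries
one zero    = 1ℤ
one (suc _) = 0ℤ
X zero    = 0ℤ
X (suc n) = one n

_⊕_ _⊖_ _⊛_ : PowerSeries → PowerSeries → PowerSeries
(f ⊕ g) n = f n ℤ.+ g n
(f ⊖ g) n = f n ℤ.- g n
(f ⊛ g) n = ∑[ k ≤ n ] (f (toℕ k) ℤ.* g (n ∸ toℕ k))

_^ˢ_ : PowerSeries → ℕ → PowerSeries
f ^ˢ zero  = one
f ^ˢ suc k = f ⊛ f ^ˢ k

-- f = 1/g, i.e. f is the (unique) inverse of g in the commutative ring ℤ⟦x⟧.
_≐1/_ : PowerSeries → PowerSeries → Set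
f ≐1/ g = f ⊛ g ≗ one

genFun : (ℕ → ℕ) → PowerSeries
genFun a w = + a w

module _ (e : ℕ) .{{_ : NonZero e}} where

  -- The weight of p, given its core γ; the division is exact because every
  -- rim hook removed has size e.
  weight : Partition → Partition → ℕ
  weight γ p = (size p ∸ size γ) / e

  -- Parts are indexed from 1 in the condition λⱼ - j ≡ i (mod e), while the
  -- list index j starts at 0.  The remainder lies in [0, e), also for negative
  -- dividends.
  oddSequence : Partition → Vec ℕ e
  oddSequence p = tabulate λ i → length (filter
    (λ j → odd? (lookup (parts p) j)
           ×-dec ((+ lookup (parts p) j ℤ.- + suc (toℕ j)) %ℕ e ℕ.≟ toℕ i))
    (allFin (length (parts p))))

  OddSeqs : Partition → ℕ → Pred (Vec ℕ e) 0ℓ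
  OddSeqs γ w θ =
    ∃[ p ] (IsCoreOf e γ p × weight γ p ≡ w × oddSequence p ≡ θ)

  HasZero : Pred (Vec ℕ e) 0ℓ
  HasZero θ = ∃[ i ] Vec.lookup θ i ≡ 0

  NewOddSeqs : Partition → ℕ → Pred (Vec ℕ e) 0ℓ
  NewOddSeqs γ w θ = OddSeqs γ w θ × (∀ w′ → w′ < w → ¬ OddSeqs γ w′ θ)

  CountsT CountsZ CountsM CountsN : Partition → (ℕ → ℕ) → Set
  CountsT γ T = ∀ w → HasSize (OddSeqs γ w) (T w)
  CountsZ γ Z = ∀ w → HasSize (OddSeqs γ w ∩ HasZero) (Z w)
  CountsM γ M = ∀ w → HasSize (NewOddSeqs γ w) (M w)
  CountsN γ N = ∀ w → HasSize (NewOddSeqs γ w ∩ HasZero) (N w)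

{-# OPTIONS --safe #-}
-- Partitions are placed on an abacus with e runners.  A bead stands for the part given by the
-- number of gaps below it, the numbers of beads on the runners determine the core, and removing a rim hook
-- of length e lowers one bead by one row.  The odd sequences of two blocks are compared as follows.
-- Exchanging two adjacent runners: a row in which exactly one of the two is occupied can be
-- changed without affecting the parity of any other part, and choosing these rows suitably gives a
-- bijection between the odd sequences of the two blocks that does not depend on the weight and
-- keeps the minimum of the two entries.  Adding a bead below all others only rotates the runners.
-- Together these moves connect any two cores, for all weights up to a given W.
--
-- It remains to treat one core, whose runners have lengths far apart compared with W.  There the
-- abacus splits into one zone for each runner k, in which the runners above k are full and those
-- below k are empty.  With h = (e - 1) / 2 the odd sequence becomes a fixed vector plus the sum of
-- y₀, …, y_h, where y_j is added to all entries from 2j on; y_j is a sum of contributions of the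
-- zones 2j - 1 and 2j, each of which is at most the weight of its zone and of the same parity.  So the
-- sequences of weight w are those with y₀ + … + y_h ∈ {w, w - 2, …}, the new ones are those with
-- sum w, and a zero entry means y₀ = 0.
module Submission where

open import Defs
open import Data.Nat.Base using (ℕ; NonZero; _<_; _+_; _∸_; _/_)
open import Data.Product.Base using (_×_; ∃-syntax)

open import Data.Bool.Base using (Bool; true; false; not; _∧_; if_then_else_)
import Data.Bool.Properties as Bool
open import Data.Empty using (⊥; ⊥-elim)
open import Data.Fin.Base using (Fin; zero; suc; toℕ; opposite)
import Data.Fin.Properties as Fin
open import Data.Integer.Base as ℤ using (ℤ; 0ℤ; 1ℤ; -1ℤ)
import Data.Integer.Properties as ℤ
import Data.Integer.Tactic.RingSolver as ℤ-Solver
open import Data.List.Base as List using (List; []; _∷_; _++_; length)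
open import Data.List.Membership.Propositional.Properties using (∈-map⁺; ∈-map⁻; ∈-++⁺ˡ; ∈-++⁺ʳ; ∈-++⁻)
import Data.List.Properties as List
open import Data.List.Relation.Unary.All as All using (All; []; _∷_)
import Data.List.Relation.Unary.All.Properties as All
import Data.List.Relation.Unary.AllPairs as AllPairs
import Data.List.Relation.Unary.Any as Any
open import Data.List.Relation.Unary.Linked as Linked using (Linked; []; [-]; _∷_)
import Data.List.Relation.Unary.Unique.Propositional.Properties as Unique
open import Data.Nat.Base hiding (ℕ; NonZero; _<_; _+_; _∸_; _/_)
open import Data.Nat.DivMod
open import Data.Nat.Divisibility using (_∣_; divides; divides-refl; ∣-refl)
open import Data.Nat.ListAction using (sum)
open import Data.Nat.Properties
open import Data.Nat.Tactic.RingSolver using (solve-∀)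
open import Data.Product.Base using (_,_; ∃₂; proj₁; proj₂)
open import Data.Sum.Base using (_⊎_; inj₁; inj₂; [_,_])
open import Data.Vec.Base as Vec using (Vec; []; _∷_; _∷ʳ_; replicate; toList; zipWith)
import Data.Vec.Properties as Vec
open import Algebra.Properties.CommutativeSemigroup +-commutativeSemigroup
  using () renaming (x∙yz≈y∙xz to +-swap)
open import Function.Base using (_∘_; id)
open import Function.Bundles using (_⇔_; mk⇔; module Equivalence)
open import Function.Construct.Symmetry using (⇔-sym)
open import Level using (0ℓ)
open import Relation.Binary.Construct.Closure.ReflexiveTransitive as Star using (Star; ε; _◅_; _◅◅_)
open import Relation.Binary.PropositionalEquality hiding ([_])
open import Relation.Nullary using (¬_; Dec; yes; no; does; _×-dec_; contradiction)
open import Relation.Unary using (Pred; _∖_)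

-- Newness compares different weights, so one map has to serve all weights up to `W`. The bound
-- enters because a bead in position 0 can be taken away only if there is one, which is certain
-- while each runner has more beads than the weight, and because the reference core is spread out in
-- proportion to the weight. So each weight gets its own reference core; the resulting counts do not
-- mention it. The moves reach every core thus: rotating all runners once adds a bead to each;
-- rotating all but one, which is exchanged with its neighbour before each rotation, adds a bead to
-- each of the others; comparing both changes a single runner by one bead. In the zone of runner `k`
-- every row has `k` empty positions besides the one on that runner. An even `k` leaves the parities
-- of the word on the runner as they are; an odd `k` lets beads and gaps change roles and delays the
-- contribution by one runner. Hence zones 2j - 1 and 2j act on the same entries, and (e + 1) / 2
-- parameters remain.

-- Power series and linear factors of denominators

shift : PowerSeries → PowerSeries
shift f zero    = 0ℤ
shift f (suc n) = f n

-- The scalar allows a single proof for the factors 1 - x and 1 + x.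
_⊕[_]_ : PowerSeries → ℤ → PowerSeries → PowerSeries
(f ⊕[ s ] g) n = f n ℤ.+ s ℤ.* g n

-- The sum in `_⊛_` unfolds by definition: coefficient `suc n` of `f ⊛ g` is `f 0 * g (suc n)` plus
-- coefficient `n` of `(f ∘ suc) ⊛ g`. The inductions on convolutions follow this recursion, with
-- `f` general.
⊛-cong : ∀ f {f′} g {g′} → f ≗ f′ → g ≗ g′ → f ⊛ g ≗ f′ ⊛ g′
⊛-cong f g p q zero    = cong₂ (λ a b → a ℤ.* b ℤ.+ 0ℤ) (p 0) (q 0)
⊛-cong f g p q (suc n) = cong₂ ℤ._+_ (cong₂ ℤ._*_ (p 0) (q (suc n))) (⊛-cong (f ∘ suc) g (p ∘ suc) q n)

⊛-shiftʳ : ∀ f g n → (f ⊛ shift g) (suc n) ≡ (f ⊛ g) n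
⊛-shiftʳ f g zero    = begin
  f 0 ℤ.* g 0 ℤ.+ (f 1 ℤ.* 0ℤ ℤ.+ 0ℤ) ≡⟨ cong (λ a → f 0 ℤ.* g 0 ℤ.+ (a ℤ.+ 0ℤ)) (ℤ.*-zeroʳ (f 1)) ⟩
  f 0 ℤ.* g 0 ℤ.+ 0ℤ                  ∎
  where open ≡-Reasoning
⊛-shiftʳ f g (suc n) = cong (λ a → f 0 ℤ.* g (suc n) ℤ.+ a) (⊛-shiftʳ (f ∘ suc) g n)

⊛-shiftˡ : ∀ f g n → (shift f ⊛ g) (suc n) ≡ (f ⊛ g) n
⊛-shiftˡ f g n = ℤ.+-identityˡ _

shift-⊛ : ∀ f g → f ⊛ shift g ≗ shift f ⊛ g
shift-⊛ f g zero    = cong (ℤ._+ 0ℤ) (ℤ.*-zeroʳ (f 0))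
shift-⊛ f g (suc n) = trans (⊛-shiftʳ f g n) (sym (⊛-shiftˡ f g n))

⊛-zeroˡ : ∀ g → (λ _ → 0ℤ) ⊛ g ≗ (λ _ → 0ℤ)
⊛-zeroˡ g zero    = refl
⊛-zeroˡ g (suc n) = trans (ℤ.+-identityˡ _) (⊛-zeroˡ g n)

⊛-identityˡ : ∀ g → one ⊛ g ≗ g
⊛-identityˡ g zero    = trans (ℤ.+-identityʳ _) (ℤ.*-identityˡ _)
⊛-identityˡ g (suc n) =
  trans (cong₂ ℤ._+_ (ℤ.*-identityˡ (g (suc n))) (⊛-zeroˡ g n)) (ℤ.+-identityʳ _)

⊛-distribʳ : ∀ s f g h → (f ⊕[ s ] g) ⊛ h ≗ (f ⊛ h) ⊕[ s ] (g ⊛ h)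
⊛-distribʳ s f g h zero    = lemma s (f 0) (g 0) (h 0)
  where
  lemma : ∀ s a b c → (a ℤ.+ s ℤ.* b) ℤ.* c ℤ.+ 0ℤ ≡ (a ℤ.* c ℤ.+ 0ℤ) ℤ.+ s ℤ.* (b ℤ.* c ℤ.+ 0ℤ)
  lemma = ℤ-Solver.solve-∀
⊛-distribʳ s f g h (suc n) = trans
  (cong (λ a → (f 0 ℤ.+ s ℤ.* g 0) ℤ.* h (suc n) ℤ.+ a) (⊛-distribʳ s (f ∘ suc) (g ∘ suc) h n))
  (lemma s (f 0) (g 0) (h (suc n)) _ _)
  where
  lemma : ∀ s a b c u v → (a ℤ.+ s ℤ.* b) ℤ.* c ℤ.+ (u ℤ.+ s ℤ.* v) ≡ (a ℤ.* c ℤ.+ u) ℤ.+ s ℤ.* (b ℤ.* c ℤ.+ v)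
  lemma = ℤ-Solver.solve-∀

⊛-distribˡ : ∀ s f g h → f ⊛ (g ⊕[ s ] h) ≗ (f ⊛ g) ⊕[ s ] (f ⊛ h)
⊛-distribˡ s f g h zero    = lemma s (f 0) (g 0) (h 0)
  where
  lemma : ∀ s a b c → a ℤ.* (b ℤ.+ s ℤ.* c) ℤ.+ 0ℤ ≡ (a ℤ.* b ℤ.+ 0ℤ) ℤ.+ s ℤ.* (a ℤ.* c ℤ.+ 0ℤ)
  lemma = ℤ-Solver.solve-∀
⊛-distribˡ s f g h (suc n) = trans
  (cong (λ a → f 0 ℤ.* (g (suc n) ℤ.+ s ℤ.* h (suc n)) ℤ.+ a) (⊛-distribˡ s (f ∘ suc) g h n))
  (lemma s (f 0) (g (suc n)) (h (suc n)) _ _)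
  where
  lemma : ∀ s a b c u v → a ℤ.* (b ℤ.+ s ℤ.* c) ℤ.+ (u ℤ.+ s ℤ.* v) ≡ (a ℤ.* b ℤ.+ u) ℤ.+ s ℤ.* (a ℤ.* c ℤ.+ v)
  lemma = ℤ-Solver.solve-∀

X≗shift : X ≗ shift one
X≗shift zero    = refl
X≗shift (suc n) = refl

one⊖X : one ⊖ X ≗ one ⊕[ -1ℤ ] shift one
one⊖X n = cong (λ a → one n ℤ.+ a) (trans (cong ℤ.-_ (X≗shift n)) (sym (ℤ.-1*i≡-i _)))

one⊕X : one ⊕ X ≗ one ⊕[ 1ℤ ] shift one
one⊕X n = cong (λ a → one n ℤ.+ a) (trans (X≗shift n) (sym (ℤ.*-identityˡ _)))

-- f · (1 + s x) g = (f · (1 + s x)) · g: a linear factor of the denominator is moved to f.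
cancel-factor : ∀ s {L} f f′ g → L ≗ one ⊕[ s ] shift one →
                f ⊕[ s ] shift f ≗ f′ → f′ ≐1/ g → f ≐1/ L ⊛ g
cancel-factor s {L} f f′ g l p q n = begin
  (f ⊛ (L ⊛ g)) n                    ≡⟨ ⊛-cong f (L ⊛ g) (λ _ → refl) (⊛-cong L g l (λ _ → refl)) n ⟩
  (f ⊛ ((one ⊕[ s ] shift one) ⊛ g)) n ≡⟨ ⊛-cong f _ (λ _ → refl) factor n ⟩
  (f ⊛ (g ⊕[ s ] shift g)) n         ≡⟨ ⊛-distribˡ s f g (shift g) n ⟩
  (f ⊛ g) n ℤ.+ s ℤ.* (f ⊛ shift g) n ≡⟨ cong (λ a → (f ⊛ g) n ℤ.+ s ℤ.* a) (shift-⊛ f g n) ⟩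
  (f ⊛ g) n ℤ.+ s ℤ.* (shift f ⊛ g) n ≡⟨ ⊛-distribʳ s f (shift f) g n ⟨
  ((f ⊕[ s ] shift f) ⊛ g) n         ≡⟨ ⊛-cong (f ⊕[ s ] shift f) g p (λ _ → refl) n ⟩
  (f′ ⊛ g) n                         ≡⟨ q n ⟩
  one n                              ∎
  where
  open ≡-Reasoning
  shift-one : shift one ⊛ g ≗ shift g
  shift-one zero    = refl
  shift-one (suc m) = trans (⊛-shiftˡ one g m) (⊛-identityˡ g m)
  factor : (one ⊕[ s ] shift one) ⊛ g ≗ g ⊕[ s ] shift g
  factor m = trans (⊛-distribʳ s one (shift one) g m)
    (cong₂ (λ a b → a ℤ.+ s ℤ.* b) (⊛-identityˡ g m) (shift-one m))

-- Weak compositions of the second argument into as many parts as the first says. The recursion asks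
-- whether the first part is zero, so that multiplying the series for `suc k` by 1 - x gives the
-- series for `k`.
compositions : ℕ → ℕ → ℕ
compositions zero    zero    = 1
compositions zero    (suc w) = 0
compositions (suc k) zero    = compositions k zero
compositions (suc k) (suc w) = compositions k (suc w) + compositions (suc k) w

-- The coefficients of F / (1 - x²), where F is the series of `f`.
everySecond : (ℕ → ℕ) → ℕ → ℕ
everySecond f zero          = f 0
everySecond f (suc zero)    = f 1
everySecond f (suc (suc n)) = f (suc (suc n)) + everySecond f n

genFun-compositions : ∀ k → genFun (compositions k) ≐1/ (one ⊖ X) ^ˢ k
genFun-compositions zero    n = trans (⊛-cong (genFun (compositions 0)) one genFun-0 (λ _ → refl) n) (⊛-identityˡ one n)
  where
  genFun-0 : genFun (compositions 0) ≗ one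
  genFun-0 zero    = refl
  genFun-0 (suc n) = refl
genFun-compositions (suc k) = cancel-factor -1ℤ (genFun (compositions (suc k))) (genFun (compositions k)) ((one ⊖ X) ^ˢ k) one⊖X difference (genFun-compositions k)
  where
  lemma : ∀ a b → a ℤ.+ b ℤ.+ -1ℤ ℤ.* b ≡ a
  lemma = ℤ-Solver.solve-∀
  difference : genFun (compositions (suc k)) ⊕[ -1ℤ ] shift (genFun (compositions (suc k)))
             ≗ genFun (compositions k)
  difference zero    = ℤ.+-identityʳ _
  difference (suc n) = trans
    (cong (λ a → a ℤ.+ -1ℤ ℤ.* genFun (compositions (suc k)) n) (ℤ.pos-+ (compositions k (suc n)) (compositions (suc k) n)))
    (lemma (genFun (compositions k) (suc n)) (genFun (compositions (suc k)) n))

-- Two consecutive alternate sums interleave to a full partial sum of `compositions k`, and these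
-- partial sums are `compositions (suc k)`. So multiplication by 1 + x suffices and 1 - x² never
-- appears.
genFun-everySecond : ∀ k → genFun (everySecond (compositions k)) ≐1/ (one ⊕ X) ⊛ (one ⊖ X) ^ˢ suc k
genFun-everySecond k = cancel-factor 1ℤ (genFun t) (genFun (compositions (suc k))) ((one ⊖ X) ^ˢ suc k) one⊕X
  (λ n → trans (ints n) (cong (λ a → ℤ.+ a) (nats n))) (genFun-compositions (suc k))
  where
  t = everySecond (compositions k)
  t⁻ : ℕ → ℕ
  t⁻ zero    = 0
  t⁻ (suc n) = t n
  nats : ∀ n → t n + t⁻ n ≡ compositions (suc k) n
  nats zero          = +-identityʳ _
  nats (suc zero)    = refl
  nats (suc (suc n)) = trans (lemma (compositions k (suc (suc n))) (t n) (t (suc n)))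
    (cong (compositions k (suc (suc n)) +_) (nats (suc n)))
    where
    open import Data.Nat.Tactic.RingSolver
    lemma : ∀ a b c → a + b + c ≡ a + (c + b)
    lemma = solve-∀
  ints : ∀ n → (genFun t ⊕[ 1ℤ ] shift (genFun t)) n ≡ genFun (λ m → t m + t⁻ m) n
  ints zero    = refl
  ints (suc n) = trans (cong (λ a → genFun t (suc n) ℤ.+ a) (ℤ.*-identityˡ (genFun t n))) (sym (ℤ.pos-+ (t (suc n)) (t n)))

-- Cardinalities of finite sets

module _ {A : Set} where

  HasSize-resp-⇔ : ∀ {P Q : Pred A 0ℓ} {n} → (∀ x → P x ⇔ Q x) → HasSize P n → HasSize Q n
  HasSize-resp-⇔ P⇔Q (xs , u , mem , len) =
    xs , u , (λ x → mk⇔ (to (P⇔Q x) ∘ to (mem x)) (from (mem x) ∘ from (P⇔Q x))) , len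
    where open Equivalence

  HasSize-⊎ : ∀ {P Q : Pred A 0ℓ} {m n} → (∀ {x} → P x → ¬ Q x) →
              HasSize P m → HasSize Q n → HasSize (λ x → P x ⊎ Q x) (m + n)
  HasSize-⊎ P∩Q=∅ (xs , u , mem , len) (ys , u′ , mem′ , len′) =
    xs ++ ys ,
    Unique.++⁺ u u′ (λ (x∈xs , x∈ys) → P∩Q=∅ (to (mem _) x∈xs) (to (mem′ _) x∈ys)) ,
    (λ x → mk⇔ (λ x∈ → [ inj₁ ∘ to (mem x) , inj₂ ∘ to (mem′ x) ] (∈-++⁻ xs x∈))
               [ ∈-++⁺ˡ ∘ from (mem x) , ∈-++⁺ʳ xs ∘ from (mem′ x) ]) ,
    trans (List.length-++ xs) (cong₂ _+_ len len′)
    where open Equivalence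

HasSize-image : ∀ {A B : Set} {P : Pred A 0ℓ} {n} (f : A → B) → (∀ {x y} → f x ≡ f y → x ≡ y) →
                HasSize P n → HasSize (λ y → ∃[ x ] (P x × f x ≡ y)) n
HasSize-image f f-inj (xs , u , mem , len) =
  List.map f xs , Unique.map⁺ f-inj u ,
  (λ y → mk⇔ (λ y∈ → let x , x∈ , eq = ∈-map⁻ f y∈ in x , to (mem x) x∈ , sym eq)
             (λ { (x , Px , refl) → ∈-map⁺ f (from (mem x) Px) })) ,
  trans (List.length-map f xs) len
  where open Equivalence

HasSize-∅ : ∀ {A : Set} {P : Pred A 0ℓ} → (∀ x → ¬ P x) → HasSize P 0
HasSize-∅ ¬P = [] , AllPairs.[] , (λ x → mk⇔ (λ ()) (⊥-elim ∘ ¬P x)) , refl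

HasSize-compositions : ∀ k w → HasSize (λ (v : Vec ℕ k) → Vec.sum v ≡ w) (compositions k w)
HasSize-compositions zero zero =
  [] ∷ [] , All.[] AllPairs.∷ AllPairs.[] , (λ { [] → mk⇔ (λ _ → refl) (λ _ → Any.here refl) }) , refl
HasSize-compositions zero (suc w) = HasSize-∅ λ { [] () }
HasSize-compositions (suc k) zero =
  HasSize-resp-⇔ (λ { (x ∷ v) → mk⇔ (λ { (_ , p , refl) → p }) (back x v) })
    (HasSize-image (0 ∷_) (λ { refl → refl }) (HasSize-compositions k zero))
  where
  back : ∀ x (v : Vec ℕ k) → x + Vec.sum v ≡ 0 → ∃[ u ] (Vec.sum u ≡ 0 × 0 ∷ u ≡ x ∷ v)
  back zero v p = v , p , refl
HasSize-compositions (suc k) (suc w) =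
  HasSize-resp-⇔ (λ v → mk⇔ forth (back v))
    (HasSize-⊎ (λ { (_ , _ , refl) ((_ ∷ _) , _ , ()) })
      (HasSize-image (0 ∷_) (λ { refl → refl }) (HasSize-compositions k (suc w)))
      (HasSize-image suc-head suc-head-injective (HasSize-compositions (suc k) w)))
  where
  suc-head : Vec ℕ (suc k) → Vec ℕ (suc k)
  suc-head (x ∷ v) = suc x ∷ v
  suc-head-injective : ∀ {u v} → suc-head u ≡ suc-head v → u ≡ v
  suc-head-injective {_ ∷ _} {_ ∷ _} refl = refl
  forth : ∀ {v} → ∃[ u ] (Vec.sum u ≡ suc w × 0 ∷ u ≡ v) ⊎ ∃[ u ] (Vec.sum u ≡ w × suc-head u ≡ v) → Vec.sum v ≡ suc w
  forth (inj₁ (_ , p , refl))       = p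
  forth (inj₂ ((_ ∷ _) , p , refl)) = cong suc p
  back : ∀ v → Vec.sum v ≡ suc w → ∃[ u ] (Vec.sum u ≡ suc w × 0 ∷ u ≡ v) ⊎ ∃[ u ] (Vec.sum u ≡ w × suc-head u ≡ v)
  back (zero  ∷ v) p = inj₁ (v , p , refl)
  back (suc x ∷ v) p = inj₂ (x ∷ v , suc-injective p , refl)

-- Since `k` is determined by `x`, the sets with `f x` equal to w, w - 2 and so on are disjoint, as
-- the recursion of `everySecond` needs.
HasSize-everySecond : ∀ {A : Set} (f : A → ℕ) (c : ℕ → ℕ) → (∀ w → HasSize (λ x → f x ≡ w) (c w)) →
                      ∀ w → HasSize (λ x → ∃[ k ] f x + (k + k) ≡ w) (everySecond c w)
HasSize-everySecond f c size zero =
  HasSize-resp-⇔ (λ x → mk⇔ (λ p → 0 , trans (+-identityʳ _) p)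
    (λ { (zero , p) → trans (sym (+-identityʳ _)) p
       ; (suc k , p) → ⊥-elim (case-0 (f x) p) })) (size 0)
  where
  case-0 : ∀ n {k} → n + suc k ≡ 0 → ⊥
  case-0 zero    ()
  case-0 (suc n) ()
HasSize-everySecond f c size (suc zero) =
  HasSize-resp-⇔ (λ x → mk⇔ (λ p → 0 , trans (+-identityʳ _) p)
    (λ { (zero , p) → trans (sym (+-identityʳ _)) p
       ; (suc k , p) → ⊥-elim (case-1 (f x) k p) })) (size 1)
  where
  case-1 : ∀ n k → n + suc (k + suc k) ≡ 1 → ⊥
  case-1 n k p with trans (sym (cong (n +_) (cong suc (+-suc k k)))) p
  ... | q rewrite +-suc n (suc (k + k)) | +-suc n (k + k) with q
  ... | ()
HasSize-everySecond f c size (suc (suc w)) =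
  HasSize-resp-⇔ (λ x → mk⇔
    (λ { (inj₁ p) → 0 , trans (+-identityʳ _) p
       ; (inj₂ (k , p)) → suc k , trans (step (f x) k) (cong (2 +_) p) })
    (λ { (zero , p) → inj₁ (trans (sym (+-identityʳ _)) p)
       ; (suc k , p) → inj₂ (k , suc-injective (suc-injective (trans (sym (step (f x) k)) p))) }))
    (HasSize-⊎ (λ {x} p (k , q) → larger (f x) k p q) (size (suc (suc w))) (HasSize-everySecond f c size w))
  where
  step : ∀ n k → n + (suc k + suc k) ≡ suc (suc (n + (k + k)))
  step n k rewrite +-suc k k | +-suc n (suc (k + k)) | +-suc n (k + k) = refl
  larger : ∀ n k → n ≡ suc (suc w) → n + (k + k) ≡ w → ⊥
  larger _ k refl q = m+n≢n′ q
    where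
    open import Data.Nat.Properties using (m≢1+m+n)
    m+n≢n′ : ∀ {j} → suc (suc w) + j ≡ w → ⊥
    m+n≢n′ {j} eq = m≢1+m+n w (sym (trans (cong suc (+-suc w j)) eq))

-- Abaci: beads, levels and odd parts

-- Rows are listed from the top of the abacus down, and the runners of a row from the last to
-- the first, so that the beads after a given one are those in smaller positions.  A bead stands
-- for a part equal to the number of gaps after it.
Abacus : ℕ → Set
Abacus n = List (Vec Bool n)

bit : Bool → ℕ
bit true  = 1
bit false = 0

trues : ∀ {n} → Vec Bool n → ℕ
trues []      = 0
trues (x ∷ v) = bit x + trues v

gapParityRow : ∀ {n} → Vec Bool n → Bool → Bool
gapParityRow []      g = g
gapParityRow (x ∷ v) g = if x then gapParityRow v g else not (gapParityRow v g)

gapParity : ∀ {n} → Abacus n → Bool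
gapParity []      = false
gapParity (r ∷ M) = gapParityRow r (gapParity M)

infixl 6 _+ᵥ_

_+ᵥ_ : ∀ {n} → Vec ℕ n → Vec ℕ n → Vec ℕ n
_+ᵥ_ = zipWith _+_

oddsRow : ∀ {n} → Bool → Vec Bool n → Vec ℕ n
oddsRow g []      = []
oddsRow g (x ∷ v) = bit (x ∧ gapParityRow v g) ∷ oddsRow g v

odds beads : ∀ {n} → Abacus n → Vec ℕ n
odds []      = replicate _ 0
odds (r ∷ M) = oddsRow (gapParity M) r +ᵥ odds M
beads []      = replicate _ 0
beads (r ∷ M) = Vec.map bit r +ᵥ beads M

-- The height of a row is the number of rows after it, so this adds up the heights of all beads. A
-- bead lowered by one row lowers the sum by one.
levels : ∀ {n} → Abacus n → ℕ
levels []      = 0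
levels (r ∷ M) = length M * trues r + levels M

triangle : ℕ → ℕ
triangle zero    = 0
triangle (suc n) = n + triangle n

triangles : ∀ {n} → Vec ℕ n → ℕ
triangles []      = 0
triangles (x ∷ v) = triangle x + triangles v

-- triangles d is the least sum of levels of d beads, attained by the core.
record Realises {n} (d : Vec ℕ n) (w : ℕ) (θ : Vec ℕ n) (M : Abacus n) : Set where
  constructor realises
  field
    beads≡  : beads M ≡ d
    levels≡ : levels M ≡ w + triangles d
    odds≡   : odds M ≡ θ

Realisable : ∀ {n} → Vec ℕ n → ℕ → Vec ℕ n → Set
Realisable d w θ = ∃[ M ] Realises d w θ M

Zero : ∀ {n} → Vec ℕ n → Set
Zero θ = ∃[ i ] Vec.lookup θ i ≡ 0

-- Exchanging two adjacent runners

-- Length and gap parity are prescribed as well because the next row above reads both of them, as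
-- its height and as the parity its own parts start from.
Rearrangements : ∀ {n} (len : ℕ) (g : Bool) (lev p p₁ s₁ s₀ : ℕ) (ds os : Vec ℕ n) → Set
Rearrangements len g lev p p₁ s₁ s₀ ds os =
  ∀ l₁ r₁ l₀ r₀ → l₁ + r₁ ≡ s₁ → l₀ + r₀ ≡ s₀ → ∃[ M ]
    ( length M ≡ len × gapParity M ≡ g × levels M ≡ lev
    × beads M ≡ (r₁ + r₀ + p) ∷ (l₁ + l₀ + p) ∷ ds
    × odds M ≡ (r₀ + p₁) ∷ (l₁ + p₁) ∷ os )

-- Of two adjacent positions exactly one of which is occupied, the bead can be put in either: no
-- other bead changes the parity of its part, but this one does.  The l and r count such beads
-- according to their position and, in the index, to the parity of the gaps that precede both
-- positions; these sums l₁ + r₁ and l₀ + r₀ are all that constrains the choices.  p counts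
-- the pairs of adjacent beads, p₁ those with odd parts.
record RunnerPair {n} (M : Abacus (2 + n)) : Set where
  constructor runnerPair
  field
    {p p₁ l₁ r₁ l₀ r₀} : ℕ
    {ds os} : Vec ℕ n
    beads≡ : beads M ≡ (r₁ + r₀ + p) ∷ (l₁ + l₀ + p) ∷ ds
    odds≡  : odds M ≡ (r₀ + p₁) ∷ (l₁ + p₁) ∷ os
    rearrange : Rearrangements (length M) (gapParity M) (levels M) p p₁ (l₁ + r₁) (l₀ + r₀) ds os

module _ {n} (v : Vec Bool n) where

  private
    trues₂ : Bool → Bool → ℕ
    trues₂ x y = bit x + (bit y + trues v)

  beads-∷ : ∀ x y (M : Abacus (2 + n)) {a b ds} → beads M ≡ a ∷ b ∷ ds →
            beads ((x ∷ y ∷ v) ∷ M) ≡ (bit x + a) ∷ (bit y + b) ∷ (Vec.map bit v +ᵥ ds)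
  beads-∷ x y M eq rewrite eq = refl

  odds-∷ : ∀ x y (M : Abacus (2 + n)) {a b os q g} → gapParity M ≡ q → gapParityRow v q ≡ g →
           odds M ≡ a ∷ b ∷ os → odds ((x ∷ y ∷ v) ∷ M) ≡
             (bit (x ∧ (if y then g else not g)) + a) ∷ (bit (y ∧ g) + b) ∷ (oddsRow q v +ᵥ os)
  odds-∷ x y M refl refl eq rewrite eq = refl

  gapParity-∷ : ∀ x y (M : Abacus (2 + n)) {q g} → gapParity M ≡ q → gapParityRow v q ≡ g →
                gapParity ((x ∷ y ∷ v) ∷ M) ≡ (if x then (if y then g else not g) else not (if y then g else not g))
  gapParity-∷ x y M refl refl = refl

  levels-∷ : ∀ x y (M : Abacus (2 + n)) {len lev} → length M ≡ len → levels M ≡ lev →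
             levels ((x ∷ y ∷ v) ∷ M) ≡ len * trues₂ x y + lev
  levels-∷ x y M refl refl = refl

∷∷-cong : ∀ {n} {a a′ b b′ : ℕ} {v : Vec ℕ n} → a ≡ a′ → b ≡ b′ → _≡_ {A = Vec ℕ (2 + n)} (a ∷ b ∷ v) (a′ ∷ b′ ∷ v)
∷∷-cong refl refl = refl

private
  +₃-suc : ∀ a b c → a + suc b + c ≡ suc (a + b + c)
  +₃-suc = solve-∀

  +₃-suc′ : ∀ a b c → a + b + suc c ≡ suc (a + b + c)
  +₃-suc′ = solve-∀

rearrange-pair : ∀ {n} (v : Vec Bool n) {len q g lev p p₁ s₁ s₀ ds os} → gapParityRow v q ≡ g →
  Rearrangements len q lev p p₁ s₁ s₀ ds os →
  Rearrangements (suc len) g (len * (2 + trues v) + lev) (suc p) (bit g + p₁) s₁ s₀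
    (Vec.map bit v +ᵥ ds) (oddsRow q v +ᵥ os)
rearrange-pair v {g = g} {p = p} {p₁ = p₁} gv c l₁ r₁ l₀ r₀ e₁ e₀ =
  let M , len , par , lev , bs , os = c l₁ r₁ l₀ r₀ e₁ e₀ in
  (true ∷ true ∷ v) ∷ M , cong suc len , gapParity-∷ v true true M par gv ,
  levels-∷ v true true M len lev ,
  trans (beads-∷ v true true M bs)
    (∷∷-cong (sym (+₃-suc′ r₁ r₀ p)) (sym (+₃-suc′ l₁ l₀ p))) ,
  trans (odds-∷ v true true M par gv os)
    (∷∷-cong (+-swap (bit g) r₀ p₁) (+-swap (bit g) l₁ p₁))

rearrange-gap : ∀ {n} (v : Vec Bool n) {len q g lev p p₁ s₁ s₀ ds os} → gapParityRow v q ≡ g →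
  Rearrangements len q lev p p₁ s₁ s₀ ds os →
  Rearrangements (suc len) (not (not g)) (len * trues v + lev) p p₁ s₁ s₀
    (Vec.map bit v +ᵥ ds) (oddsRow q v +ᵥ os)
rearrange-gap v {g = g} gv c l₁ r₁ l₀ r₀ e₁ e₀ =
  let M , len , par , lev , bs , os = c l₁ r₁ l₀ r₀ e₁ e₀ in
  (false ∷ false ∷ v) ∷ M , cong suc len , gapParity-∷ v false false M par gv ,
  levels-∷ v false false M len lev ,
  beads-∷ v false false M bs ,
  odds-∷ v false false M par gv os

-- The gaps after both positions are odd in number, so the bead has an odd part in the second
-- position and, above one more gap, an even part in the first. Either way the row adds the same
-- number of gaps, so the rows above notice nothing.
rearrange-single₁ : ∀ {n} (v : Vec Bool n) {len q lev p p₁ s₁ s₀ ds os} → gapParityRow v q ≡ true →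
  Rearrangements len q lev p p₁ s₁ s₀ ds os →
  Rearrangements (suc len) false (len * (1 + trues v) + lev) p p₁ (suc s₁) s₀
    (Vec.map bit v +ᵥ ds) (oddsRow q v +ᵥ os)
rearrange-single₁ v gv c (suc l₁) r₁ l₀ r₀ e₁ e₀ =
  let M , len , par , lev , bs , os = c l₁ r₁ l₀ r₀ (suc-injective e₁) e₀ in
  (false ∷ true ∷ v) ∷ M , cong suc len , gapParity-∷ v false true M par gv ,
  levels-∷ v false true M len lev ,
  beads-∷ v false true M bs ,
  odds-∷ v false true M par gv os
rearrange-single₁ v gv c zero (suc r₁) l₀ r₀ e₁ e₀ =
  let M , len , par , lev , bs , os = c zero r₁ l₀ r₀ (suc-injective e₁) e₀ in
  (true ∷ false ∷ v) ∷ M , cong suc len , gapParity-∷ v true false M par gv ,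
  levels-∷ v true false M len lev ,
  beads-∷ v true false M bs ,
  odds-∷ v true false M par gv os

-- Now the first position is the one with an odd part; so of the four numbers `odds` sees only `l₁`
-- and `r₀`.
rearrange-single₀ : ∀ {n} (v : Vec Bool n) {len q lev p p₁ s₁ s₀ ds os} → gapParityRow v q ≡ false →
  Rearrangements len q lev p p₁ s₁ s₀ ds os →
  Rearrangements (suc len) true (len * (1 + trues v) + lev) p p₁ s₁ (suc s₀)
    (Vec.map bit v +ᵥ ds) (oddsRow q v +ᵥ os)
rearrange-single₀ v {p = p} gv c l₁ r₁ (suc l₀) r₀ e₁ e₀ =
  let M , len , par , lev , bs , os = c l₁ r₁ l₀ r₀ e₁ (suc-injective e₀) in
  (false ∷ true ∷ v) ∷ M , cong suc len , gapParity-∷ v false true M par gv ,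
  levels-∷ v false true M len lev ,
  trans (beads-∷ v false true M bs) (∷∷-cong refl (sym (+₃-suc l₁ l₀ p))) ,
  odds-∷ v false true M par gv os
rearrange-single₀ v {p = p} gv c l₁ r₁ zero (suc r₀) e₁ e₀ =
  let M , len , par , lev , bs , os = c l₁ r₁ zero r₀ e₁ (suc-injective e₀) in
  (true ∷ false ∷ v) ∷ M , cong suc len , gapParity-∷ v true false M par gv ,
  levels-∷ v true false M len lev ,
  trans (beads-∷ v true false M bs) (∷∷-cong (sym (+₃-suc r₁ r₀ p)) refl) ,
  odds-∷ v true false M par gv os

decompose-pair : ∀ {n} (M : Abacus (2 + n)) → RunnerPair M
decompose-pair [] = runnerPair {p = 0} {0} {0} {0} {0} {0} refl refl
  λ { zero zero zero zero refl refl → [] , refl , refl , refl , refl , refl }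
decompose-pair {n} ((x ∷ y ∷ v) ∷ M) with decompose-pair M
... | runnerPair {p} {p₁} {l₁} {r₁} {l₀} {r₀} {ds} {os} bs eq c =
  step (gapParityRow v (gapParity M)) refl x y
  where
  parity-to : ∀ {g s₁ s₀} p p₁ {k} x y → gapParity ((x ∷ y ∷ v) ∷ M) ≡ g →
    Rearrangements (suc (length M)) g (length M * k + levels M) p p₁ s₁ s₀
      (Vec.map bit v +ᵥ ds) (oddsRow (gapParity M) v +ᵥ os) →
    Rearrangements (suc (length M)) (gapParity ((x ∷ y ∷ v) ∷ M)) (length M * k + levels M) p p₁ s₁ s₀
      (Vec.map bit v +ᵥ ds) (oddsRow (gapParity M) v +ᵥ os)
  parity-to p p₁ x y q = subst (λ g → Rearrangements _ g _ p p₁ _ _ _ _) (sym q)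
  step : ∀ g → gapParityRow v (gapParity M) ≡ g → ∀ x y → RunnerPair ((x ∷ y ∷ v) ∷ M)
  step g gv true true = runnerPair {l₁ = l₁} {r₁} {l₀} {r₀}
    (trans (beads-∷ v true true M bs)
      (∷∷-cong (sym (+₃-suc′ r₁ r₀ p)) (sym (+₃-suc′ l₁ l₀ p))))
    (trans (odds-∷ v true true M refl gv eq)
      (∷∷-cong (+-swap (bit g) r₀ p₁) (+-swap (bit g) l₁ p₁)))
    (parity-to (suc p) (bit g + p₁) true true (gapParity-∷ v true true M refl gv) (rearrange-pair v gv c))
  step g gv false false = runnerPair {l₁ = l₁} {r₁} {l₀} {r₀}
    (beads-∷ v false false M bs) (odds-∷ v false false M refl gv eq)
    (parity-to p p₁ false false (gapParity-∷ v false false M refl gv) (rearrange-gap v gv c))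
  step true gv false true = runnerPair {l₁ = suc l₁} {r₁} {l₀} {r₀}
    (beads-∷ v false true M bs) (odds-∷ v false true M refl gv eq)
    (parity-to p p₁ false true (gapParity-∷ v false true M refl gv) (rearrange-single₁ v gv c))
  step true gv true false = runnerPair {l₁ = l₁} {suc r₁} {l₀} {r₀}
    (beads-∷ v true false M bs) (odds-∷ v true false M refl gv eq)
    (subst (λ s → Rearrangements (suc (length M)) (gapParity ((true ∷ false ∷ v) ∷ M)) (levels ((true ∷ false ∷ v) ∷ M)) p p₁ s (l₀ + r₀) (Vec.map bit v +ᵥ ds) (oddsRow (gapParity M) v +ᵥ os)) (sym (+-suc l₁ r₁))
      (parity-to p p₁ true false (gapParity-∷ v true false M refl gv) (rearrange-single₁ v gv c)))
  step false gv false true = runnerPair {l₁ = l₁} {r₁} {suc l₀} {r₀}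
    (trans (beads-∷ v false true M bs) (∷∷-cong refl (sym (+₃-suc l₁ l₀ p))))
    (odds-∷ v false true M refl gv eq)
    (parity-to p p₁ false true (gapParity-∷ v false true M refl gv) (rearrange-single₀ v gv c))
  step false gv true false = runnerPair {l₁ = l₁} {r₁} {l₀} {suc r₀}
    (trans (beads-∷ v true false M bs) (∷∷-cong (sym (+₃-suc r₁ r₀ p)) refl))
    (odds-∷ v true false M refl gv eq)
    (subst (λ s → Rearrangements (suc (length M)) (gapParity ((true ∷ false ∷ v) ∷ M)) (levels ((true ∷ false ∷ v) ∷ M)) p p₁ (l₁ + r₁) s (Vec.map bit v +ᵥ ds) (oddsRow (gapParity M) v +ᵥ os)) (sym (+-suc l₀ r₀))
      (parity-to p p₁ true false (gapParity-∷ v true false M refl gv) (rearrange-single₀ v gv c)))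

∸-cross : ∀ s t → (s ∸ t) + t ≡ (t ∸ s) + s
∸-cross zero    zero    = refl
∸-cross zero    (suc t) = cong suc (sym (+-identityʳ t))
∸-cross (suc s) zero    = cong suc (+-identityʳ s)
∸-cross (suc s) (suc t) = trans (+-suc (s ∸ t) t) (trans (cong suc (∸-cross s t)) (sym (+-suc (t ∸ s) s)))

∸-⊓-∸ : ∀ s t → (s ∸ t) ⊓ (t ∸ s) ≡ 0
∸-⊓-∸ zero    zero    = refl
∸-⊓-∸ zero    (suc t) = refl
∸-⊓-∸ (suc s) zero    = refl
∸-⊓-∸ (suc s) (suc t) = ∸-⊓-∸ s t

-- Each number is the minimum plus a truncated difference, and the crosswise equation fixes both
-- truncated differences.
pair-unique : ∀ {a b a′ b′} → a ⊓ b ≡ a′ ⊓ b′ → a + b′ ≡ a′ + b → a ≡ a′ × b ≡ b′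
pair-unique {a} {b} {a′} {b′} min diff =
  trans (sym (left a b)) (trans (cong₂ _+_ min ∸-eq) (left a′ b′)) ,
  trans (sym (m⊓n+n∸m≡n a b)) (trans (cong₂ _+_ min ∸-eq′) (m⊓n+n∸m≡n a′ b′))
  where
  left : ∀ m n → m ⊓ n + (m ∸ n) ≡ m
  left m n = trans (cong (_+ (m ∸ n)) (⊓-comm m n)) (m⊓n+n∸m≡n n m)
  cancel : ∀ m n o → (m + o) ∸ (n + o) ≡ m ∸ n
  cancel m n o = trans (cong₂ _∸_ (+-comm m o) (+-comm n o)) ([m+n]∸[m+o]≡n∸o o m n)
  ∸-eq : a ∸ b ≡ a′ ∸ b′
  ∸-eq = trans (sym (cancel a b b′)) (trans (cong₂ _∸_ diff (+-comm b b′)) (cancel a′ b′ b))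
  ∸-eq′ : b ∸ a ≡ b′ ∸ a′
  ∸-eq′ = trans (sym (cancel b a b′)) (trans (cong₂ _∸_ (+-comm b b′) diff) (cancel b′ a′ b))

⊓≡0 : ∀ m n → m ⊓ n ≡ 0 → m ≡ 0 ⊎ n ≡ 0
⊓≡0 zero    n       _ = inj₁ refl
⊓≡0 (suc m) zero    _ = inj₂ refl

-- The exchange keeps the minimum of the two entries and moves their difference by y - x.
exchange : ∀ {n} → ℕ → ℕ → Vec ℕ (2 + n) → Vec ℕ (2 + n)
exchange x y (a ∷ b ∷ os) =
  (a ⊓ b + ((a + y) ∸ (b + x))) ∷ (a ⊓ b + ((b + x) ∸ (a + y))) ∷ os

-- Minimum and difference characterise the exchanged pair, so that for a rearranged abacus only
-- these two have to be checked.
exchange-unique : ∀ {n} x y a b {a′ b′} {os : Vec ℕ n} → a′ ⊓ b′ ≡ a ⊓ b → a′ + (b + x) ≡ b′ + (a + y) →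
                  exchange x y (a ∷ b ∷ os) ≡ a′ ∷ b′ ∷ os
exchange-unique x y a b {a′} {b′} min diff =
  let p , q = pair-unique {a ⊓ b + (s ∸ t)} {a ⊓ b + (t ∸ s)} {a′} {b′}
        (trans (sym (+-distribˡ-⊓ (a ⊓ b) (s ∸ t) (t ∸ s)))
          (trans (cong (a ⊓ b +_) (∸-⊓-∸ s t)) (trans (+-identityʳ _) (sym min))))
        (+-cancelʳ-≡ t _ _ cross)
  in ∷∷-cong p q
  where
  s = a + y
  t = b + x
  regroup : ∀ m u v w → m + u + v + w ≡ m + v + (u + w)
  regroup = solve-∀
  cross : a ⊓ b + (s ∸ t) + b′ + t ≡ a′ + (a ⊓ b + (t ∸ s)) + t
  cross = begin
    a ⊓ b + (s ∸ t) + b′ + t     ≡⟨ regroup (a ⊓ b) (s ∸ t) b′ t ⟩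
    a ⊓ b + b′ + (s ∸ t + t)     ≡⟨ cong (a ⊓ b + b′ +_) (∸-cross s t) ⟩
    a ⊓ b + b′ + (t ∸ s + s)     ≡⟨ regroup′ (a ⊓ b) b′ (t ∸ s) s ⟩
    a ⊓ b + (t ∸ s) + (b′ + s)   ≡⟨ cong (a ⊓ b + (t ∸ s) +_) diff ⟨
    a ⊓ b + (t ∸ s) + (a′ + t)   ≡⟨ regroup″ (a ⊓ b + (t ∸ s)) a′ t ⟩
    a′ + (a ⊓ b + (t ∸ s)) + t   ∎
    where
    open ≡-Reasoning
    regroup′ : ∀ m u v w → m + u + (v + w) ≡ m + v + (u + w)
    regroup′ = solve-∀
    regroup″ : ∀ m u v → m + (u + v) ≡ u + m + v
    regroup″ = solve-∀

exchange-min : ∀ a b s t → (a ⊓ b + (s ∸ t)) ⊓ (a ⊓ b + (t ∸ s)) ≡ a ⊓ b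
exchange-min a b s t = trans (sym (+-distribˡ-⊓ (a ⊓ b) (s ∸ t) (t ∸ s)))
  (trans (cong (a ⊓ b +_) (∸-⊓-∸ s t)) (+-identityʳ _))

exchange-involutive : ∀ {n} x y (θ : Vec ℕ (2 + n)) → exchange y x (exchange x y θ) ≡ θ
exchange-involutive x y (a ∷ b ∷ os) =
  exchange-unique y x (a ⊓ b + (s ∸ t)) (a ⊓ b + (t ∸ s)) (sym (exchange-min a b s t))
    (begin
      a + (a ⊓ b + (t ∸ s) + y)   ≡⟨ regroup a (a ⊓ b) (t ∸ s) y ⟩
      a ⊓ b + ((t ∸ s) + s)       ≡⟨ cong (a ⊓ b +_) (∸-cross s t) ⟨
      a ⊓ b + ((s ∸ t) + t)       ≡⟨ regroup b (a ⊓ b) (s ∸ t) x ⟨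
      b + (a ⊓ b + (s ∸ t) + x)   ∎)
  where
  open ≡-Reasoning
  s = a + y
  t = b + x
  regroup : ∀ a m u y → a + (m + u + y) ≡ m + (u + (a + y))
  regroup = solve-∀

-- A zero among the two exchanged entries means that their minimum is zero, and the minimum is kept.
exchange-zero : ∀ {n} x y (θ : Vec ℕ (2 + n)) → Zero θ → Zero (exchange x y θ)
exchange-zero {n} x y (a ∷ b ∷ os) = λ
  { (zero , p)        → zero-min (cong (_⊓ b) p)
  ; (suc zero , p)    → zero-min (trans (cong (a ⊓_) p) (⊓-zeroʳ a))
  ; (suc (suc i) , p) → suc (suc i) , p }
  where
  zero-min : a ⊓ b ≡ 0 → Zero (exchange x y (a ∷ b ∷ os))
  zero-min p with ⊓≡0 _ _ (trans (exchange-min a b (a + y) (b + x)) p)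
  ... | inj₁ q = zero , q
  ... | inj₂ q = suc zero , q

-- The prescribed sums force r₀′ - l₁′ = l₀ - r₁ and leave one degree of freedom, which the minimum
-- fixes. The case distinctions decide which of `l₁`, `r₀` is the minimum and which sign the
-- difference has. Reflecting every single row would keep the sums but not the minimum.
balance : ∀ l₁ r₁ l₀ r₀ → ∃[ l₁′ ] ∃[ r₁′ ] ∃[ l₀′ ] ∃[ r₀′ ]
  ( l₁′ + r₁′ ≡ l₁ + r₁ × l₀′ + r₀′ ≡ l₀ + r₀
  × l₁′ + l₀′ ≡ r₁ + r₀ × r₁′ + r₀′ ≡ l₁ + l₀ × r₀′ ⊓ l₁′ ≡ r₀ ⊓ l₁ )
balance l₁ r₁ l₀ r₀ with ≤-total l₁ r₀ | ≤-total l₀ r₁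
... | inj₁ p | inj₁ q with m≤n⇒∃[o]m+o≡n p | m≤n⇒∃[o]m+o≡n q
...   | u , refl | v , refl = l₁ + v , l₀ , l₀ + u , l₁ , e₁ l₁ l₀ v , e₁ l₀ l₁ u , e₃ l₁ v l₀ u , +-comm l₀ l₁ ,
        trans (m≤n⇒m⊓n≡m (m≤m+n l₁ v)) (sym (m≥n⇒m⊓n≡n p))
  where
  e₁ : ∀ a b c → a + c + b ≡ a + (b + c)
  e₁ = solve-∀
  e₃ : ∀ a b c d → a + b + (c + d) ≡ c + b + (a + d)
  e₃ = solve-∀
balance l₁ r₁ l₀ r₀ | inj₁ p | inj₂ q with m≤n⇒∃[o]m+o≡n p | m≤n⇒∃[o]m+o≡n q
...   | u , refl | v , refl = l₁ , r₁ , r₁ + u , l₁ + v , refl , e₁ r₁ u l₁ v , +-swap l₁ r₁ u , +-swap r₁ l₁ v ,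
        trans (m≥n⇒m⊓n≡n (m≤m+n l₁ v)) (sym (m≥n⇒m⊓n≡n p))
  where
  e₁ : ∀ a b c d → a + b + (c + d) ≡ a + d + (c + b)
  e₁ = solve-∀
balance l₁ r₁ l₀ r₀ | inj₂ p | inj₁ q with m≤n⇒∃[o]m+o≡n p | m≤n⇒∃[o]m+o≡n q
...   | u , refl | v , refl = r₀ + v , l₀ + u , l₀ , r₀ , e₁ r₀ v l₀ u , refl , e₂ r₀ v l₀ , e₂ l₀ u r₀ ,
        trans (m≤n⇒m⊓n≡m (m≤m+n r₀ v)) (sym (m≤n⇒m⊓n≡m p))
  where
  e₁ : ∀ a b c d → a + b + (c + d) ≡ a + d + (c + b)
  e₁ = solve-∀
  e₂ : ∀ a b c → a + b + c ≡ c + b + a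
  e₂ = solve-∀
balance l₁ r₁ l₀ r₀ | inj₂ p | inj₂ q with m≤n⇒∃[o]m+o≡n p | m≤n⇒∃[o]m+o≡n q
...   | u , refl | v , refl = r₀ , r₁ + u , r₁ , r₀ + v , e₁ r₀ r₁ u , e₁ r₁ r₀ v , +-comm r₀ r₁ , e₃ r₁ u r₀ v ,
        trans (m≥n⇒m⊓n≡n (m≤m+n r₀ v)) (sym (m≤n⇒m⊓n≡m p))
  where
  e₁ : ∀ a b c → a + (b + c) ≡ a + c + b
  e₁ = solve-∀
  e₃ : ∀ a b c d → a + b + (c + d) ≡ c + b + (a + d)
  e₃ = solve-∀

-- The weight is kept since beads move only within their rows, which preserves `levels`, and
-- `triangles` is symmetric in the runners.
exchange-Realisable : ∀ {n} x y {ds : Vec ℕ n} {w θ} →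
  Realisable (x ∷ y ∷ ds) w θ → Realisable (y ∷ x ∷ ds) w (exchange x y θ)
exchange-Realisable x y {w = w} (M , realises bs lev os) with decompose-pair M
... | runnerPair {p} {p₁} {l₁} {r₁} {l₀} {r₀} bs′ os′ c with trans (sym bs) bs′ | trans (sym os) os′
... | refl | refl =
  let l₁′ , r₁′ , l₀′ , r₀′ , e₁ , e₀ , eˡ , eʳ , min = balance l₁ r₁ l₀ r₀
      M′ , _ , _ , lev″ , bs″ , os″ = c l₁′ r₁′ l₀′ r₀′ e₁ e₀
  in M′ , realises
    (trans bs″ (∷∷-cong (cong (_+ p) eʳ) (cong (_+ p) eˡ)))
    (trans lev″ (trans lev (cong (w +_) (+-swap (triangle (r₁ + r₀ + p)) (triangle (l₁ + l₀ + p)) _))))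
    (trans os″ (sym (exchange-unique (r₁ + r₀ + p) (l₁ + l₀ + p) (r₀ + p₁) (l₁ + p₁)
      (trans (sym (+-distribʳ-⊓ p₁ r₀′ l₁′)) (trans (cong (_+ p₁) min) (+-distribʳ-⊓ p₁ r₀ l₁)))
      (difference {l₁′} {r₁′} {l₀′} {r₀′} e₁ e₀ eˡ))))
  where
  difference : ∀ {l₁′ r₁′ l₀′ r₀′} → l₁′ + r₁′ ≡ l₁ + r₁ → l₀′ + r₀′ ≡ l₀ + r₀ → l₁′ + l₀′ ≡ r₁ + r₀ →
    r₀′ + p₁ + (l₁ + p₁ + (r₁ + r₀ + p)) ≡ l₁′ + p₁ + (r₀ + p₁ + (l₁ + l₀ + p))
  difference {l₁′} {r₁′} {l₀′} {r₀′} e₁ e₀ eˡ = begin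
    r₀′ + p₁ + (l₁ + p₁ + (r₁ + r₀ + p))     ≡⟨ cong (λ a → r₀′ + p₁ + (l₁ + p₁ + (a + p))) eˡ ⟨
    r₀′ + p₁ + (l₁ + p₁ + (l₁′ + l₀′ + p))   ≡⟨ g₁ r₀′ p₁ l₁ l₁′ l₀′ p ⟩
    (l₀′ + r₀′) + (l₁′ + p₁ + (p₁ + l₁ + p)) ≡⟨ cong (_+ (l₁′ + p₁ + (p₁ + l₁ + p))) e₀ ⟩
    (l₀ + r₀) + (l₁′ + p₁ + (p₁ + l₁ + p))   ≡⟨ g₂ l₀ r₀ l₁′ p₁ l₁ p ⟩
    l₁′ + p₁ + (r₀ + p₁ + (l₁ + l₀ + p))     ∎
    where
    open ≡-Reasoning
    g₁ : ∀ r₀′ p₁ l₁ l₁′ l₀′ p → r₀′ + p₁ + (l₁ + p₁ + (l₁′ + l₀′ + p)) ≡ (l₀′ + r₀′) + (l₁′ + p₁ + (p₁ + l₁ + p))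
    g₁ = solve-∀
    g₂ : ∀ l₀ r₀ l₁′ p₁ l₁ p → (l₀ + r₀) + (l₁′ + p₁ + (p₁ + l₁ + p)) ≡ l₁′ + p₁ + (r₀ + p₁ + (l₁ + l₀ + p))
    g₂ = solve-∀

+ᵥ-∷ʳ : ∀ {n} (u v : Vec ℕ n) a b → (u ∷ʳ a) +ᵥ (v ∷ʳ b) ≡ (u +ᵥ v) ∷ʳ (a + b)
+ᵥ-∷ʳ []      []      a b = refl
+ᵥ-∷ʳ (x ∷ u) (y ∷ v) a b = cong (x + y ∷_) (+ᵥ-∷ʳ u v a b)

+ᵥ-identityˡ : ∀ {n} (v : Vec ℕ n) → replicate n 0 +ᵥ v ≡ v
+ᵥ-identityˡ []      = refl
+ᵥ-identityˡ (x ∷ v) = cong (x ∷_) (+ᵥ-identityˡ v)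

replicate-∷ʳ : ∀ {A : Set} n (a : A) → replicate n a ∷ʳ a ≡ replicate (suc n) a
replicate-∷ʳ zero    a = refl
replicate-∷ʳ (suc n) a = cong (a ∷_) (replicate-∷ʳ n a)

trues-∷ʳ : ∀ {n} (v : Vec Bool n) x → trues (v ∷ʳ x) ≡ trues v + bit x
trues-∷ʳ []      x = +-identityʳ (bit x)
trues-∷ʳ (y ∷ v) x = trans (cong (bit y +_) (trues-∷ʳ v x)) (sym (+-assoc (bit y) _ _))

gapParityRow-∷ʳ : ∀ {n} (v : Vec Bool n) x g →
                  gapParityRow (v ∷ʳ x) g ≡ gapParityRow v (if x then g else not g)
gapParityRow-∷ʳ []          x g = refl
gapParityRow-∷ʳ (true  ∷ v) x g = gapParityRow-∷ʳ v x g
gapParityRow-∷ʳ (false ∷ v) x g = cong not (gapParityRow-∷ʳ v x g)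

oddsRow-∷ʳ : ∀ {n} (v : Vec Bool n) x g →
             oddsRow g (v ∷ʳ x) ≡ oddsRow (if x then g else not g) v ∷ʳ bit (x ∧ g)
oddsRow-∷ʳ []      x g = refl
oddsRow-∷ʳ (y ∷ v) x g = cong₂ (λ a u → bit (y ∧ a) ∷ u) (gapParityRow-∷ʳ v x g) (oddsRow-∷ʳ v x g)

triangles-∷ʳ : ∀ {n} (v : Vec ℕ n) x → triangles (v ∷ʳ x) ≡ triangle x + triangles v
triangles-∷ʳ []      x = refl
triangles-∷ʳ (y ∷ v) x = trans (cong (triangle y +_) (triangles-∷ʳ v x)) (+-swap (triangle y) (triangle x) _)

-- Adding a bead in position 0 below all beads

-- Rotate x M M′: all positions of M are increased by one and a bead is put in position 0;
-- x is the entry of the topmost position of M, which drops out.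
data Rotate {n} : Bool → Abacus (suc n) → Abacus (suc n) → Set where
  base : Rotate true [] []
  add-row : ∀ {c x v M M′} → Rotate c M M′ → Rotate x ((x ∷ v) ∷ M) ((v ∷ʳ c) ∷ M′)

Rotate-length : ∀ {n x} {M M′ : Abacus (suc n)} → Rotate x M M′ → length M ≡ length M′
Rotate-length base     = refl
Rotate-length (add-row ρ) = cong suc (Rotate-length ρ)

Rotate-beads : ∀ {n x} {M M′ : Abacus (suc n)} → Rotate x M M′ →
  ∃[ b ] ∃[ b′ ] ∃[ bs ] (beads M ≡ b ∷ bs × beads M′ ≡ bs ∷ʳ b′ × b′ + bit x ≡ suc b)
Rotate-beads {n} base = 0 , 0 , replicate n 0 , refl , sym (replicate-∷ʳ n 0) , refl
Rotate-beads (add-row {c} {x} {v} ρ) =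
  let b , b′ , bs , e , e′ , p = Rotate-beads ρ in
  bit x + b , bit c + b′ , Vec.map bit v +ᵥ bs , cong (Vec.map bit (x ∷ v) +ᵥ_) e ,
  trans (cong₂ _+ᵥ_ (Vec.map-∷ʳ bit c v) e′) (+ᵥ-∷ʳ _ bs (bit c) b′) ,
  (begin
    bit c + b′ + bit x ≡⟨ cong (_+ bit x) (trans (+-comm (bit c) b′) p) ⟩
    suc (b + bit x)    ≡⟨ cong suc (+-comm b (bit x)) ⟩
    suc (bit x + b)    ∎)
  where open ≡-Reasoning

-- Only the beads on the runner at the head of the vector change rows, each going up by one. If the
-- topmost entry is a bead, it leaves the abacus; the second summand on the left makes up for it.
Rotate-levels : ∀ {n x} {M M′ : Abacus (suc n)} → Rotate x M M′ → ∀ {b bs} → beads M ≡ b ∷ bs →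
  levels M′ + length M * bit x ≡ levels M + b
Rotate-levels base refl = refl
Rotate-levels (add-row {c} {x} {v} {M} {M′} ρ) e with Rotate-beads ρ
... | b , b′ , bs , e₀ , _ with trans (sym e) (cong (Vec.map bit (x ∷ v) +ᵥ_) e₀)
... | refl = begin
  length M′ * trues (v ∷ʳ c) + levels M′ + suc (length M) * bit x
    ≡⟨ cong₂ (λ l t → l * t + levels M′ + suc (length M) * bit x) (sym (Rotate-length ρ)) (trues-∷ʳ v c) ⟩
  length M * (trues v + bit c) + levels M′ + suc (length M) * bit x
    ≡⟨ regroup₁ (length M) (trues v) (bit c) (levels M′) (bit x) ⟩
  length M * (bit x + trues v) + (levels M′ + length M * bit c) + bit x
    ≡⟨ cong (λ a → length M * (bit x + trues v) + a + bit x) (Rotate-levels ρ e₀) ⟩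
  length M * (bit x + trues v) + (levels M + b) + bit x
    ≡⟨ regroup₂ (length M * (bit x + trues v)) (levels M) b (bit x) ⟩
  length M * (bit x + trues v) + levels M + (bit x + b) ∎
  where
  open ≡-Reasoning
  regroup₁ : ∀ l t c m x → l * (t + c) + m + suc l * x ≡ l * (x + t) + (m + l * c) + x
  regroup₁ = solve-∀
  regroup₂ : ∀ a m b x → a + (m + b) + x ≡ a + m + (x + b)
  regroup₂ = solve-∀

Rotate-gapParity : ∀ {n x} {M M′ : Abacus (suc n)} → Rotate x M M′ →
  gapParity M ≡ (if x then gapParity M′ else not (gapParity M′))
Rotate-gapParity base = refl
Rotate-gapParity (add-row {c} {x} {v} {M} {M′} ρ) = cong (λ g → if x then g else not g)
  (trans (cong (gapParityRow v) (Rotate-gapParity ρ)) (sym (gapParityRow-∷ʳ v c (gapParity M′))))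

-- The new bead has part 0 and puts no gap below the others, so no part changes and the counts
-- merely follow their runners.
Rotate-odds : ∀ {n x} {M M′ : Abacus (suc n)} → Rotate x M M′ →
  ∃[ o ] ∃[ o′ ] ∃[ os ] (odds M ≡ o ∷ os × odds M′ ≡ os ∷ʳ o′ × o ≡ bit (x ∧ gapParity M′) + o′)
Rotate-odds {n} base = 0 , 0 , replicate n 0 , refl , sym (replicate-∷ʳ n 0) , refl
Rotate-odds (add-row {c} {x} {v} {M} {M′} ρ) =
  let o , o′ , os , e , e′ , p = Rotate-odds ρ in
  bit (x ∧ gapParityRow v (gapParity M)) + o , bit (c ∧ gapParity M′) + o′ , oddsRow (gapParity M) v +ᵥ os ,
  cong (oddsRow (gapParity M) (x ∷ v) +ᵥ_) e ,
  trans (cong₂ _+ᵥ_ (trans (oddsRow-∷ʳ v c (gapParity M′))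
                       (cong (λ g → oddsRow g v ∷ʳ bit (c ∧ gapParity M′)) (sym (Rotate-gapParity ρ)))) e′)
    (+ᵥ-∷ʳ _ os _ o′) ,
  cong₂ (λ g a → bit (x ∧ g) + a)
    (trans (cong (gapParityRow v) (Rotate-gapParity ρ)) (sym (gapParityRow-∷ʳ v c (gapParity M′)))) p

rotate : ∀ {n} (M : Abacus (suc n)) → ∃₂ λ x M′ → Rotate x M M′
rotate []            = true , [] , base
rotate ((x ∷ v) ∷ M) = let c , M′ , ρ = rotate M in x , (v ∷ʳ c) ∷ M′ , add-row ρ

emptyRow : ∀ n → Vec Bool n
emptyRow n = replicate n false

beads-emptyRow : ∀ {n} (M : Abacus n) → beads (emptyRow n ∷ M) ≡ beads M
beads-emptyRow {n} M = trans (cong (_+ᵥ beads M) (Vec.map-replicate bit false n)) (+ᵥ-identityˡ (beads M))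

oddsRow-emptyRow : ∀ n g → oddsRow g (emptyRow n) ≡ replicate n 0
oddsRow-emptyRow zero    g = refl
oddsRow-emptyRow (suc n) g = cong (0 ∷_) (oddsRow-emptyRow n g)

odds-emptyRow : ∀ {n} (M : Abacus n) → odds (emptyRow n ∷ M) ≡ odds M
odds-emptyRow {n} M = trans (cong (_+ᵥ odds M) (oddsRow-emptyRow n _)) (+ᵥ-identityˡ (odds M))

trues-emptyRow : ∀ n → trues (emptyRow n) ≡ 0
trues-emptyRow zero    = refl
trues-emptyRow (suc n) = trues-emptyRow n

levels-emptyRow : ∀ {n} (M : Abacus n) → levels (emptyRow n ∷ M) ≡ levels M
levels-emptyRow {n} M = cong (_+ levels M) (trans (cong (length M *_) (trues-emptyRow n)) (*-zeroʳ (length M)))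

Realises-emptyRow : ∀ {n d w θ} {M : Abacus n} → Realises d w θ M → Realises d w θ (emptyRow n ∷ M)
Realises-emptyRow {M = M} (realises b l o) = realises
  (trans (beads-emptyRow M) b) (trans (levels-emptyRow M) l) (trans (odds-emptyRow M) o)

rotateᵥ : ∀ {n} → Vec ℕ (suc n) → Vec ℕ (suc n)
rotateᵥ (o ∷ os) = os ∷ʳ o

-- The beads of the rotated runner rise by `x` levels in all, which is the difference between
-- `triangle (suc x)` and `triangle x`.
rotate-Realisable : ∀ {n} x (ds : Vec ℕ n) {w θ} → Realisable (x ∷ ds) w θ → Realisable (ds ∷ʳ suc x) w (rotateᵥ θ)
-- The empty row on top ensures that no bead drops out.
rotate-Realisable {n} x ds {w} (M , R) with rotate (emptyRow (suc n) ∷ M) | Realises-emptyRow R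
... | false , M′ , ρ@(add-row _) | realises bs lev os
  with Rotate-beads ρ | Rotate-odds ρ
... | b , b′ , bs₀ , e , e′ , p | o , o′ , os₀ , eᵒ , eᵒ′ , pᵒ with trans (sym bs) e | trans (sym os) eᵒ
... | refl | refl = M′ , realises
  (trans e′ (cong (ds ∷ʳ_) (trans (sym (+-identityʳ b′)) p)))
  (begin
    levels M′                                                    ≡⟨ +-identityʳ _ ⟨
    levels M′ + 0                                                ≡⟨ cong (levels M′ +_) (*-zeroʳ (length M)) ⟨
    levels M′ + suc (length M) * 0                               ≡⟨ Rotate-levels ρ e ⟩
    levels (emptyRow (suc n) ∷ M) + x                            ≡⟨ cong (_+ x) lev ⟩
    w + (triangle x + triangles ds) + x                          ≡⟨ regroup w (triangle x) (triangles ds) x ⟩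
    w + (triangle (suc x) + triangles ds)                        ≡⟨ cong (w +_) (triangles-∷ʳ ds (suc x)) ⟨
    w + triangles (ds ∷ʳ suc x)                                  ∎)
  (trans eᵒ′ (cong (os₀ ∷ʳ_) (sym pᵒ)))
  where
  open ≡-Reasoning
  regroup : ∀ w t s x → w + (t + s) + x ≡ w + (x + t + s)
  regroup = solve-∀

beads≤length : ∀ {n} (M : Abacus n) → All (_≤ length M) (toList (beads M))
beads≤length []      = zeros _
  where
  zeros : ∀ n → All (_≤ 0) (toList (replicate n 0))
  zeros zero    = []
  zeros (suc n) = z≤n ∷ zeros n
beads≤length (r ∷ M) = add r (beads M) (beads≤length M)
  where
  add : ∀ {n k} (r : Vec Bool n) (v : Vec ℕ n) → All (_≤ k) (toList v) → All (_≤ suc k) (toList (Vec.map bit r +ᵥ v))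
  add []          []      []       = []
  add (true ∷ r)  (a ∷ v) (p ∷ ps) = s≤s p ∷ add r v ps
  add (false ∷ r) (a ∷ v) (p ∷ ps) = m≤n⇒m≤1+n p ∷ add r v ps

-- A bead in a row of height `k` joins at most `k` beads on its runner, so it raises `triangle`
-- there by at most its own height.
triangles-+ᵥ : ∀ {n k} (r : Vec Bool n) (v : Vec ℕ n) → All (_≤ k) (toList v) →
               triangles (Vec.map bit r +ᵥ v) ≤ k * trues r + triangles v
triangles-+ᵥ []          []      []       = z≤n
triangles-+ᵥ {k = k} (true ∷ r)  (a ∷ v) (p ∷ ps) = begin
  a + triangle a + triangles (Vec.map bit r +ᵥ v) ≤⟨ +-mono-≤ (+-monoˡ-≤ (triangle a) p) (triangles-+ᵥ r v ps) ⟩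
  k + triangle a + (k * trues r + triangles v)    ≡⟨ regroup k (triangle a) (trues r) (triangles v) ⟩
  k * suc (trues r) + (triangle a + triangles v)  ∎
  where
  open ≤-Reasoning
  regroup : ∀ k t r s → k + t + (k * r + s) ≡ k * suc r + (t + s)
  regroup = solve-∀
triangles-+ᵥ {k = k} (false ∷ r) (a ∷ v) (p ∷ ps) = begin
  triangle a + triangles (Vec.map bit r +ᵥ v) ≤⟨ +-monoʳ-≤ (triangle a) (triangles-+ᵥ r v ps) ⟩
  triangle a + (k * trues r + triangles v)    ≡⟨ +-swap (triangle a) (k * trues r) (triangles v) ⟩
  k * trues r + (triangle a + triangles v)    ∎
  where
  open ≤-Reasoning

-- If position 0 is empty then every bead on its runner has a gap below it, so the weight is at
-- least the number b of these beads.
BottomGap : ∀ {n} → Bool → Abacus (suc n) → Set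
BottomGap x M = ∃₂ λ bs b →
  beads M ≡ bs ∷ʳ b × b + bit x ≤ length M × b + triangles (bs ∷ʳ b) ≤ levels M

All-∷ʳ⁻ : ∀ {n} {P : ℕ → Set} (v : Vec ℕ n) {x} → All P (toList (v ∷ʳ x)) → All P (toList v)
All-∷ʳ⁻ v {x} a = All.++⁻ˡ (toList v) (subst (All _) (Vec.toList-∷ʳ x v) a)

-- Each row passes its last entry down as the first entry of the row below in the unrotated abacus.
-- At the bottom the entry passed on is position 0 itself, and its value decides between the two
-- outcomes.
unrotate : ∀ {n} x (M′ : Abacus (suc n)) → ∃[ M ] Rotate x M M′ ⊎ BottomGap x M′
unrotate {n} true  [] = inj₁ ([] , base)
unrotate {n} false [] = inj₂ (replicate n 0 , 0 , sym (replicate-∷ʳ n 0) , z≤n ,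
  ≤-reflexive (trans (triangles-∷ʳ (replicate n 0) 0) (zeros n)))
  where
  zeros : ∀ n → triangles (replicate n 0) ≡ 0
  zeros zero    = refl
  zeros (suc n) = zeros n
unrotate x (r ∷ M′) with Vec.initLast r
... | v , c , refl with unrotate c M′
...   | inj₁ (M , ρ)                   = inj₁ ((x ∷ v) ∷ M , add-row ρ)
...   | inj₂ (bs , b , e , len , lev) = inj₂
  (Vec.map bit v +ᵥ bs , bit c + b ,
   trans (cong₂ _+ᵥ_ (Vec.map-∷ʳ bit c v) e) (+ᵥ-∷ʳ _ bs (bit c) b) ,
   (begin
     bit c + b + bit x   ≡⟨ cong (_+ bit x) (+-comm (bit c) b) ⟩
     b + bit c + bit x   ≤⟨ +-mono-≤ len (bit≤1 x) ⟩
     length M′ + 1       ≡⟨ +-comm (length M′) 1 ⟩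
     suc (length M′)     ∎) ,
   (begin
     bit c + b + triangles ((Vec.map bit v +ᵥ bs) ∷ʳ (bit c + b))
       ≡⟨ cong (bit c + b +_) (triangles-∷ʳ (Vec.map bit v +ᵥ bs) (bit c + b)) ⟩
     bit c + b + (triangle (bit c + b) + triangles (Vec.map bit v +ᵥ bs))
       ≤⟨ +-monoʳ-≤ (bit c + b) (+-monoʳ-≤ (triangle (bit c + b))
            (triangles-+ᵥ v bs (All-∷ʳ⁻ bs (subst (λ u → All (_≤ length M′) (toList u)) e (beads≤length M′))))) ⟩
     bit c + b + (triangle (bit c + b) + (length M′ * trues v + triangles bs))
       ≡⟨ regroup₁ (bit c + b) (triangle (bit c + b)) (length M′ * trues v) (triangles bs) ⟩
     bit c + b + triangle (bit c + b) + length M′ * trues v + triangles bs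
       ≤⟨ +-monoˡ-≤ (triangles bs) (+-monoˡ-≤ (length M′ * trues v) (last-runner c len)) ⟩
     length M′ * bit c + (b + triangle b) + length M′ * trues v + triangles bs
       ≡⟨ regroup₂ (length M′) (bit c) (b) (triangle b) (trues v) (triangles bs) ⟩
     length M′ * (trues v + bit c) + (b + (triangle b + triangles bs))
       ≡⟨ cong₂ (λ t s → length M′ * t + (b + s)) (sym (trues-∷ʳ v c)) (sym (triangles-∷ʳ bs b)) ⟩
     length M′ * trues (v ∷ʳ c) + (b + triangles (bs ∷ʳ b))
       ≤⟨ +-monoʳ-≤ _ lev ⟩
     length M′ * trues (v ∷ʳ c) + levels M′ ∎))
  where
  open ≤-Reasoning
  bit≤1 : ∀ x → bit x ≤ 1
  bit≤1 true  = ≤-refl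
  bit≤1 false = z≤n
  regroup₁ : ∀ a t m s → a + (t + (m + s)) ≡ a + t + m + s
  regroup₁ = solve-∀
  regroup₂ : ∀ l c b t v s → l * c + (b + t) + l * v + s ≡ l * (v + c) + (b + (t + s))
  regroup₂ = solve-∀
  -- A bead on the last runner has height `length M′`, but the gap at the bottom leaves fewer than
  -- `length M′` beads under it there: one level to spare for each bead.
  last-runner : ∀ c → b + bit c ≤ length M′ → bit c + b + triangle (bit c + b) ≤ length M′ * bit c + (b + triangle b)
  last-runner true p  = +-monoˡ-≤ (b + triangle b) (≤-trans (≤-reflexive (+-comm 1 b)) (≤-trans p (≤-reflexive (sym (*-identityʳ _)))))
  last-runner false p = m≤n+m (b + triangle b) (length M′ * 0)

unrotateᵥ : ∀ {n} → Vec ℕ (suc n) → Vec ℕ (suc n)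
unrotateᵥ θ = Vec.last θ ∷ Vec.init θ

-- A gap in position 0 would lie under all `suc x` beads of that runner and force a weight above
-- `w`.
unrotate-Realisable : ∀ {n} x (ds : Vec ℕ n) {w θ} → w ≤ x →
  Realisable (ds ∷ʳ suc x) w θ → Realisable (x ∷ ds) w (unrotateᵥ θ)
unrotate-Realisable {n} x ds {w} w≤x (M′ , realises bs lev os) with unrotate false M′
... | inj₂ (bs′ , b , e , _ , excess) with Vec.∷ʳ-injective ds bs′ (trans (sym bs) e)
...   | refl , refl = ⊥-elim (1+n≰n (begin
    suc x + triangles (ds ∷ʳ suc x) ≤⟨ excess ⟩
    levels M′                       ≡⟨ lev ⟩
    w + triangles (ds ∷ʳ suc x)     ≤⟨ +-monoˡ-≤ _ w≤x ⟩
    x + triangles (ds ∷ʳ suc x)     ∎))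
  where open ≤-Reasoning
unrotate-Realisable {n} x ds {w} w≤x (M′ , realises bs lev os)
    | inj₁ (M , ρ) with Rotate-beads ρ | Rotate-odds ρ
... | b , b′ , bs₀ , e , e′ , p | o , o′ , os₀ , eᵒ , eᵒ′ , pᵒ with Vec.∷ʳ-injective ds bs₀ (trans (sym bs) e′)
... | refl , refl with suc-injective (trans (sym (+-identityʳ (suc x))) p)
... | refl = M , realises e
  (+-cancelʳ-≡ x _ _ (begin
    levels M + x                            ≡⟨ Rotate-levels ρ e ⟨
    levels M′ + length M * 0                ≡⟨ cong (levels M′ +_) (*-zeroʳ (length M)) ⟩
    levels M′ + 0                           ≡⟨ +-identityʳ _ ⟩
    levels M′                               ≡⟨ lev ⟩
    w + triangles (ds ∷ʳ suc x)             ≡⟨ cong (w +_) (triangles-∷ʳ ds (suc x)) ⟩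
    w + (x + triangle x + triangles ds)     ≡⟨ regroup w (triangle x) (triangles ds) x ⟨
    w + (triangle x + triangles ds) + x     ∎))
  (trans eᵒ (trans (cong (_∷ os₀) pᵒ)
    (cong₂ _∷_ (trans (sym (Vec.last-∷ʳ o′ os₀)) (cong Vec.last (trans (sym eᵒ′) os)))
               (trans (sym (Vec.init-∷ʳ o′ os₀)) (cong Vec.init (trans (sym eᵒ′) os))))))
  where
  open ≡-Reasoning
  regroup : ∀ w t s x → w + (t + s) + x ≡ w + (x + t + s)
  regroup = solve-∀

-- Equivalence of bead configurations up to weight W

-- The bijection must not depend on the weight, so that it preserves newness.
record Equivalent {n} (W : ℕ) (d d′ : Vec ℕ n) : Set where
  field
    to from   : Vec ℕ n → Vec ℕ n
    from∘to   : ∀ θ → from (to θ) ≡ θ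
    to∘from   : ∀ θ → to (from θ) ≡ θ
    to-Realisable   : ∀ {w θ} → w ≤ W → Realisable d w θ → Realisable d′ w (to θ)
    from-Realisable : ∀ {w θ} → w ≤ W → Realisable d′ w θ → Realisable d w (from θ)
    to-Zero   : ∀ θ → Zero θ → Zero (to θ)
    from-Zero : ∀ θ → Zero θ → Zero (from θ)

module _ {n W : ℕ} where

  Equivalent-refl : ∀ {d : Vec ℕ n} → Equivalent W d d
  Equivalent-refl = record
    { to = id ; from = id ; from∘to = λ _ → refl ; to∘from = λ _ → refl
    ; to-Realisable = λ _ R → R ; from-Realisable = λ _ R → R ; to-Zero = λ _ z → z ; from-Zero = λ _ z → z }

  Equivalent-sym : ∀ {d d′ : Vec ℕ n} → Equivalent W d d′ → Equivalent W d′ d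
  Equivalent-sym E = record
    { to = from ; from = to ; from∘to = to∘from ; to∘from = from∘to
    ; to-Realisable = from-Realisable ; from-Realisable = to-Realisable
    ; to-Zero = from-Zero ; from-Zero = to-Zero }
    where open Equivalent E

  Equivalent-trans : ∀ {d d′ d″ : Vec ℕ n} → Equivalent W d d′ → Equivalent W d′ d″ → Equivalent W d d″
  Equivalent-trans E F = record
    { to = F.to ∘ E.to ; from = E.from ∘ F.from
    ; from∘to = λ θ → trans (cong E.from (F.from∘to (E.to θ))) (E.from∘to θ)
    ; to∘from = λ θ → trans (cong F.to (E.to∘from (F.from θ))) (F.to∘from θ)
    ; to-Realisable = λ w≤W R → F.to-Realisable w≤W (E.to-Realisable w≤W R)
    ; from-Realisable = λ w≤W R → E.from-Realisable w≤W (F.from-Realisable w≤W R)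
    ; to-Zero = λ θ z → F.to-Zero (E.to θ) (E.to-Zero θ z)
    ; from-Zero = λ θ z → E.from-Zero (F.from θ) (F.from-Zero θ z) }
    where
    module E = Equivalent E
    module F = Equivalent F

exchange-Equivalent : ∀ {n W} x y (ds : Vec ℕ n) → Equivalent W (x ∷ y ∷ ds) (y ∷ x ∷ ds)
exchange-Equivalent x y ds = record
  { to = exchange x y ; from = exchange y x
  ; from∘to = exchange-involutive x y ; to∘from = exchange-involutive y x
  ; to-Realisable = λ _ → exchange-Realisable x y ; from-Realisable = λ _ → exchange-Realisable y x
  ; to-Zero = exchange-zero x y ; from-Zero = exchange-zero y x }

lookup-∷ʳ-last : ∀ {n} (v : Vec ℕ n) x → ∃[ i ] Vec.lookup (v ∷ʳ x) i ≡ x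
lookup-∷ʳ-last []      x = zero , refl
lookup-∷ʳ-last (y ∷ v) x = let i , p = lookup-∷ʳ-last v x in suc i , p

lookup-∷ʳ-init : ∀ {n} (v : Vec ℕ n) x i → ∃[ j ] Vec.lookup (v ∷ʳ x) j ≡ Vec.lookup v i
lookup-∷ʳ-init (y ∷ v) x zero    = zero , refl
lookup-∷ʳ-init (y ∷ v) x (suc i) = let j , p = lookup-∷ʳ-init v x i in suc j , p

rotate-Zero : ∀ {n} (θ : Vec ℕ (suc n)) → Zero θ → Zero (rotateᵥ θ)
rotate-Zero (o ∷ os) (zero  , refl) = lookup-∷ʳ-last os o
rotate-Zero (o ∷ os) (suc i , p)    = let j , q = lookup-∷ʳ-init os o i in j , trans q p

lookup-∷ʳ : ∀ {n} (v : Vec ℕ n) x i → Vec.lookup (v ∷ʳ x) i ≡ x ⊎ ∃[ j ] Vec.lookup v j ≡ Vec.lookup (v ∷ʳ x) i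
lookup-∷ʳ []      x zero    = inj₁ refl
lookup-∷ʳ (y ∷ v) x zero    = inj₂ (zero , refl)
lookup-∷ʳ (y ∷ v) x (suc i) with lookup-∷ʳ v x i
... | inj₁ p       = inj₁ p
... | inj₂ (j , p) = inj₂ (suc j , p)

unrotate-Zero : ∀ {n} (θ : Vec ℕ (suc n)) → Zero θ → Zero (unrotateᵥ θ)
unrotate-Zero θ (i , p) with Vec.initLast θ
... | os , o , refl with lookup-∷ʳ os o i
...   | inj₁ q       = zero , trans (sym q) p
...   | inj₂ (j , q) = suc j , trans q p

unrotate∘rotate : ∀ {n} (θ : Vec ℕ (suc n)) → unrotateᵥ (rotateᵥ θ) ≡ θ
unrotate∘rotate (o ∷ os) = cong₂ _∷_ (Vec.last-∷ʳ o os) (Vec.init-∷ʳ o os)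

rotate∘unrotate : ∀ {n} (θ : Vec ℕ (suc n)) → rotateᵥ (unrotateᵥ θ) ≡ θ
rotate∘unrotate θ = sym (proj₂ (proj₂ (Vec.initLast θ)))

rotate-Equivalent : ∀ {n W} x (ds : Vec ℕ n) → W ≤ x → Equivalent W (x ∷ ds) (ds ∷ʳ suc x)
rotate-Equivalent x ds W≤x = record
  { to = rotateᵥ ; from = unrotateᵥ ; from∘to = unrotate∘rotate ; to∘from = rotate∘unrotate
  ; to-Realisable = λ _ → rotate-Realisable x ds
  ; from-Realisable = λ w≤W → unrotate-Realisable x ds (≤-trans w≤W W≤x)
  ; to-Zero = rotate-Zero ; from-Zero = unrotate-Zero }

AllEntries : ∀ {n} → (ℕ → Set) → Vec ℕ n → Set
AllEntries P v = All P (toList v)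

AllEntries-∷ʳ : ∀ {n P} (v : Vec ℕ n) {x} → AllEntries P v → P x → AllEntries P (v ∷ʳ x)
AllEntries-∷ʳ v {x} a p = subst (All _) (sym (Vec.toList-∷ʳ x v)) (All.++⁺ a (p ∷ []))

advance : ∀ {n} → Vec ℕ n → Vec ℕ n
advance []       = []
advance (x ∷ ds) = ds ∷ʳ suc x

advances : ∀ {n} → ℕ → Vec ℕ n → Vec ℕ n
advances zero    d = d
advances (suc k) d = advances k (advance d)

AllEntries-advance : ∀ {n W} (d : Vec ℕ n) → AllEntries (W ≤_) d → AllEntries (W ≤_) (advance d)
AllEntries-advance []       []       = []
AllEntries-advance (x ∷ ds) (p ∷ ps) = AllEntries-∷ʳ ds ps (m≤n⇒m≤1+n p)

-- The vector acts as a queue: entries leave at the front and return at the back increased by one.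
toList-advances : ∀ {n} (d : Vec ℕ n) u v → toList d ≡ u ++ v → toList (advances (length u) d) ≡ v ++ List.map suc u
toList-advances d        []      v p = trans p (sym (List.++-identityʳ v))
toList-advances (x ∷ ds) (_ ∷ u) v p with List.∷-injective p
... | refl , q = trans
  (toList-advances (ds ∷ʳ suc x) u (v List.∷ʳ suc x)
    (trans (Vec.toList-∷ʳ (suc x) ds) (trans (cong (_++ _) q) (List.++-assoc u v _))))
  (List.++-assoc v _ _)

toList-injective : ∀ {n} {u v : Vec ℕ n} → toList u ≡ toList v → u ≡ v
toList-injective {u = u} {v} p = trans (sym (Vec.cast-is-id refl u)) (Vec.toList-injective refl u v p)

advances-all : ∀ {n} (d : Vec ℕ n) → advances n d ≡ Vec.map suc d
advances-all {n} d = toList-injective (trans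
  (subst (λ k → toList (advances k d) ≡ List.map suc (toList d)) (Vec.length-toList d)
    (toList-advances d (toList d) [] (sym (List.++-identityʳ _))))
  (sym (Vec.toList-map suc d)))

module _ {W : ℕ} where

  advances-Equivalent : ∀ {n} k (d : Vec ℕ n) → AllEntries (W ≤_) d → Equivalent W d (advances k d)
  advances-Equivalent zero    d        ps       = Equivalent-refl
  advances-Equivalent (suc k) []       ps       = advances-Equivalent k [] ps
  advances-Equivalent (suc k) (x ∷ ds) (p ∷ ps) = Equivalent-trans (rotate-Equivalent x ds p)
    (advances-Equivalent k (ds ∷ʳ suc x) (AllEntries-advance (x ∷ ds) (p ∷ ps)))

  -- Exchanging the first two runners and rotating keeps the first one in its place.
  advances-tail-Equivalent : ∀ {n} k x (d : Vec ℕ n) → AllEntries (W ≤_) d → Equivalent W (x ∷ d) (x ∷ advances k d)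
  advances-tail-Equivalent zero    x d        ps       = Equivalent-refl
  advances-tail-Equivalent (suc k) x []       ps       = advances-tail-Equivalent k x [] ps
  advances-tail-Equivalent (suc k) x (y ∷ ds) (p ∷ ps) = Equivalent-trans
    (exchange-Equivalent x y ds) (Equivalent-trans (rotate-Equivalent y (x ∷ ds) p)
      (advances-tail-Equivalent k x (ds ∷ʳ suc y) (AllEntries-advance (y ∷ ds) (p ∷ ps))))

  -- From `x ∷ d⁻`, advancing the tail leads to `x ∷ d` and advancing everything leads to
  -- `suc x ∷ d`. The tail has to be lowered by one first, which is why its entries are at least
  -- `suc W`.
  head-suc-Equivalent : ∀ {n} x (d : Vec ℕ n) → W ≤ x → AllEntries (suc W ≤_) d → Equivalent W (x ∷ d) (suc x ∷ d)
  head-suc-Equivalent {n} x d W≤x ps = subst (λ u → Equivalent W (x ∷ u) (suc x ∷ u)) (map-suc-pred d ps)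
    (Equivalent-trans
      (Equivalent-sym (subst (λ u → Equivalent W (x ∷ d⁻) (x ∷ u)) (advances-all d⁻)
        (advances-tail-Equivalent n x d⁻ (pred-entries d ps))))
      (subst (Equivalent W (x ∷ d⁻)) (advances-all (x ∷ d⁻))
        (advances-Equivalent (suc n) (x ∷ d⁻) (W≤x ∷ pred-entries d ps))))
    where
    d⁻ : Vec ℕ n
    d⁻ = Vec.map pred d
    map-suc-pred : ∀ {m} (v : Vec ℕ m) → AllEntries (suc W ≤_) v → Vec.map suc (Vec.map pred v) ≡ v
    map-suc-pred []          []           = refl
    map-suc-pred (suc y ∷ v) (s≤s _ ∷ ps) = cong (suc y ∷_) (map-suc-pred v ps)
    pred-entries : ∀ {m} (v : Vec ℕ m) → AllEntries (suc W ≤_) v → AllEntries (W ≤_) (Vec.map pred v)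
    pred-entries []          []           = []
    pred-entries (suc y ∷ v) (s≤s p ∷ ps) = p ∷ pred-entries v ps

  head-+-Equivalent : ∀ {n} k x (d : Vec ℕ n) → W ≤ x → AllEntries (suc W ≤_) d → Equivalent W (x ∷ d) (k + x ∷ d)
  head-+-Equivalent zero    x d W≤x ps = Equivalent-refl
  head-+-Equivalent (suc k) x d W≤x ps = Equivalent-trans (head-+-Equivalent k x d W≤x ps)
    (head-suc-Equivalent (k + x) d (≤-trans W≤x (m≤n+m x k)) ps)

  head-Equivalent : ∀ {n} x y (d : Vec ℕ n) → W ≤ x → W ≤ y → AllEntries (suc W ≤_) d → Equivalent W (x ∷ d) (y ∷ d)
  head-Equivalent x y d W≤x W≤y ps with ≤-total x y
  ... | inj₁ x≤y = subst (λ z → Equivalent W (x ∷ d) (z ∷ d)) (m∸n+n≡m x≤y) (head-+-Equivalent (y ∸ x) x d W≤x ps)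
  ... | inj₂ y≤x = Equivalent-sym
    (subst (λ z → Equivalent W (y ∷ d) (z ∷ d)) (m∸n+n≡m y≤x) (head-+-Equivalent (x ∸ y) y d W≤y ps))

  replace : ∀ {n} → Vec ℕ n → List ℕ → Vec ℕ n
  replace d        []       = d
  replace []       (c ∷ cs) = []
  replace (x ∷ ds) (c ∷ cs) = replace (ds ∷ʳ c) cs

  toList-replace : ∀ {n} (d : Vec ℕ n) u v cs → toList d ≡ u ++ v → length u ≡ length cs → toList (replace d cs) ≡ v ++ cs
  toList-replace d        []      v []       p _ = trans p (sym (List.++-identityʳ v))
  toList-replace (x ∷ ds) (_ ∷ u) v (c ∷ cs) p l with List.∷-injective p
  ... | refl , q = trans
    (toList-replace (ds ∷ʳ c) u (v List.∷ʳ c) cs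
      (trans (Vec.toList-∷ʳ c ds) (trans (cong (_++ _) q) (List.++-assoc u v _))) (suc-injective l))
    (List.++-assoc v _ _)

  replace-Equivalent : ∀ {n} (d : Vec ℕ n) cs → AllEntries (suc W ≤_) d → All (suc W ≤_) cs → Equivalent W d (replace d cs)
  replace-Equivalent d        []           ps       qs             = Equivalent-refl
  replace-Equivalent []       (c ∷ cs)     ps       qs             = Equivalent-refl
  replace-Equivalent (x ∷ ds) (suc c ∷ cs) (p ∷ ps) (s≤s q ∷ qs) = Equivalent-trans
    -- The rotation that follows adds a bead, so the head is set to one less than its target
    -- `suc c`.
    (head-Equivalent x c ds (≤-trans (n≤1+n W) p) q ps)
    (Equivalent-trans (rotate-Equivalent c ds q)
      (replace-Equivalent (ds ∷ʳ suc c) cs (AllEntries-∷ʳ ds ps (s≤s q)) qs))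

  all-Equivalent : ∀ {n} (d d′ : Vec ℕ n) → AllEntries (suc W ≤_) d → AllEntries (suc W ≤_) d′ → Equivalent W d d′
  all-Equivalent d d′ ps qs = subst (Equivalent W d)
    (toList-injective (toList-replace d (toList d) [] (toList d′) (sym (List.++-identityʳ _))
      (trans (Vec.length-toList d) (sym (Vec.length-toList d′)))))
    (replace-Equivalent d (toList d′) ps qs)

-- Words of beads and gaps, from the top down

#beads #gaps : List Bool → ℕ
#beads []       = 0
#beads (x ∷ xs) = bit x + #beads xs
#gaps []       = 0
#gaps (x ∷ xs) = bit (not x) + #gaps xs

-- The size of the partition whose parts are the numbers of gaps after the beads.
inversions : List Bool → ℕ
inversions []           = 0
inversions (true  ∷ xs) = #gaps xs + inversions xs
inversions (false ∷ xs) = inversions xs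

oddGaps : List Bool → Bool
oddGaps []           = false
oddGaps (true  ∷ xs) = oddGaps xs
oddGaps (false ∷ xs) = not (oddGaps xs)

oddBeads evenGaps : List Bool → ℕ
oddBeads []           = 0
oddBeads (true  ∷ xs) = bit (oddGaps xs) + oddBeads xs
oddBeads (false ∷ xs) = oddBeads xs
evenGaps []           = 0
evenGaps (true  ∷ xs) = evenGaps xs
evenGaps (false ∷ xs) = bit (not (oddGaps xs)) + evenGaps xs

#beads+#gaps : ∀ xs → #beads xs + #gaps xs ≡ length xs
#beads+#gaps []           = refl
#beads+#gaps (true  ∷ xs) = cong suc (#beads+#gaps xs)
#beads+#gaps (false ∷ xs) = trans (+-suc (#beads xs) (#gaps xs)) (cong suc (#beads+#gaps xs))

#beads≤length : ∀ xs → #beads xs ≤ length xs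
#beads≤length xs = subst (#beads xs ≤_) (#beads+#gaps xs) (m≤m+n _ _)

#beads-++ : ∀ xs ys → #beads (xs ++ ys) ≡ #beads xs + #beads ys
#beads-++ []       ys = refl
#beads-++ (x ∷ xs) ys = trans (cong (bit x +_) (#beads-++ xs ys)) (sym (+-assoc (bit x) _ _))

#gaps-++ : ∀ xs ys → #gaps (xs ++ ys) ≡ #gaps xs + #gaps ys
#gaps-++ []       ys = refl
#gaps-++ (x ∷ xs) ys = trans (cong (bit (not x) +_) (#gaps-++ xs ys)) (sym (+-assoc (bit (not x)) _ _))

#gaps-map-not : ∀ xs → #gaps (List.map not xs) ≡ #beads xs
#gaps-map-not []           = refl
#gaps-map-not (true  ∷ xs) = cong suc (#gaps-map-not xs)
#gaps-map-not (false ∷ xs) = #gaps-map-not xs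

inversions-++ : ∀ xs ys → #beads xs * #gaps ys ≤ inversions (xs ++ ys)
inversions-++ []           ys = z≤n
inversions-++ (true  ∷ xs) ys = +-mono-≤
  (≤-trans (m≤n+m (#gaps ys) (#gaps xs)) (≤-reflexive (sym (#gaps-++ xs ys)))) (inversions-++ xs ys)
inversions-++ (false ∷ xs) ys = inversions-++ xs ys

inversions-full : ∀ xs ys → #gaps ys ≡ 0 → inversions (xs ++ ys) ≡ inversions xs
inversions-full []           []          p = refl
inversions-full []           (true ∷ ys) p = cong₂ _+_ p (inversions-full [] ys p)
inversions-full (true  ∷ xs) ys          p = cong₂ _+_
  (trans (#gaps-++ xs ys) (trans (cong (#gaps xs +_) p) (+-identityʳ _))) (inversions-full xs ys p)
inversions-full (false ∷ xs) ys          p = inversions-full xs ys p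

isOdd : ℕ → Bool
isOdd zero    = false
isOdd (suc n) = not (isOdd n)

parity-half : ∀ xs → ∃[ k ] #gaps xs ≡ bit (oddGaps xs) + (k + k)
parity-half []           = 0 , refl
parity-half (true  ∷ xs) = parity-half xs
parity-half (false ∷ xs) with oddGaps xs | parity-half xs
... | false | k , p = k , cong suc p
... | true  | k , p = suc k , trans (cong suc p) (cong suc (sym (+-suc k k)))

-- A part exceeds its remainder modulo 2 by an even number, and `inversions` is the sum of the
-- parts.
inversions-oddBeads : ∀ xs → ∃[ k ] inversions xs ≡ oddBeads xs + (k + k)
inversions-oddBeads []           = 0 , refl
inversions-oddBeads (false ∷ xs) = inversions-oddBeads xs
inversions-oddBeads (true  ∷ xs) =
  let k , p = parity-half xs ; l , q = inversions-oddBeads xs in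
  k + l , trans (cong₂ _+_ p q) (regroup (bit (oddGaps xs)) k (oddBeads xs) l)
  where
  regroup : ∀ a k b l → a + (k + k) + (b + (l + l)) ≡ a + b + (k + l + (k + l))
  regroup = solve-∀

-- From the bottom up, the number of gaps below a gap is alternately even and odd.
evenGaps-half : ∀ xs c → #gaps xs ≡ c + c → evenGaps xs ≡ c × oddGaps xs ≡ false
evenGaps-half xs c p = even (oddGaps xs) refl
  where
  general : ∀ xs → evenGaps xs + evenGaps xs ≡ bit (oddGaps xs) + #gaps xs
  general []           = refl
  general (true  ∷ xs) = general xs
  general (false ∷ xs) with oddGaps xs | general xs
  ... | false | q = cong suc (trans (+-suc (evenGaps xs) (evenGaps xs)) (cong suc q))
  ... | true  | q = q
  2*-injective : ∀ a b → a + a ≡ b + b → a ≡ b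
  2*-injective zero    zero    _ = refl
  2*-injective (suc a) (suc b) q = cong suc (2*-injective a b
    (suc-injective (trans (sym (+-suc a a)) (trans (suc-injective q) (+-suc b b)))))
  odd≢even : ∀ a b → a + a ≢ suc (b + b)
  odd≢even (suc a) (suc b) q = odd≢even a b
    (suc-injective (trans (sym (+-suc a a)) (trans (suc-injective q) (cong suc (+-suc b b)))))
  odd≢even (suc a) zero    q = 1+n≢0 (trans (sym (+-suc a a)) (suc-injective q))
  even : ∀ b → oddGaps xs ≡ b → evenGaps xs ≡ c × oddGaps xs ≡ false
  even false q = 2*-injective _ c (trans (general xs) (cong₂ (λ b n → bit b + n) q p)) , q
  even true  q = ⊥-elim (odd≢even (evenGaps xs) c (trans (general xs) (cong₂ (λ b n → bit b + n) q p)))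

-- With an even number of beads in all, the beads above a gap are odd in number iff those below are.
inversions-map-not : ∀ xs c → #beads xs ≡ c + c →
                     ∃[ k ] inversions xs ≡ oddBeads (List.map not xs) + (k + k)
inversions-map-not xs c p =
  let k , q = general xs 0 (trans (proj₂ (evenGaps-half (List.map not xs) c (trans (#gaps-map-not xs) p))) refl)
  in k , q
  where
  half : ∀ n → ∃[ k ] n ≡ bit (isOdd n) + (k + k)
  half zero    = 0 , refl
  half (suc n) with isOdd n | half n
  ... | false | k , e = k , cong suc e
  ... | true  | k , e = suc k , trans (cong suc e) (cong suc (sym (+-suc k k)))
  not≡not : ∀ {a b} → not a ≡ b → a ≡ not b
  not≡not {a} refl = sym (Bool.not-involutive a)
  -- Inversions are counted by gaps instead of beads: each gap counts the beads above it, of which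
  -- `a` have already been passed.
  general : ∀ xs a → oddGaps (List.map not xs) ≡ isOdd a →
            ∃[ k ] a * #gaps xs + inversions xs ≡ oddBeads (List.map not xs) + (k + k)
  general []           a e = 0 , trans (+-identityʳ _) (*-zeroʳ a)
  general (true  ∷ xs) a e =
    let k , q = general xs (suc a) (not≡not e) in
    k , trans (regroup a (#gaps xs) (inversions xs)) q
    where
    regroup : ∀ a g i → a * g + (g + i) ≡ suc a * g + i
    regroup = solve-∀
  general (false ∷ xs) a e with half a | general xs a e
  ... | k , p | l , q rewrite e = k + l , (begin
    a * suc (#gaps xs) + inversions xs                  ≡⟨ regroup₁ a (#gaps xs) (inversions xs) ⟩
    a + (a * #gaps xs + inversions xs)                  ≡⟨ cong₂ _+_ p q ⟩
    bit (isOdd a) + (k + k) + (oddBeads (List.map not xs) + (l + l))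
                                                        ≡⟨ regroup₂ (bit (isOdd a)) k _ l ⟩
    bit (isOdd a) + oddBeads (List.map not xs) + (k + l + (k + l)) ∎)
    where
    open ≡-Reasoning
    regroup₁ : ∀ a g i → a * suc g + i ≡ a + (a * g + i)
    regroup₁ = solve-∀
    regroup₂ : ∀ a k b l → a + (k + k) + (b + (l + l)) ≡ a + b + (k + l + (k + l))
    regroup₂ = solve-∀

-- Runners

heads : ∀ {n} → Abacus (suc n) → List Bool
heads = List.map Vec.head

tails : ∀ {n} → Abacus (suc n) → Abacus n
tails = List.map Vec.tail

-- The total size of the e-quotient: each runner, read as a word of its own, is one of its
-- components.
excess : ∀ {n} → Abacus n → ℕ
excess {zero}  M = 0
excess {suc n} M = inversions (heads M) + excess (tails M)

beads-heads : ∀ {n} (M : Abacus (suc n)) → beads M ≡ #beads (heads M) ∷ beads (tails M)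
beads-heads []            = refl
beads-heads ((x ∷ v) ∷ M) = cong (Vec.map bit (x ∷ v) +ᵥ_) (beads-heads M)

-- The height of a bead is the number of gaps plus the number of beads below it on its runner. The
-- gaps add up to `inversions`, the beads to `triangle`.
levels-excess : ∀ {n} (M : Abacus n) → levels M ≡ excess M + triangles (beads M)
levels-excess {zero} M = trans (no-levels M) (sym (no-triangles (beads M)))
  where
  no-levels : (M : Abacus 0) → levels M ≡ 0
  no-levels []       = refl
  no-levels ([] ∷ M) = trans (cong (_+ levels M) (*-zeroʳ (length M))) (no-levels M)
  no-triangles : (v : Vec ℕ 0) → triangles v ≡ 0
  no-triangles [] = refl
levels-excess {suc n} M = begin
  levels M                                              ≡⟨ runner M ⟩
  inversions (heads M) + triangle t + levels (tails M)  ≡⟨ cong (inversions (heads M) + triangle t +_) (levels-excess (tails M)) ⟩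
  inversions (heads M) + triangle t + (excess (tails M) + triangles (beads (tails M)))
    ≡⟨ regroup (inversions (heads M)) (triangle t) (excess (tails M)) _ ⟩
  excess M + triangles (t ∷ beads (tails M))            ≡⟨ cong (λ u → excess M + triangles u) (beads-heads M) ⟨
  excess M + triangles (beads M)                        ∎
  where
  open ≡-Reasoning
  t = #beads (heads M)
  regroup : ∀ i t e s → i + t + (e + s) ≡ i + e + (t + s)
  regroup = solve-∀
  runner : ∀ (M : Abacus (suc n)) → levels M ≡ inversions (heads M) + triangle (#beads (heads M)) + levels (tails M)
  runner []                 = refl
  runner ((false ∷ v) ∷ M) = begin
    length M * trues v + levels M ≡⟨ cong₂ (λ l m → l * trues v + m) (sym (List.length-map Vec.tail M)) (runner M) ⟩
    length (tails M) * trues v + (inversions (heads M) + triangle (#beads (heads M)) + levels (tails M))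
      ≡⟨ +-swap (length (tails M) * trues v) (inversions (heads M) + triangle (#beads (heads M))) _ ⟩
    inversions (heads M) + triangle (#beads (heads M)) + (length (tails M) * trues v + levels (tails M)) ∎
  runner ((true ∷ v) ∷ M) = begin
    length M * suc (trues v) + levels M
      ≡⟨ cong₂ (λ l m → l + m) (*-suc (length M) (trues v)) (runner M) ⟩
    length M + length M * trues v + (inversions (heads M) + triangle (#beads (heads M)) + levels (tails M))
      ≡⟨ cong₂ (λ l k → l + k * trues v + (inversions (heads M) + triangle (#beads (heads M)) + levels (tails M)))
           (trans (sym (List.length-map Vec.head M)) (sym (#beads+#gaps (heads M)))) (sym (List.length-map Vec.tail M)) ⟩
    #beads (heads M) + #gaps (heads M) + length (tails M) * trues v
      + (inversions (heads M) + triangle (#beads (heads M)) + levels (tails M))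
      ≡⟨ regroup₂ (#beads (heads M)) (#gaps (heads M)) (length (tails M) * trues v) (inversions (heads M)) _ _ ⟩
    #gaps (heads M) + inversions (heads M) + (#beads (heads M) + triangle (#beads (heads M)))
      + (length (tails M) * trues v + levels (tails M)) ∎
    where
    regroup₂ : ∀ t f r i s l → t + f + r + (i + s + l) ≡ f + i + (t + s) + (r + l)
    regroup₂ = solve-∀

Realises⇒excess : ∀ {n d w θ} {M : Abacus n} → Realises d w θ M → excess M ≡ w
Realises⇒excess {M = M} (realises refl lev _) = +-cancelʳ-≡ (triangles (beads M)) _ _ (trans (sym (levels-excess M)) lev)

excess⇒Realises : ∀ {n d w θ} (M : Abacus n) → beads M ≡ d → excess M ≡ w → odds M ≡ θ → Realises d w θ M
excess⇒Realises M refl refl o = realises refl (levels-excess M) o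

-- Empty rows on top

Empty : ∀ {n} → Abacus n → Set
Empty {n} = All (_≡ emptyRow n)

beads-Empty : ∀ {n} (U V : Abacus n) → Empty U → beads (U ++ V) ≡ beads V
beads-Empty []      V []         = refl
beads-Empty (_ ∷ U) V (refl ∷ a) = trans (beads-emptyRow (U ++ V)) (beads-Empty U V a)

odds-Empty : ∀ {n} (U V : Abacus n) → Empty U → odds (U ++ V) ≡ odds V
odds-Empty []      V []         = refl
odds-Empty (_ ∷ U) V (refl ∷ a) = trans (odds-emptyRow (U ++ V)) (odds-Empty U V a)

levels-Empty : ∀ {n} (U V : Abacus n) → Empty U → levels (U ++ V) ≡ levels V
levels-Empty []      V []         = refl
levels-Empty (_ ∷ U) V (refl ∷ a) = trans (levels-emptyRow (U ++ V)) (levels-Empty U V a)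

excess-Empty : ∀ {n} (U V : Abacus n) → Empty U → excess (U ++ V) ≡ excess V
excess-Empty U V a = +-cancelʳ-≡ (triangles (beads V)) _ _ (begin
  excess (U ++ V) + triangles (beads V)          ≡⟨ cong (λ b → excess (U ++ V) + triangles b) (beads-Empty U V a) ⟨
  excess (U ++ V) + triangles (beads (U ++ V))   ≡⟨ levels-excess (U ++ V) ⟨
  levels (U ++ V)                                ≡⟨ levels-Empty U V a ⟩
  levels V                                       ≡⟨ levels-excess V ⟩
  excess V + triangles (beads V)                 ∎)
  where open ≡-Reasoning

Empty-replicate : ∀ {n} k → Empty (List.replicate k (emptyRow n))
Empty-replicate zero    = []
Empty-replicate (suc k) = refl ∷ Empty-replicate k

split-at-length : ∀ {A : Set} k (M : List A) → k ≤ length M → ∃₂ λ U V → M ≡ U ++ V × length V ≡ k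
split-at-length k M k≤ = List.take (length M ∸ k) M , List.drop (length M ∸ k) M ,
  sym (List.take++drop≡id (length M ∸ k) M) ,
  trans (List.length-drop (length M ∸ k) M) (m∸[m∸n]≡n k≤)

Realises-pad : ∀ {n d w θ} (M : Abacus n) k → length M ≤ k → Realises d w θ M →
               ∃[ M′ ] (length M′ ≡ k × Realises d w θ M′)
Realises-pad M k l≤k R = pad (k ∸ length M) M (m∸n+n≡m l≤k) R
  where
  pad : ∀ {n d w θ k} j (M : Abacus n) → j + length M ≡ k → Realises d w θ M → ∃[ M′ ] (length M′ ≡ k × Realises d w θ M′)
  pad zero    M l R = M , l , R
  pad (suc j) M l R = pad j (emptyRow _ ∷ M) (trans (+-suc j (length M)) l) (Realises-emptyRow R)

-- Stacking a runner on top of the others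

-- This is 2h + 1, in steps of two because the runners are later removed in pairs.
runners : ℕ → ℕ
runners zero    = 1
runners (suc h) = suc (suc (runners h))

odd-row : ∀ h g → gapParityRow (emptyRow (runners h)) g ≡ not g
odd-row zero    g = refl
odd-row (suc h) g = trans (Bool.not-involutive _) (odd-row h g)

even-row : ∀ h g → gapParityRow (emptyRow (suc (runners h))) g ≡ g
even-row h g = trans (cong not (odd-row h g)) (Bool.not-involutive g)

-- full M would be the number of odd beads on an additional, full runner above the runners of M.
full : ∀ {n} → Abacus n → ℕ
full []      = 0
full (r ∷ M) = bit (gapParity (r ∷ M)) + full M

-- M as an abacus whose new runner is full up to the top of M and continues with xs above it.
stack : ∀ {n} → List Bool → Abacus n → Abacus (suc n)
stack {n} xs M = List.map (_∷ emptyRow n) xs ++ List.map (true ∷_) M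

module _ {n : ℕ} where

  heads-stack : ∀ xs (M : Abacus n) → heads (stack xs M) ≡ xs ++ List.replicate (length M) true
  heads-stack []       []      = refl
  heads-stack []       (r ∷ M) = cong (true ∷_) (heads-stack [] M)
  heads-stack (x ∷ xs) M       = cong (x ∷_) (heads-stack xs M)

  tails-stack : ∀ xs (M : Abacus n) → tails (stack xs M) ≡ List.replicate (length xs) (emptyRow n) ++ M
  tails-stack []       []      = refl
  tails-stack []       (r ∷ M) = cong (r ∷_) (tails-stack [] M)
  tails-stack (x ∷ xs) M       = cong (emptyRow n ∷_) (tails-stack xs M)

  length-stack : ∀ xs (M : Abacus n) → length (stack xs M) ≡ length xs + length M
  length-stack xs M = trans (List.length-++ (List.map (_∷ emptyRow n) xs))
    (cong₂ _+_ (List.length-map (_∷ emptyRow n) xs) (List.length-map (true ∷_) M))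

  #beads-replicate : ∀ k → #beads (List.replicate k true) ≡ k
  #beads-replicate zero    = refl
  #beads-replicate (suc k) = cong suc (#beads-replicate k)

  #gaps-replicate : ∀ k → #gaps (List.replicate k true) ≡ 0
  #gaps-replicate zero    = refl
  #gaps-replicate (suc k) = #gaps-replicate k

  beads-stack : ∀ xs (M : Abacus n) → beads (stack xs M) ≡ (#beads xs + length M) ∷ beads M
  beads-stack xs M = trans (beads-heads (stack xs M)) (cong₂ _∷_
    (trans (cong #beads (heads-stack xs M)) (trans (#beads-++ xs _) (cong (#beads xs +_) (#beads-replicate (length M)))))
    (trans (cong beads (tails-stack xs M)) (beads-Empty _ M (Empty-replicate (length xs)))))

  excess-stack : ∀ xs (M : Abacus n) → excess (stack xs M) ≡ inversions xs + excess M
  excess-stack xs M = cong₂ _+_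
    (trans (cong inversions (heads-stack xs M)) (inversions-full xs _ (#gaps-replicate (length M))))
    (trans (cong excess (tails-stack xs M)) (excess-Empty _ M (Empty-replicate (length xs))))

  gapParity-full : ∀ (M : Abacus n) → gapParity (stack [] M) ≡ gapParity M
  gapParity-full []      = refl
  gapParity-full (r ∷ M) = cong (gapParityRow r) (gapParity-full M)

  full-full : ∀ (M : Abacus n) → full (stack [] M) ≡ full M
  full-full []      = refl
  full-full (r ∷ M) = cong₂ (λ g f → bit g + f) (gapParity-full (r ∷ M)) (full-full M)

  odds-full : ∀ (M : Abacus n) → odds (stack [] M) ≡ full M ∷ odds M
  odds-full []      = refl
  odds-full (r ∷ M) = trans (cong (oddsRow (gapParity (stack [] M)) (true ∷ r) +ᵥ_) (odds-full M))
    (cong (λ g → bit (gapParityRow r g) + full M ∷ oddsRow g r +ᵥ odds M) (gapParity-full M))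

  odds-stack-∷ : ∀ x xs (M : Abacus n) {a os} → odds (stack xs M) ≡ a ∷ os →
    odds (stack (x ∷ xs) M) ≡ (bit (x ∧ gapParityRow (emptyRow n) (gapParity (stack xs M))) + a) ∷ os
  odds-stack-∷ x xs M {a} {os} e = trans (cong (oddsRow (gapParity (stack xs M)) (x ∷ emptyRow n) +ᵥ_) e)
    (cong ((bit (x ∧ gapParityRow (emptyRow n) (gapParity (stack xs M))) + a) ∷_) (trans (cong (_+ᵥ os) (oddsRow-emptyRow n _)) (+ᵥ-identityˡ os)))

  private
    regroup₁ : ∀ a b c d → a + (b + c + d) ≡ a + b + c + d
    regroup₁ = solve-∀
    regroup₂ : ∀ a b c d → a + (b + c + d) ≡ b + (a + c) + d
    regroup₂ = solve-∀

  -- An even number of empty positions per row preserves parity, so the beads of `xs` have the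
  -- parities they would have on a single runner. A further full runner sees the parity at the end
  -- of each row, which is odd exactly at the odd beads and the even gaps of `xs`.
  stack-even : (∀ g → gapParityRow (emptyRow n) g ≡ g) → ∀ xs (M : Abacus n) → gapParity M ≡ false →
    gapParity (stack xs M) ≡ oddGaps xs × odds (stack xs M) ≡ (oddBeads xs + full M) ∷ odds M
      × full (stack xs M) ≡ oddBeads xs + evenGaps xs + full M
  stack-even even [] M p = trans (gapParity-full M) p , odds-full M , full-full M
  stack-even even (x ∷ xs) M p with stack-even even xs M p
  stack-even even (true ∷ xs) M p | g , o , f =
    trans (even _) g ,
    trans (odds-stack-∷ true xs M o) (cong (_∷ odds M) (trans (cong (λ g → bit g + (oddBeads xs + full M)) (trans (even _) g)) (sym (+-assoc (bit (oddGaps xs)) _ _)))) ,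
    trans (cong₂ (λ g f → bit g + f) (trans (even _) g) f) (regroup₁ (bit (oddGaps xs)) (oddBeads xs) (evenGaps xs) (full M))
  stack-even even (false ∷ xs) M p | g , o , f =
    cong not (trans (even _) g) ,
    odds-stack-∷ false xs M o ,
    trans (cong₂ (λ g f → bit (not g) + f) (trans (even _) g) f) (regroup₂ (bit (not (oddGaps xs))) (oddBeads xs) (evenGaps xs) (full M))

  -- On top of an odd number of runners the beads and gaps of the word change roles.
  stack-odd : (∀ g → gapParityRow (emptyRow n) g ≡ not g) → ∀ xs (M : Abacus n) → gapParity M ≡ false →
    let xs′ = List.map not xs in
    gapParity (stack xs M) ≡ oddGaps xs′ × odds (stack xs M) ≡ (evenGaps xs′ + full M) ∷ odds M
      × full (stack xs M) ≡ oddBeads xs′ + evenGaps xs′ + full M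
  stack-odd odd [] M p = trans (gapParity-full M) p , odds-full M , full-full M
  stack-odd odd (x ∷ xs) M p with stack-odd odd xs M p
  stack-odd odd (true ∷ xs) M p | g , o , f =
    trans (odd _) (cong not g) ,
    trans (odds-stack-∷ true xs M o) (cong (_∷ odds M)
      (trans (cong (λ g → bit g + (evenGaps (List.map not xs) + full M)) (trans (odd _) (cong not g))) (sym (+-assoc (bit (not (oddGaps (List.map not xs)))) _ _)))) ,
    trans (cong₂ (λ g f → bit g + f) (trans (odd _) (cong not g)) f)
      (regroup₂ (bit (not (oddGaps (List.map not xs)))) (oddBeads (List.map not xs)) (evenGaps (List.map not xs)) (full M))
  stack-odd odd (false ∷ xs) M p | g , o , f =
    trans (cong not (odd _)) (trans (Bool.not-involutive _) g) ,
    odds-stack-∷ false xs M o ,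
    trans (cong₂ (λ g f → bit g + f) (trans (cong not (odd _)) (trans (Bool.not-involutive _) g)) f)
      (regroup₁ (bit (oddGaps (List.map not xs))) (oddBeads (List.map not xs)) (evenGaps (List.map not xs)) (full M))

-- Beside all `T` beads `v` has room for `q` gaps, so a bead in `u` would lie above `q` gaps.
above-empty : ∀ {q T} u v → #beads (u ++ v) ≡ T → inversions (u ++ v) < q → q + T ≤ length v → #beads u ≡ 0
above-empty {q} {T} u v t i<q len with #beads u in eq
... | zero  = refl
... | suc k = ⊥-elim (<⇒≱ i<q (begin
  q                     ≤⟨ +-cancelʳ-≤ (#beads v) q (#gaps v) bound ⟩
  #gaps v               ≤⟨ m≤m+n (#gaps v) (k * #gaps v) ⟩
  suc k * #gaps v       ≡⟨ cong (_* #gaps v) eq ⟨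
  #beads u * #gaps v    ≤⟨ inversions-++ u v ⟩
  inversions (u ++ v)   ∎))
  where
  open ≤-Reasoning
  bound : q + #beads v ≤ #gaps v + #beads v
  bound = begin
    q + #beads v                ≤⟨ +-monoʳ-≤ q (m≤n+m (#beads v) (#beads u)) ⟩
    q + (#beads u + #beads v)   ≡⟨ cong (q +_) (trans (sym (#beads-++ u v)) t) ⟩
    q + T                       ≤⟨ len ⟩
    length v                    ≡⟨ #beads+#gaps v ⟨
    #beads v + #gaps v          ≡⟨ +-comm (#beads v) (#gaps v) ⟩
    #gaps v + #beads v          ∎

-- At most `length v` beads fit into `v`, so at least `q` are in `u`, and a gap in `v` would lie
-- below all of these.
below-full : ∀ {q} u v → #beads (u ++ v) ≡ length v + q → inversions (u ++ v) < q → #gaps v ≡ 0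
below-full {q} u v t i<q with #gaps v in eq
... | zero  = refl
... | suc k = ⊥-elim (<⇒≱ i<q (begin
  q                     ≤⟨ +-cancelʳ-≤ (#beads v) q (#beads u) bound ⟩
  #beads u              ≤⟨ m≤m*n (#beads u) (suc k) ⟩
  #beads u * suc k      ≡⟨ cong (#beads u *_) eq ⟨
  #beads u * #gaps v    ≤⟨ inversions-++ u v ⟩
  inversions (u ++ v)   ∎))
  where
  open ≤-Reasoning
  bound : q + #beads v ≤ #beads u + #beads v
  bound = begin
    q + #beads v             ≤⟨ +-monoʳ-≤ q (#beads≤length v) ⟩
    q + length v             ≡⟨ +-comm q (length v) ⟩
    length v + q             ≡⟨ t ⟨
    #beads (u ++ v)          ≡⟨ #beads-++ u v ⟩
    #beads u + #beads v      ∎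

Empty-rows : ∀ {n} (U : Abacus (suc n)) → #beads (heads U) ≡ 0 → Empty (tails U) → Empty U
Empty-rows []                  p []         = []
Empty-rows ((false ∷ _) ∷ U) p (refl ∷ a) = refl ∷ Empty-rows U p a

rows-above : ∀ {n} (U : Abacus (suc n)) → Empty (tails U) → U ≡ List.map (_∷ emptyRow n) (heads U)
rows-above []            []         = refl
rows-above ((x ∷ _) ∷ U) (refl ∷ a) = cong (_ ∷_) (rows-above U a)

rows-below : ∀ {n} (V : Abacus (suc n)) → #gaps (heads V) ≡ 0 → V ≡ List.map (true ∷_) (tails V)
rows-below []                 p = refl
rows-below ((true ∷ v) ∷ V) p = cong (_ ∷_) (rows-below V p)

module _ {n} (U V : Abacus (suc n)) where

  heads-++ : heads (U ++ V) ≡ heads U ++ heads V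
  heads-++ = List.map-++ Vec.head U V

  tails-++ : tails (U ++ V) ≡ tails U ++ tails V
  tails-++ = List.map-++ Vec.tail U V

-- All statistics of a word are carried together so that an explicit word can be evaluated block by
-- block.
data Bits : ℕ → ℕ → Bool → ℕ → ℕ → List Bool → Set where
  bits : ∀ {b g p o i xs} → #beads xs ≡ b → #gaps xs ≡ g → oddGaps xs ≡ p → oddBeads xs ≡ o → inversions xs ≡ i →
         Bits b g p o i xs

add-beads : ∀ k {b g p o i xs} → Bits b g p o i xs → Bits (k + b) g p (k * bit p + o) (k * g + i) (List.replicate k true ++ xs)
add-beads zero    B = B
add-beads (suc k) {g = g₀} {p₀} {o₀} {i₀} B with add-beads k B
... | bits b g p o i = bits (cong suc b) g p
  (trans (cong₂ (λ a c → bit a + c) p o) (sym (+-assoc (bit p₀) (k * bit p₀) o₀)))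
  (trans (cong₂ _+_ g i) (sym (+-assoc g₀ (k * g₀) i₀)))

add-gap : ∀ {b g p o i xs} → Bits b g p o i xs → Bits b (suc g) (not p) o i (false ∷ xs)
add-gap (bits b g p o i) = bits b (cong suc g) (cong not p) o i

add-gaps : ∀ k {b g p o i xs} → Bits b g p o i xs → ∃[ p′ ] Bits b (k + g) p′ o i (List.replicate k false ++ xs)
add-gaps zero    B = _ , B
add-gaps (suc k) B = _ , add-gap (proj₂ (add-gaps k B))

-- The word of the partition (2ᵏ, 1ʸ), with q beads and q gaps.
word : ∀ {q} y k → 2 ≤ q → y + (k + k) < q →
       ∃[ xs ] (#beads xs ≡ q × #gaps xs ≡ q × oddBeads xs ≡ y × inversions xs ≡ y + (k + k))
word {q} y k (s≤s (s≤s {n = m} z≤n)) lt with m≤n⇒∃[o]m+o≡n {k + y} {q} (begin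
    k + y        ≤⟨ m≤m+n (k + y) k ⟩
    k + y + k    ≡⟨ regroup k y ⟩
    y + (k + k)  ≤⟨ <⇒≤ lt ⟩
    q            ∎)
  where
  open ≤-Reasoning
  regroup : ∀ k y → k + y + k ≡ y + (k + k)
  regroup = solve-∀
... | r , eq with add-gaps m (add-beads k (add-gap (add-beads y (add-gap (add-beads r (bits {xs = []} refl refl refl refl refl))))))
... | p , bits b g _ o i =
  -- The `r` beads at the bottom have part 0 and fill up the number of beads; the `m` gaps on top
  -- lie below no bead and fill up the number of gaps.
  List.replicate m false ++ List.replicate k true ++ false ∷ List.replicate y true ++ false ∷ List.replicate r true ++ [] ,
  trans b (trans (regroup₁ k y r) eq) ,
  trans g (+-comm m 2) ,
  trans o (regroup₂ k y r) ,
  trans i (regroup₃ k y r)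
  where
  regroup₁ : ∀ k y r → k + (y + (r + 0)) ≡ k + y + r
  regroup₁ = solve-∀
  regroup₂ : ∀ k y r → k * 0 + (y * 1 + (r * 0 + 0)) ≡ y
  regroup₂ = solve-∀
  regroup₃ : ∀ k y r → k * 2 + (y * 1 + (r * 0 + 0)) ≡ y + (k + k)
  regroup₃ = solve-∀

-- A core with widely spaced runners

module RoCK (c : ℕ) where

  -- A bead leaving its zone would pass `q` gaps or let a gap fall below `q` beads, too much for a
  -- weight below `q`. So the runner of a zone of `z` rows always has `q` beads and `q` gaps there,
  -- and since `q` is even, no zone changes the parity seen by those above.
  q z : ℕ
  q = c + c
  z = q + q

  2≤q : ∀ {w} → w < q → 2 ≤ q
  2≤q w<q = double c (≤-<-trans z≤n w<q)
    where
    double : ∀ c → 0 < c + c → 2 ≤ c + c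
    double (suc c) _ = s≤s (≤-trans (s≤s z≤n) (m≤n+m (suc c) c))

  -- Bead counts of the core of a RoCK block (Rouquier, or Chuang and Kessar), from the longest
  -- runner down.
  rock : ∀ n → Vec ℕ n
  rock zero    = []
  rock (suc n) = (n * z + q) ∷ rock n

  above-rock : ∀ {n} (U V : Abacus n) → beads (U ++ V) ≡ rock n → excess (U ++ V) < q → n * z ≤ length V → Empty U
  above-rock {zero}  []       V b i len = []
  above-rock {zero}  ([] ∷ U) V b i len = refl ∷ above-rock U V (vec₀ _ _) i z≤n
    where
    vec₀ : (u v : Vec ℕ 0) → u ≡ v
    vec₀ [] [] = refl
  above-rock {suc n} U V b i len = Empty-rows U
    (above-empty (heads U) (heads V)
      (trans (cong #beads (sym (heads-++ U V))) (Vec.∷-injectiveˡ b′))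
      (≤-<-trans (≤-trans (≤-reflexive (cong inversions (sym (heads-++ U V)))) (m≤m+n _ _)) i)
      (≤-trans (≤-reflexive (regroup q (n * z))) (≤-trans len (≤-reflexive (sym (List.length-map Vec.head V))))))
    (above-rock (tails U) (tails V)
      (trans (cong beads (sym (tails-++ U V))) (Vec.∷-injectiveʳ b′))
      (≤-<-trans (≤-trans (≤-reflexive (cong excess (sym (tails-++ U V)))) (m≤n+m _ (inversions (heads (U ++ V))))) i)
      (≤-trans (m≤n+m (n * z) z) (≤-trans len (≤-reflexive (sym (List.length-map Vec.tail V))))))
    where
    b′ = trans (sym (beads-heads (U ++ V))) b
    regroup : ∀ q m → q + (m + q) ≡ q + q + m
    regroup = solve-∀

  -- All beads of the top runner below level n z are present, those of the others lie below that level.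
  peel : ∀ {n} (M : Abacus (suc n)) → beads M ≡ rock (suc n) → excess M < q → length M ≡ suc n * z →
    ∃₂ λ xs B → M ≡ stack xs B × #beads xs ≡ q × #gaps xs ≡ q × length B ≡ n * z × beads B ≡ rock n
              × excess M ≡ inversions xs + excess B
  peel {n} M b i len with split-at-length (n * z) M (≤-trans (m≤n+m (n * z) z) (≤-reflexive (sym len)))
  ... | U , V , refl , lenV =
    heads U , tails V , M≡ , #b , #g , lenB ,
    Vec.∷-injectiveʳ b″ , trans (cong excess M≡) (excess-stack (heads U) (tails V))
    where
    b′ : #beads (heads (U ++ V)) ∷ beads (tails (U ++ V)) ≡ rock (suc n)
    b′ = trans (sym (beads-heads (U ++ V))) b
    lenB : length (tails V) ≡ n * z
    lenB = trans (List.length-map Vec.tail V) lenV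
    empty : Empty (tails U)
    empty = above-rock (tails U) (tails V)
      (trans (cong beads (sym (tails-++ U V))) (Vec.∷-injectiveʳ b′))
      (≤-<-trans (≤-trans (≤-reflexive (cong excess (sym (tails-++ U V)))) (m≤n+m _ (inversions (heads (U ++ V))))) i)
      (≤-reflexive (sym lenB))
    no-gaps : #gaps (heads V) ≡ 0
    no-gaps = below-full (heads U) (heads V)
      (trans (cong #beads (sym (heads-++ U V))) (trans (Vec.∷-injectiveˡ b′)
        (cong (_+ q) (sym (trans (List.length-map Vec.head V) lenV)))))
      (≤-<-trans (≤-trans (≤-reflexive (cong inversions (sym (heads-++ U V)))) (m≤m+n _ _)) i)
    M≡ : U ++ V ≡ stack (heads U) (tails V)
    M≡ = cong₂ _++_ (rows-above U empty) (rows-below V no-gaps)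
    b″ : (#beads (heads U) + length (tails V)) ∷ beads (tails V) ≡ rock (suc n)
    b″ = trans (sym (beads-stack (heads U) (tails V))) (trans (cong beads (sym M≡)) b)
    #b : #beads (heads U) ≡ q
    #b = +-cancelʳ-≡ (n * z) _ _ (trans (cong (#beads (heads U) +_) (sym lenB)) (trans (Vec.∷-injectiveˡ b″) (+-comm (n * z) q)))
    #g : #gaps (heads U) ≡ q
    #g = +-cancelˡ-≡ q _ _ (begin
      q + #gaps (heads U)                 ≡⟨ cong (_+ #gaps (heads U)) #b ⟨
      #beads (heads U) + #gaps (heads U)  ≡⟨ #beads+#gaps (heads U) ⟩
      length (heads U)                    ≡⟨ List.length-map Vec.head U ⟩
      length U                            ≡⟨ +-cancelʳ-≡ (length V) _ _ (trans (sym (List.length-++ U)) (trans len (cong (z +_) (sym lenV)))) ⟩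
      z                                   ∎)
      where open ≡-Reasoning

  -- Every zone adds to `full` its contribution to some entry of the vector and the constant `c`,
  -- half of its `q` gaps or, with roles exchanged, of its `q` beads.
  fullOf : ∀ h → Vec ℕ (suc h) → ℕ
  fullOf zero    (y ∷ []) = y + c
  fullOf (suc h) (y ∷ ys) = y + (c + (c + fullOf h ys))

  -- Runners are listed from the last one down, and so are the parameters: y₀ is the last entry of
  -- the argument.
  Φ : ∀ h → Vec ℕ (suc h) → Vec ℕ (runners h)
  Φ zero    (y ∷ []) = y ∷ []
  Φ (suc h) (y ∷ ys) = (y + (c + fullOf h ys)) ∷ (c + fullOf h ys) ∷ Φ h ys

  record Sequence (h : ℕ) (ys : Vec ℕ (suc h)) (M : Abacus (runners h)) : Set where
    constructor mkSequence
    field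
      odds≡      : odds M ≡ Φ h ys
      full≡      : full M ≡ fullOf h ys
      gapParity≡ : gapParity M ≡ false

  stack-zero : ∀ {B : Abacus 0} xs {y} → B ≡ [] → #gaps xs ≡ q → oddBeads xs ≡ y → Sequence 0 (y ∷ []) (stack xs B)
  stack-zero xs {y} refl g refl =
    let p , o , f = stack-even (λ _ → refl) xs [] refl
        eg , og   = evenGaps-half xs c g
    in mkSequence (trans o (cong (_∷ []) (+-identityʳ _))) (trans f (trans (+-identityʳ _) (cong (y +_) eg))) (trans p og)

  -- The word `xs′` stands on an odd number of runners: its own entry gets only the constant `c`,
  -- while its odd beads after the change of roles enter `full` and thereby all entries above. The
  -- word `xs` stands on an even number and already contributes to its own entry. Both contributions
  -- thus begin at the same entry and merge into one parameter.
  stack-suc : ∀ h {ys} {B : Abacus (runners h)} xs xs′ → Sequence h ys B → #gaps xs ≡ q → #beads xs′ ≡ q →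
    Sequence (suc h) (oddBeads xs + oddBeads (List.map not xs′) ∷ ys) (stack xs (stack xs′ B))
  stack-suc h {ys} {B} xs xs′ (mkSequence o f p) g b = mkSequence
    (trans o₂ (cong₂ _∷_ (trans (cong (oddBeads xs +_) full₁) (sym (+-assoc (oddBeads xs) _ _)))
      (trans o₁ (cong₂ _∷_ (cong₂ _+_ eg₁ f) o))))
    (begin
      full (stack xs (stack xs′ B))                       ≡⟨ f₂ ⟩
      oddBeads xs + evenGaps xs + full (stack xs′ B)      ≡⟨ cong₂ (λ a b → oddBeads xs + a + b) eg₂ full₁ ⟩
      oddBeads xs + c + (oddBeads xs″ + (c + fullOf h ys)) ≡⟨ regroup (oddBeads xs) c (oddBeads xs″) (fullOf h ys) ⟩
      oddBeads xs + oddBeads xs″ + (c + (c + fullOf h ys)) ∎)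
    (trans p₂ og₂)
    where
    open ≡-Reasoning
    xs″ = List.map not xs′
    regroup : ∀ a c b f → a + c + (b + (c + f)) ≡ a + b + (c + (c + f))
    regroup = solve-∀
    s₁ = stack-odd (odd-row h) xs′ B p
    h₁ = evenGaps-half xs″ c (trans (#gaps-map-not xs′) b)
    o₁ = proj₁ (proj₂ s₁)
    eg₁ = proj₁ h₁
    full₁ : full (stack xs′ B) ≡ oddBeads xs″ + (c + fullOf h ys)
    full₁ = trans (proj₂ (proj₂ s₁)) (trans (cong₂ (λ a b → oddBeads xs″ + a + b) eg₁ f) (+-assoc (oddBeads xs″) c _))
    s₂ = stack-even (even-row h) xs (stack xs′ B) (trans (proj₁ s₁) (proj₂ h₁))
    h₂ = evenGaps-half xs c g
    p₂ = proj₁ s₂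
    o₂ = proj₁ (proj₂ s₂)
    f₂ = proj₂ (proj₂ s₂)
    eg₂ = proj₁ h₂
    og₂ = proj₂ h₂

  analyse : ∀ h (M : Abacus (runners h)) → beads M ≡ rock (runners h) → excess M < q → length M ≡ runners h * z →
    ∃₂ λ ys k → Sequence h ys M × Vec.sum ys + (k + k) ≡ excess M
  analyse zero M b i len with peel M b i len
  ... | xs , [] , refl , #b , #g , lenB , bB , ex =
    let k , inv = inversions-oddBeads xs in
    oddBeads xs ∷ [] , k , stack-zero xs refl #g refl ,
    trans (cong (_+ (k + k)) (+-identityʳ (oddBeads xs))) (sym (trans ex (trans (+-identityʳ _) inv)))
  analyse (suc h) M b i len with peel M b i len
  ... | xs , B₁ , refl , #b , #g , lenB , bB , ex with peel B₁ bB (≤-<-trans (≤-trans (m≤n+m _ (inversions xs)) (≤-reflexive (sym ex))) i) lenB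
  ... | xs′ , B , refl , #b′ , #g′ , lenB′ , bB′ , ex′
    with analyse h B bB′ (≤-<-trans (≤-trans (m≤n+m _ (inversions xs′)) (≤-trans (≤-reflexive (sym ex′))
                            (≤-trans (m≤n+m _ (inversions xs)) (≤-reflexive (sym ex))))) i) lenB′
       | inversions-oddBeads xs | inversions-map-not xs′ c #b′
  ... | ys , k , S , sum | k₁ , inv₁ | k₂ , inv₂ =
    oddBeads xs + oddBeads (List.map not xs′) ∷ ys , k₁ + k₂ + k , stack-suc h xs xs′ S #g #b′ , (begin
      oddBeads xs + oddBeads xs″ + Vec.sum ys + (k₁ + k₂ + k + (k₁ + k₂ + k))
        ≡⟨ regroup (oddBeads xs) (oddBeads xs″) (Vec.sum ys) k₁ k₂ k ⟩
      (oddBeads xs + (k₁ + k₁)) + ((oddBeads xs″ + (k₂ + k₂)) + (Vec.sum ys + (k + k)))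
        ≡⟨ cong₂ _+_ (sym inv₁) (cong₂ _+_ (sym inv₂) sum) ⟩
      inversions xs + (inversions xs′ + excess B)   ≡⟨ cong (inversions xs +_) ex′ ⟨
      inversions xs + excess (stack xs′ B)          ≡⟨ ex ⟨
      excess (stack xs (stack xs′ B))               ∎)
    where
    open ≡-Reasoning
    xs″ = List.map not xs′
    regroup : ∀ a b s k l m → a + b + s + (k + l + m + (k + l + m)) ≡ (a + (k + k)) + ((b + (l + l)) + (s + (m + m)))
    regroup = solve-∀

  -- Each parameter is realised in the upper zone of its pair by parts 1, the lower zone staying at
  -- rest. The surplus `k + k` goes to the bottom zone as parts 2, which add no odd part.
  construct : ∀ h (ys : Vec ℕ (suc h)) k → Vec.sum ys + (k + k) < q →
    ∃[ M ] (Sequence h ys M × length M ≡ runners h * z × beads M ≡ rock (runners h) × excess M ≡ Vec.sum ys + (k + k))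
  construct zero (y ∷ []) k lt =
    let xs , #b , #g , ob , inv = word y k (2≤q lt) (subst (λ a → a + (k + k) < q) (+-identityʳ y) lt) in
    stack xs [] , stack-zero xs refl #g ob ,
    trans (length-stack {0} xs []) (cong (_+ 0) (trans (sym (#beads+#gaps xs)) (cong₂ _+_ #b #g))) ,
    trans (beads-stack {0} xs []) (cong (_∷ []) (trans (+-identityʳ _) #b)) ,
    trans (excess-stack {0} xs []) (trans (+-identityʳ _) (trans inv (cong (_+ (k + k)) (sym (+-identityʳ y)))))
  construct (suc h) (y ∷ ys) k lt =
    let xs , #b , #g , ob , inv = word y 0 (2≤q lt) (≤-<-trans (≤-trans (≤-reflexive (+-identityʳ y)) (≤-trans (m≤m+n y _) (m≤m+n _ _))) lt)
        xs′ , #b′ , #g′ , _ , inv′ = word 0 0 (2≤q lt) (≤-<-trans z≤n lt)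
        B , S , len , bB , ex = construct h ys k (≤-<-trans (≤-trans (m≤n+m _ y) (≤-reflexive (sym (+-assoc y _ _)))) lt)
        l , inv″ = inversions-map-not xs′ c #b′
        ob′ = m+n≡0⇒m≡0 (oddBeads (List.map not xs′)) (trans (sym inv″) inv′)
        len′ = trans (length-stack xs′ B) (cong₂ _+_ (trans (sym (#beads+#gaps xs′)) (cong₂ _+_ #b′ #g′)) len)
    in stack xs (stack xs′ B) ,
       subst (λ a → Sequence (suc h) (a ∷ ys) (stack xs (stack xs′ B)))
         (trans (cong₂ _+_ ob ob′) (+-identityʳ y)) (stack-suc h xs xs′ S #g #b′) ,
       trans (length-stack xs (stack xs′ B)) (cong₂ _+_ (trans (sym (#beads+#gaps xs)) (cong₂ _+_ #b #g)) len′) ,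
       trans (beads-stack xs (stack xs′ B)) (cong₂ _∷_ (trans (cong₂ _+_ #b len′) (+-comm q _))
         (trans (beads-stack xs′ B) (cong₂ _∷_ (trans (cong₂ _+_ #b′ len) (+-comm q _)) bB))) ,
       trans (excess-stack xs (stack xs′ B)) (trans
         (cong₂ _+_ (trans inv (+-identityʳ y)) (trans (excess-stack xs′ B) (cong₂ _+_ inv′ ex))) (sym (+-assoc y _ _)))

  -- Since `analyse` wants exactly `runners h * z` rows, shorter abaci are padded, and longer ones
  -- are cut where `above-rock` shows all rows to be empty.
  rock-Realisable : ∀ h {w θ} → w < q →
    Realisable (rock (runners h)) w θ ⇔ (∃[ ys ] (∃[ k ] Vec.sum ys + (k + k) ≡ w) × Φ h ys ≡ θ)
  rock-Realisable h {w} {θ} w<q = mk⇔ forth back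
    where
    exact : (M : Abacus (runners h)) → length M ≡ runners h * z → Realises (rock (runners h)) w θ M →
            ∃[ ys ] (∃[ k ] Vec.sum ys + (k + k) ≡ w) × Φ h ys ≡ θ
    exact M len R@(realises b _ o) =
      let ex = Realises⇒excess R
          ys , k , mkSequence o′ _ _ , sum = analyse h M b (≤-<-trans (≤-reflexive ex) w<q) len
      in ys , (k , trans sum ex) , trans (sym o′) o
    forth : Realisable (rock (runners h)) w θ → ∃[ ys ] (∃[ k ] Vec.sum ys + (k + k) ≡ w) × Φ h ys ≡ θ
    forth (M , R) with ≤-total (length M) (runners h * z)
    ... | inj₁ len with Realises-pad M _ len R
    ...   | M′ , len′ , R′ = exact M′ len′ R′
    forth (M , R@(realises b l o)) | inj₂ len with split-at-length _ M len
    ...   | U , V , refl , len′ = exact V len′ (realises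
              (trans (sym (beads-Empty U V empty)) b) (trans (sym (levels-Empty U V empty)) l) (trans (sym (odds-Empty U V empty)) o))
      where
      empty = above-rock U V b (≤-<-trans (≤-reflexive (Realises⇒excess R)) w<q) (≤-reflexive (sym len′))
    back : ∃[ ys ] (∃[ k ] Vec.sum ys + (k + k) ≡ w) × Φ h ys ≡ θ → Realisable (rock (runners h)) w θ
    back (ys , (k , refl) , refl) =
      let M , mkSequence o _ _ , _ , b , ex = construct h ys k w<q in M , excess⇒Realises M b ex o

  Φ-injective : ∀ h {ys ys′} → Φ h ys ≡ Φ h ys′ → ys ≡ ys′
  Φ-injective zero    {y ∷ []} {y′ ∷ []} refl = refl
  Φ-injective (suc h) {y ∷ ys} {y′ ∷ ys′} p with Φ-injective h (Vec.∷-injectiveʳ (Vec.∷-injectiveʳ p))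
  ... | refl = cong (_∷ ys) (+-cancelʳ-≡ (c + fullOf h ys) y y′ (Vec.∷-injectiveˡ p))

  -- Every entry but the last contains a summand `c`, which is positive; the last entry is y₀
  -- itself.
  Φ-Zero : ∀ h .{{_ : NonZero c}} ys → Zero (Φ h ys) ⇔ Vec.last ys ≡ 0
  Φ-Zero zero    (y ∷ []) = mk⇔ (λ { (zero , p) → p }) (λ p → zero , p)
  Φ-Zero (suc h) (y ∷ ys) = mk⇔ forth (λ p → let i , p′ = from (Φ-Zero h ys) p in suc (suc i) , p′)
    where
    open Function.Bundles.Equivalence
    nonzero : ∀ f → c + f ≢ 0
    nonzero f p = ≢-nonZero⁻¹ c (m+n≡0⇒m≡0 c p)
    forth : Zero (Φ (suc h) (y ∷ ys)) → Vec.last ys ≡ 0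
    forth (zero , p)        = ⊥-elim (nonzero _ (m+n≡0⇒n≡0 y p))
    forth (suc zero , p)    = ⊥-elim (nonzero _ p)
    forth (suc (suc i) , p) = to (Φ-Zero h ys) (i , p)

  rock-entries : ∀ {W} n → W ≤ q → All (W ≤_) (toList (rock n))
  rock-entries zero    W≤q = []
  rock-entries (suc n) W≤q = ≤-trans W≤q (m≤n+m q (n * z)) ∷ rock-entries n W≤q

-- Parts, positions and runners of beads

partsOf : List Bool → List ℕ
partsOf []           = []
partsOf (true  ∷ xs) = #gaps xs ∷ partsOf xs
partsOf (false ∷ xs) = partsOf xs

-- F takes the position and the part of a bead.
beadSum : (ℕ → ℕ → ℕ) → List Bool → ℕ
beadSum F []           = 0
beadSum F (true  ∷ xs) = F (length xs) (#gaps xs) + beadSum F xs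
beadSum F (false ∷ xs) = beadSum F xs

-- The position of a bead is the beta-number of its part: the gaps below it plus the beads below it.
partSum : (ℕ → ℕ → ℕ) → List ℕ → ℕ
partSum F []       = 0
partSum F (x ∷ xs) = F (x + length xs) x + partSum F xs

length-partsOf : ∀ xs → length (partsOf xs) ≡ #beads xs
length-partsOf []           = refl
length-partsOf (true  ∷ xs) = cong suc (length-partsOf xs)
length-partsOf (false ∷ xs) = length-partsOf xs

beadSum≡partSum : ∀ F xs → beadSum F xs ≡ partSum F (partsOf xs)
beadSum≡partSum F []           = refl
beadSum≡partSum F (true  ∷ xs) = cong₂ (λ l s → F l (#gaps xs) + s)
  (trans (sym (#beads+#gaps xs)) (trans (+-comm (#beads xs) (#gaps xs)) (cong (#gaps xs +_) (sym (length-partsOf xs)))))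
  (beadSum≡partSum F xs)
beadSum≡partSum F (false ∷ xs) = beadSum≡partSum F xs

oddGaps≡isOdd : ∀ xs → oddGaps xs ≡ isOdd (#gaps xs)
oddGaps≡isOdd []           = refl
oddGaps≡isOdd (true  ∷ xs) = oddGaps≡isOdd xs
oddGaps≡isOdd (false ∷ xs) = cong not (oddGaps≡isOdd xs)

flat : ∀ {n} → Abacus n → List Bool
flat []      = []
flat (r ∷ M) = toList r ++ flat M

length-flat : ∀ {n} (M : Abacus n) → length (flat M) ≡ length M * n
length-flat []      = refl
length-flat (r ∷ M) = trans (List.length-++ (toList r)) (cong₂ _+_ (Vec.length-toList r) (length-flat M))

gapParityRow≡ : ∀ {m} (v : Vec Bool m) xs → gapParityRow v (oddGaps xs) ≡ oddGaps (toList v ++ xs)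
gapParityRow≡ []          xs = refl
gapParityRow≡ (true  ∷ v) xs = gapParityRow≡ v xs
gapParityRow≡ (false ∷ v) xs = cong not (gapParityRow≡ v xs)

gapParity≡ : ∀ {n} (M : Abacus n) → gapParity M ≡ oddGaps (flat M)
gapParity≡ []      = refl
gapParity≡ (r ∷ M) = trans (cong (gapParityRow r) (gapParity≡ M)) (gapParityRow≡ r (flat M))

onRunner : ∀ n .{{_ : NonZero n}} → ℕ → (ℕ → ℕ) → ℕ → ℕ → ℕ
onRunner n i φ b x = if (b % n) ≡ᵇ i then φ x else 0

oddBit unit : ℕ → ℕ
oddBit x = bit (isOdd x)
unit _ = 1


≡ᵇ-refl : ∀ m → (m ≡ᵇ m) ≡ true
≡ᵇ-refl zero    = refl
≡ᵇ-refl (suc m) = ≡ᵇ-refl m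

≢⇒≡ᵇ-false : ∀ m n → m ≢ n → (m ≡ᵇ n) ≡ false
≢⇒≡ᵇ-false zero    zero    p = ⊥-elim (p refl)
≢⇒≡ᵇ-false zero    (suc n) p = refl
≢⇒≡ᵇ-false (suc m) zero    p = refl
≢⇒≡ᵇ-false (suc m) (suc n) p = ≢⇒≡ᵇ-false m n (p ∘ cong suc)

rowSum : ∀ {m} → (ℕ → ℕ) → Vec Bool m → List Bool → Vec ℕ m
rowSum φ []      xs = []
rowSum φ (x ∷ v) xs = (if x then φ (#gaps (toList v ++ xs)) else 0) ∷ rowSum φ v xs

module _ {n : ℕ} .{{_ : NonZero n}} where

  private
    position : ∀ {m} (v : Vec Bool m) l xs → m < n → length xs ≡ l * n → (length (toList v ++ xs)) % n ≡ m
    position {m} v l xs m<n e = begin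
      length (toList v ++ xs) % n ≡⟨ cong (_% n) (trans (List.length-++ (toList v)) (cong₂ _+_ (Vec.length-toList v) e)) ⟩
      (m + l * n) % n             ≡⟨ [m+kn]%n≡m%n m l n ⟩
      m % n                       ≡⟨ m<n⇒m%n≡m m<n ⟩
      m                           ∎
      where open ≡-Reasoning

  skip-row : ∀ i φ {m} (v : Vec Bool m) l xs → m ≤ i → i < n → length xs ≡ l * n →
             beadSum (onRunner n i φ) (toList v ++ xs) ≡ beadSum (onRunner n i φ) xs
  skip-row i φ []          l xs m≤i i<n e = refl
  skip-row i φ (false ∷ v) l xs m<i i<n e = skip-row i φ v l xs (<⇒≤ m<i) i<n e
  skip-row i φ (true  ∷ v) l xs m<i i<n e = trans
    (cong (λ b → (if b then φ (#gaps (toList v ++ xs)) else 0) + beadSum (onRunner n i φ) (toList v ++ xs))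
      (trans (cong (_≡ᵇ i) (position v l xs (<-trans m<i i<n) e)) (≢⇒≡ᵇ-false _ i (<⇒≢ m<i))))
    (skip-row i φ v l xs (<⇒≤ m<i) i<n e)

  beadSum-row : ∀ φ {m} (v : Vec Bool m) l xs (k : Fin m) → m ≤ n → length xs ≡ l * n →
    let i = m ∸ suc (toℕ k) in
    beadSum (onRunner n i φ) (toList v ++ xs) ≡ Vec.lookup (rowSum φ v xs) k + beadSum (onRunner n i φ) xs
  beadSum-row φ (false ∷ v) l xs zero m<n e = skip-row _ φ v l xs ≤-refl m<n e
  beadSum-row φ {suc m} (true ∷ v) l xs zero m<n e = cong₂ (λ b s → (if b then φ (#gaps (toList v ++ xs)) else 0) + s)
    (trans (cong (_≡ᵇ m) (position v l xs m<n e)) (≡ᵇ-refl m))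
    (skip-row m φ v l xs ≤-refl m<n e)
  beadSum-row φ (false ∷ v) l xs (suc k) m<n e = beadSum-row φ v l xs k (<⇒≤ m<n) e
  beadSum-row φ {suc m} (true ∷ v) l xs (suc k) m<n e = trans
    (cong (λ b → (if b then φ (#gaps (toList v ++ xs)) else 0) + beadSum (onRunner n i φ) (toList v ++ xs))
      (trans (cong (_≡ᵇ i) (position v l xs m<n e)) (≢⇒≡ᵇ-false m i (>⇒≢ (∸-lt m (toℕ k) (Fin.toℕ<n k))))))
    (beadSum-row φ v l xs k (<⇒≤ m<n) e)
    where
    i = m ∸ suc (toℕ k)
    ∸-lt : ∀ m k → k < m → m ∸ suc k < m
    ∸-lt (suc m) k _ = s≤s (m∸n≤m m k)

  module _ (φ : ℕ → ℕ) (stat : Abacus n → Vec ℕ n)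
           (stat-[] : stat [] ≡ Vec.replicate n 0)
           (stat-∷ : ∀ r M → stat (r ∷ M) ≡ rowSum φ r (flat M) +ᵥ stat M) where

    -- Bead counts and odd counts are both sums over beads of a function of the part, so one
    -- induction serves both. `opposite` appears because rows start with the last runner.
    lookup-stat : ∀ M k → Vec.lookup (stat M) k ≡ beadSum (onRunner n (toℕ (opposite k)) φ) (flat M)
    lookup-stat []      k = trans (cong (λ u → Vec.lookup u k) stat-[]) (Vec.lookup-replicate k 0)
    lookup-stat (r ∷ M) k = begin
      Vec.lookup (stat (r ∷ M)) k
        ≡⟨ cong (λ u → Vec.lookup u k) (stat-∷ r M) ⟩
      Vec.lookup (rowSum φ r (flat M) +ᵥ stat M) k
        ≡⟨ Vec.lookup-zipWith _+_ k (rowSum φ r (flat M)) (stat M) ⟩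
      Vec.lookup (rowSum φ r (flat M)) k + Vec.lookup (stat M) k
        ≡⟨ cong (Vec.lookup (rowSum φ r (flat M)) k +_) (trans (lookup-stat M k) (cong (λ i → beadSum (onRunner n i φ) (flat M)) (Fin.opposite-prop k))) ⟩
      Vec.lookup (rowSum φ r (flat M)) k + beadSum (onRunner n (n ∸ suc (toℕ k)) φ) (flat M)
        ≡⟨ beadSum-row φ r (length M) (flat M) k ≤-refl (length-flat M) ⟨
      beadSum (onRunner n (n ∸ suc (toℕ k)) φ) (flat (r ∷ M))
        ≡⟨ cong (λ i → beadSum (onRunner n i φ) (flat (r ∷ M))) (Fin.opposite-prop k) ⟨
      beadSum (onRunner n (toℕ (opposite k)) φ) (flat (r ∷ M)) ∎
      where open ≡-Reasoning

  lookup-beads : ∀ (M : Abacus n) k → Vec.lookup (beads M) k ≡ beadSum (onRunner n (toℕ (opposite k)) unit) (flat M)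
  lookup-beads = lookup-stat unit beads refl (λ r M → cong (_+ᵥ beads M) (row≡ r (flat M)))
    where
    row≡ : ∀ {m} (v : Vec Bool m) xs → Vec.map bit v ≡ rowSum unit v xs
    row≡ []          xs = refl
    row≡ (true  ∷ v) xs = cong (1 ∷_) (row≡ v xs)
    row≡ (false ∷ v) xs = cong (0 ∷_) (row≡ v xs)

  lookup-odds : ∀ (M : Abacus n) k → Vec.lookup (odds M) k ≡ beadSum (onRunner n (toℕ (opposite k)) oddBit) (flat M)
  lookup-odds = lookup-stat oddBit odds refl (λ r M → cong (_+ᵥ odds M)
    (trans (cong (λ g → oddsRow g r) (gapParity≡ M)) (row≡ r (flat M))))
    where
    row≡ : ∀ {m} (v : Vec Bool m) xs → oddsRow (oddGaps xs) v ≡ rowSum oddBit v xs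
    row≡ []          xs = refl
    row≡ (true  ∷ v) xs = cong₂ (λ b u → bit b ∷ u) (trans (gapParityRow≡ v xs) (oddGaps≡isOdd (toList v ++ xs))) (row≡ v xs)
    row≡ (false ∷ v) xs = cong (0 ∷_) (row≡ v xs)

  onLevel : ℕ → ℕ → ℕ
  onLevel b _ = b / n

  levels≡ : ∀ (M : Abacus n) → levels M ≡ beadSum onLevel (flat M)
  levels≡ []      = refl
  levels≡ (r ∷ M) = sym (trans (along r ≤-refl) (cong (length M * trues r +_) (sym (levels≡ M))))
    where
    open ≡-Reasoning
    l = length M
    along : ∀ {m} (v : Vec Bool m) → m ≤ n → beadSum onLevel (toList v ++ flat M) ≡ l * trues v + beadSum onLevel (flat M)
    along []          m≤n = cong (_+ beadSum onLevel (flat M)) (sym (*-zeroʳ l))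
    along (false ∷ v) m<n = along v (<⇒≤ m<n)
    along {suc m} (true ∷ v) m<n = begin
      length (toList v ++ flat M) / n + beadSum onLevel (toList v ++ flat M)
        ≡⟨ cong₂ (λ b s → b / n + s) (trans (List.length-++ (toList v)) (cong₂ _+_ (Vec.length-toList v) (length-flat M))) (along v (<⇒≤ m<n)) ⟩
      (m + l * n) / n + (l * trues v + beadSum onLevel (flat M))
        ≡⟨ cong (_+ (l * trues v + beadSum onLevel (flat M))) (trans (+-distrib-/-∣ʳ m (divides-refl l)) (cong₂ _+_ (m<n⇒m/n≡0 m<n) (m*n/n≡m l n))) ⟩
      l + (l * trues v + beadSum onLevel (flat M))
        ≡⟨ regroup l (trues v) _ ⟩
      l * suc (trues v) + beadSum onLevel (flat M) ∎
      where
      regroup : ∀ l t s → l + (l * t + s) ≡ l * suc t + s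
      regroup = solve-∀

  #beads-flat : ∀ {m} (M : Abacus m) → #beads (flat M) ≡ Vec.sum (beads M)
  #beads-flat {m} []      = sym (zeros m)
    where
    zeros : ∀ m → Vec.sum (Vec.replicate m 0) ≡ 0
    zeros zero    = refl
    zeros (suc m) = zeros m
  #beads-flat (r ∷ M) = trans (#beads-++ (toList r) (flat M)) (trans (cong (#beads (toList r) +_) (#beads-flat M)) (along r (beads M)))
    where
    along : ∀ {m} (v : Vec Bool m) u → #beads (toList v) + Vec.sum u ≡ Vec.sum (Vec.map bit v +ᵥ u)
    along []      []      = refl
    along (x ∷ v) (a ∷ u) = trans (swap (bit x) (#beads (toList v)) a (Vec.sum u)) (cong (bit x + a +_) (along v u))
      where
      swap : ∀ b t a s → b + t + (a + s) ≡ b + a + (t + s)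
      swap = solve-∀

isOdd-∣ : ∀ x → isOdd x ≡ false → 2 ∣ x
isOdd-∣ zero          p = divides 0 refl
isOdd-∣ (suc (suc x)) p with isOdd-∣ x (trans (sym (Bool.not-involutive (isOdd x))) p)
... | divides k refl = divides (suc k) refl

isOdd-∤ : ∀ x → isOdd x ≡ true → Odd x
isOdd-∤ x p (divides k refl) with trans (sym p) (even k)
  where
  even : ∀ k → isOdd (k * 2) ≡ false
  even zero    = refl
  even (suc k) = trans (Bool.not-involutive _) (even k)
... | ()

-- Residues of parts and of bead positions

module _ {n : ℕ} .{{_ : NonZero n}} where

  -- The two components match the two cases in which the remainder of a negative integer is defined.
  %-complement : ∀ a b t → a + b ≡ t * n → (b % n ≡ 0 → a % n ≡ 0) × (∀ r → b % n ≡ suc r → a % n ≡ n ∸ suc r)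
  %-complement a b t e = when-zero , when-suc
    where
    total : (a % n + b % n) % n ≡ 0
    total = trans (sym (%-distribˡ-+ a b n)) (trans (cong (_% n) e) (m*n%n≡0 t n))
    when-zero : b % n ≡ 0 → a % n ≡ 0
    when-zero q = trans (sym (m%n%n≡m%n a n)) (trans (cong (_% n) (sym (trans (cong (a % n +_) q) (+-identityʳ _)))) total)
    when-suc : ∀ r → b % n ≡ suc r → a % n ≡ n ∸ suc r
    when-suc r q with a % n + b % n <? n
    ... | yes lt = contradiction (trans (sym q) (m+n≡0⇒n≡0 (a % n) (trans (sym (m<n⇒m%n≡m lt)) total))) λ ()
    ... | no ¬lt = begin
      a % n                       ≡⟨ m+n∸n≡m (a % n) (b % n) ⟨
      a % n + b % n ∸ b % n       ≡⟨ cong₂ _∸_ sum≡n q ⟩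
      n ∸ suc r                   ∎
      where
      open ≡-Reasoning
      n≤ : n ≤ a % n + b % n
      n≤ = ≮⇒≥ ¬lt
      rest : a % n + b % n ∸ n ≡ 0
      rest = trans (sym (m<n⇒m%n≡m (+-cancelʳ-< n _ _ (subst (_< n + n) (sym (m∸n+n≡m n≤)) (+-mono-< (m%n<n a n) (m%n<n b n))))))
        (trans (sym ([m+kn]%n≡m%n (a % n + b % n ∸ n) 1 n))
          (trans (cong (λ m → (a % n + b % n ∸ n + m) % n) (+-identityʳ n)) (trans (cong (_% n) (m∸n+n≡m n≤)) total)))
      sum≡n : a % n + b % n ≡ n
      sum≡n = trans (sym (m∸n+n≡m n≤)) (cong (_+ n) rest)

  -- A part `x` with `s` parts before it and `l` after it has its bead in position `x + l`. If the
  -- number of parts, zeros included, is a multiple of `n`, then `l` is congruent to minus `suc s`.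
  -- This is why lists are padded to a multiple of `n`.
  %ℕ-complement : ∀ x s l t → suc s + l ≡ t * n → (ℤ.+ x ℤ.- ℤ.+ suc s) ℤ.%ℕ n ≡ (x + l) % n
  %ℕ-complement x s l t e with ≤-total (suc s) x
  ... | inj₁ s<x = begin
    (ℤ.+ x ℤ.- ℤ.+ suc s) ℤ.%ℕ n    ≡⟨ cong (ℤ._%ℕ n) (trans (ℤ.m-n≡m⊖n x (suc s)) (ℤ.⊖-≥ s<x)) ⟩
    (x ∸ suc s) % n                 ≡⟨ [m+kn]%n≡m%n (x ∸ suc s) t n ⟨
    (x ∸ suc s + t * n) % n         ≡⟨ cong (λ m → (x ∸ suc s + m) % n) e ⟨
    (x ∸ suc s + (suc s + l)) % n   ≡⟨ cong (_% n) (trans (sym (+-assoc (x ∸ suc s) (suc s) l)) (cong (_+ l) (m∸n+n≡m s<x))) ⟩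
    (x + l) % n                     ∎
    where open ≡-Reasoning
  ... | inj₂ x≤s with m≤n⇒∃[o]m+o≡n x≤s
  ...   | zero  , q = trans (cong (ℤ._%ℕ n) (trans (ℤ.m-n≡m⊖n x (suc s)) (trans (cong (ℤ._⊖ suc s) x≡) (ℤ.n⊖n≡0 (suc s)))))
      (trans (m*n%n≡0 0 n) (sym (trans (cong (λ m → (m + l) % n) x≡) (trans (cong (_% n) e) (m*n%n≡0 t n)))))
    where
    x≡ = trans (sym (+-identityʳ x)) q
  ...   | suc o , q = trans (cong (ℤ._%ℕ n) negative) (neg-case (suc o % n) refl)
    where
    open ≡-Reasoning
    negative : ℤ.+ x ℤ.- ℤ.+ suc s ≡ ℤ.-[1+ o ]
    negative = begin
      ℤ.+ x ℤ.- ℤ.+ suc s       ≡⟨ ℤ.m-n≡m⊖n x (suc s) ⟩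
      x ℤ.⊖ suc s               ≡⟨ cong₂ ℤ._⊖_ (sym (+-identityʳ x)) (sym q) ⟩
      (x + 0) ℤ.⊖ (x + suc o)   ≡⟨ ℤ.+-cancelˡ-⊖ x 0 (suc o) ⟩
      ℤ.-[1+ o ]                ∎
    sum≡ : x + l + suc o ≡ t * n
    sum≡ = trans (swap x l (suc o)) (trans (cong (_+ l) q) e)
      where
      swap : ∀ a b c → a + b + c ≡ a + c + b
      swap = solve-∀
    neg-case : ∀ r → suc o % n ≡ r → ℤ.-[1+ o ] ℤ.%ℕ n ≡ (x + l) % n
    neg-case r p with suc o % n | %-complement (x + l) (suc o) t sum≡
    neg-case zero    refl | zero  | f , _ = sym (f refl)
    neg-case (suc r) refl | suc r | _ , f = sym (f r refl)

module _ (n : ℕ) .{{_ : NonZero n}} where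

  partSum-zeros : ∀ i k → partSum (onRunner n i oddBit) (List.replicate k 0) ≡ 0
  partSum-zeros i zero    = refl
  partSum-zeros i (suc k) with (length (List.replicate k 0) % n) ≡ᵇ i
  ... | true  = partSum-zeros i k
  ... | false = partSum-zeros i k

  -- The numbering is a function `o` with prescribed values: after the first part is dropped,
  -- `o ∘ suc` fits the filter over indices `suc j` without rewriting its predicate.
  count-odd : ∀ i xs k s t (o : Fin (length xs) → ℕ) → (∀ j → o j ≡ suc (s + toℕ j)) → s + (length xs + k) ≡ t * n →
    length (List.filter (λ j → odd? (List.lookup xs j) ×-dec ((ℤ.+ List.lookup xs j ℤ.- ℤ.+ o j) ℤ.%ℕ n ≟ i)) (List.allFin (length xs)))
      ≡ partSum (onRunner n i oddBit) (xs ++ List.replicate k 0)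
  count-odd i []       k s t o o≡ e = sym (partSum-zeros i k)
  count-odd i (x ∷ xs) k s t o o≡ e = filter-head
    where
    P? : ∀ j → _
    P? j = odd? (List.lookup (x ∷ xs) j) ×-dec ((ℤ.+ List.lookup (x ∷ xs) j ℤ.- ℤ.+ o j) ℤ.%ℕ n ≟ i)
    rest : length (List.filter P? (List.tabulate suc)) ≡ partSum (onRunner n i oddBit) (xs ++ List.replicate k 0)
    rest = trans (cong (length ∘ List.filter P?) (sym (List.map-tabulate id suc)))
      (trans (filter-map (List.allFin (length xs)))
        (count-odd i xs k (suc s) t (o ∘ suc) (λ j → trans (o≡ (suc j)) (cong suc (+-suc s (toℕ j)))) (trans (sym (+-suc s _)) e)))
      where
      filter-map : ∀ js → length (List.filter P? (List.map suc js)) ≡ length (List.filter (P? ∘ suc) js)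
      filter-map []       = refl
      filter-map (j ∷ js) with does (P? (suc j))
      ... | true  = cong suc (filter-map js)
      ... | false = filter-map js
    l = length (xs ++ List.replicate k 0)
    l≡ : l ≡ length xs + k
    l≡ = trans (List.length-++ xs) (cong (length xs +_) (List.length-replicate k))
    residue : (ℤ.+ x ℤ.- ℤ.+ o zero) ℤ.%ℕ n ≡ (x + l) % n
    residue = trans (cong (λ a → (ℤ.+ x ℤ.- ℤ.+ a) ℤ.%ℕ n) (trans (o≡ zero) (cong suc (+-identityʳ s))))
      (%ℕ-complement x s l t (trans (cong (suc s +_) l≡) (trans (sym (+-suc s _)) e)))
    value : ∀ {b g} → ((x + l) % n ≡ᵇ i) ≡ b → isOdd x ≡ g → (if b then bit g else 0) ≡ onRunner n i oddBit (x + l) x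
    value refl refl = refl
    residue≢ : (ℤ.+ x ℤ.- ℤ.+ o zero) ℤ.%ℕ n ≢ i → ((x + l) % n ≡ᵇ i) ≡ false
    residue≢ ¬q = ≢⇒≡ᵇ-false ((x + l) % n) i (¬q ∘ trans residue)
    even-value : isOdd x ≡ false → 0 ≡ onRunner n i oddBit (x + l) x
    even-value px with (x + l) % n ≡ᵇ i
    ... | true  = cong bit (sym px)
    ... | false = refl
    by-parity : ∀ g → isOdd x ≡ g → Dec ((ℤ.+ x ℤ.- ℤ.+ o zero) ℤ.%ℕ n ≡ i) →
      length (List.filter P? (zero ∷ List.tabulate suc)) ≡ onRunner n i oddBit (x + l) x + partSum (onRunner n i oddBit) (xs ++ List.replicate k 0)
    by-parity true  px (yes q) = trans (cong length (List.filter-accept P? {x = zero} {xs = List.tabulate suc} (isOdd-∤ x px , q)))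
      (cong₂ _+_ (value (trans (cong (_≡ᵇ i) (trans (sym residue) q)) (≡ᵇ-refl i)) px) rest)
    by-parity true  px (no ¬q) = trans (cong length (List.filter-reject P? {x = zero} {xs = List.tabulate suc} (¬q ∘ proj₂)))
      (cong₂ _+_ (value (residue≢ ¬q) px) rest)
    by-parity false px _       = trans (cong length (List.filter-reject P? {x = zero} {xs = List.tabulate suc} (λ (odd , _) → odd (isOdd-∣ x px))))
      (cong₂ _+_ (even-value px) rest)
    filter-head : length (List.filter P? (zero ∷ List.tabulate suc)) ≡ onRunner n i oddBit (x + l) x + partSum (onRunner n i oddBit) (xs ++ List.replicate k 0)
    filter-head = by-parity (isOdd x) refl ((ℤ.+ x ℤ.- ℤ.+ o zero) ℤ.%ℕ n ≟ i)

  oddSequence≡ : ∀ p k t → length (parts p) + k ≡ t * n → ∀ i →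
    Vec.lookup (oddSequence n p) i ≡ partSum (onRunner n (toℕ i) oddBit) (parts p ++ List.replicate k 0)
  oddSequence≡ p k t e i = trans (Vec.lookup∘tabulate _ i) (count-odd (toℕ i) (parts p) k 0 t (suc ∘ toℕ) (λ _ → refl) e)

-- Skew diagrams, given by lists of rows that may end in zeros

Skew : List ℕ → List ℕ → Pred Cell 0ℓ
Skew ps qs (i , j) = j < row ps i × ¬ (j < row qs i)

Step : Pred Cell 0ℓ → Cell → Cell → Set
Step C a b = C a × C b × Adjacent a b

Step-sym : ∀ {C a b} → Step C a b → Step C b a
Step-sym {a = i , j} {i′ , j′} (p , q , adj) =
  q , p , trans (cong₂ _+_ (∣-∣-comm i′ i) (∣-∣-comm j′ j)) adj

row-++-zeros : ∀ xs k i → row (xs ++ List.replicate k 0) i ≡ row xs i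
row-++-zeros (x ∷ xs) k       zero    = refl
row-++-zeros (x ∷ xs) k       (suc i) = row-++-zeros xs k i
row-++-zeros []       zero    i       = refl
row-++-zeros []       (suc k) zero    = refl
row-++-zeros []       (suc k) (suc i) = row-++-zeros [] k i

-- From rim hooks to beads

-- The first step out of the rows up to `i` changes the row; having length 1, it is vertical and
-- goes from row `i` to row `suc i`.
crossing : ∀ {C : Pred Cell 0ℓ} i {c d} → Star (Step C) c d → proj₁ c ≤ i → i < proj₁ d →
           ∃[ j ] (C (i , j) × C (suc i , j))
crossing i ε c≤i i<d = ⊥-elim (<⇒≱ i<d c≤i)
crossing {C} i (_◅_ {a , y} {b , y′} (p , q , adj) path) a≤i i<d with b ≤? i
... | yes b≤i = crossing i path b≤i i<d
... | no  b≰i = step a b adj a≤i (≰⇒> b≰i) p q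
  where
  step : ∀ a b → ∣ a - b ∣ + ∣ y - y′ ∣ ≡ 1 → a ≤ i → i < b → C (a , y) → C (b , y′) → ∃[ j ] (C (i , j) × C (suc i , j))
  step a b adj a≤i i<b p q = y , subst (λ r → C (r , y)) a≡i p , subst₂ (λ r s → C (r , s)) b≡ (sym (∣m-n∣≡0⇒m≡n column)) q
    where
    a<b : a < b
    a<b = ≤-<-trans a≤i i<b
    gap : ∣ a - b ∣ ≡ b ∸ a
    gap = m≤n⇒∣m-n∣≡n∸m (<⇒≤ a<b)
    b∸a≤1 : b ∸ a ≤ 1
    b∸a≤1 = ≤-trans (m≤m+n (b ∸ a) ∣ y - y′ ∣) (≤-reflexive (trans (cong (_+ ∣ y - y′ ∣) (sym gap)) adj))
    b≤1+a : b ≤ suc a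
    b≤1+a = ≤-trans (m≤n+m∸n b a) (≤-trans (+-monoʳ-≤ a b∸a≤1) (≤-reflexive (+-comm a 1)))
    a≡i : a ≡ i
    a≡i = ≤-antisym a≤i (s≤s⁻¹ (≤-trans i<b b≤1+a))
    b≡ : b ≡ suc i
    b≡ = ≤-antisym (≤-trans b≤1+a (s≤s a≤i)) i<b
    column : ∣ y - y′ ∣ ≡ 0
    column = n≤0⇒n≡0 (+-cancelˡ-≤ 1 _ _ (≤-trans (+-monoˡ-≤ ∣ y - y′ ∣ (≤-trans (m<n⇒0<n∸m a<b) (≤-reflexive (sym gap)))) (≤-reflexive adj)))

-- Between the first and the last row that it meets, a rim hook meets each pair of consecutive
-- rows in exactly one common column.
record HookLike (ps qs : List ℕ) : Set where
  constructor hookLike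
  field
    below : ∀ i → row qs i ≤ row ps i
    link  : ∀ i j k → j ≤ i → i < k → row qs j < row ps j → row qs k < row ps k →
            row ps (suc i) ≡ suc (row qs i) × row qs (suc i) < row ps (suc i)

HookLike-tail : ∀ {p q ps qs} → HookLike (p ∷ ps) (q ∷ qs) → HookLike ps qs
HookLike-tail (hookLike b l) = hookLike (b ∘ suc) (λ i j k j≤i i<k → l (suc i) (suc j) (suc k) (s≤s j≤i) (s≤s i<k))

-- Connectedness gives a column shared by rows `i` and `suc i`, so `P (suc i)` exceeds `Q i`. The
-- first removed cell of row `i` lies in the rim, so it does not exceed it by more than one.
RemoveRimHook⇒HookLike : ∀ {e p q ps qs} → (∀ i → row (parts p) i ≡ row ps i) → (∀ i → row (parts q) i ≡ row qs i) →
                         RemoveRimHook e p q → HookLike ps qs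
RemoveRimHook⇒HookLike {e} {p} {q} {ps} {qs} p≡ q≡ R = hookLike below link
  where
  open RemoveRimHook R
  P Q : ℕ → ℕ
  P = row (parts p)
  Q = row (parts q)
  below′ : ∀ i → Q i ≤ P i
  below′ i with Q i ≤? P i
  ... | yes le = le
  ... | no ¬le = ⊥-elim (<-irrefl refl (contained {i , P i} (≰⇒> ¬le)))
  below : ∀ i → row qs i ≤ row ps i
  below i = subst₂ _≤_ (q≡ i) (p≡ i) (below′ i)
  link : ∀ i j k → j ≤ i → i < k → row qs j < row ps j → row qs k < row ps k →
         row ps (suc i) ≡ suc (row qs i) × row qs (suc i) < row ps (suc i)
  link i j k j≤i i<k dj dk with
    crossing i (connected {j , Q j} {k , Q k} (subst₂ _<_ (sym (q≡ j)) (sym (p≡ j)) dj , <-irrefl refl)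
                                              (subst₂ _<_ (sym (q≡ k)) (sym (p≡ k)) dk , <-irrefl refl)) j≤i i<k
  ... | y , (y<Pi , ¬y<Qi) , (y<P , ¬y<Q) =
    subst₂ (λ a b → a ≡ suc b) (p≡ (suc i)) (q≡ i) P≡ ,
    subst₂ _<_ (q≡ (suc i)) (p≡ (suc i)) (≤-<-trans (≮⇒≥ ¬y<Q) y<P)
    where
    Q≤y : Q i ≤ y
    Q≤y = ≮⇒≥ ¬y<Qi
    rim : P (suc i) ≤ suc (Q i)
    rim = ≮⇒≥ (proj₂ (inRim {i , Q i} (≤-<-trans Q≤y y<Pi , <-irrefl refl)))
    P≡ : P (suc i) ≡ suc (Q i)
    P≡ = ≤-antisym rim (≤-trans (s≤s Q≤y) y<P)

position : (ℕ → ℕ) → ℕ → ℕ → ℕ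
position F b _ = F b

rows-differ : ∀ ps qs → length ps ≡ length qs → (∀ i → row qs i ≤ row ps i) → ps ≡ qs ⊎ ∃[ k ] row qs k < row ps k
rows-differ []       []       _ _ = inj₁ refl
rows-differ (p ∷ ps) (q ∷ qs) l b with m≤n⇒m<n∨m≡n (b 0)
... | inj₁ q<p = inj₂ (0 , q<p)
... | inj₂ refl with rows-differ ps qs (suc-injective l) (b ∘ suc)
...   | inj₁ refl    = inj₁ refl
...   | inj₂ (k , d) = inj₂ (suc k , d)

-- In two consecutive rows of the hook `p′` is `suc q`; as `q` stands one row higher, its new
-- position is the old position of `p′`. The sums telescope, and only the old position of the first
-- row and the new position of the last row remain.
chain-move : ∀ p q ps qs → q < p → length ps ≡ length qs → HookLike (p ∷ ps) (q ∷ qs) →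
  ∃[ y ] (∀ F → partSum (position F) (p ∷ ps) + F y ≡ partSum (position F) (q ∷ qs) + F (p + length ps))
chain-move p q ps qs q<p l H@(hookLike b lk) with rows-differ ps qs l (b ∘ suc)
... | inj₁ refl = q + length qs , λ F → regroup (F (p + length ps)) (partSum (position F) ps) (F (q + length ps))
  where
  regroup : ∀ a s c → a + s + c ≡ c + s + a
  regroup = solve-∀
chain-move p q []        []        q<p l H | inj₂ (k , ())
chain-move p q (p′ ∷ ps) (q′ ∷ qs) q<p l H@(hookLike b lk) | inj₂ (k , d)
  with lk 0 0 (suc k) z≤n (s≤s z≤n) q<p d
... | refl , q′<p′ with chain-move p′ q′ ps qs q′<p′ (suc-injective l) (HookLike-tail H)
...   | y , move = y , λ F → begin
        F (p + suc (length ps)) + partSum (position F) (suc q ∷ ps) + F y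
          ≡⟨ +-assoc (F (p + suc (length ps))) _ _ ⟩
        F (p + suc (length ps)) + (partSum (position F) (suc q ∷ ps) + F y)
          ≡⟨ cong (F (p + suc (length ps)) +_) (move F) ⟩
        F (p + suc (length ps)) + (partSum (position F) (q′ ∷ qs) + F (suc q + length ps))
          ≡⟨ cong (λ m → F (p + suc (length ps)) + (partSum (position F) (q′ ∷ qs) + F m))
               (trans (sym (+-suc q (length ps))) (cong (q +_) l)) ⟩
        F (p + suc (length ps)) + (partSum (position F) (q′ ∷ qs) + F (q + suc (length qs)))
          ≡⟨ regroup (F (p + suc (length ps))) (partSum (position F) (q′ ∷ qs)) (F (q + suc (length qs))) ⟩
        F (q + suc (length qs)) + partSum (position F) (q′ ∷ qs) + F (p + suc (length ps)) ∎
  where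
  open ≡-Reasoning
  regroup : ∀ a s c → a + (s + c) ≡ c + s + a
  regroup = solve-∀

hook-move : ∀ ps qs → length ps ≡ length qs → HookLike ps qs → ps ≢ qs →
  ∃₂ λ x y → ∀ F → partSum (position F) ps + F y ≡ partSum (position F) qs + F x
hook-move []       []       l H ps≢qs = ⊥-elim (ps≢qs refl)
hook-move (p ∷ ps) (q ∷ qs) l H ps≢qs with m≤n⇒m<n∨m≡n (HookLike.below H 0)
... | inj₁ q<p  = let y , move = chain-move p q ps qs q<p (suc-injective l) H in p + length ps , y , move
... | inj₂ refl with hook-move ps qs (suc-injective l) (HookLike-tail H) (ps≢qs ∘ cong (q ∷_))
...   | x , y , move = x , y , λ F → trans (+-assoc (F (q + length ps)) _ _)
        (trans (cong₂ (λ m s → F (q + m) + s) (suc-injective l) (move F)) (sym (+-assoc (F (q + length qs)) _ _)))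

partSum-id : ∀ ps → partSum (position id) ps ≡ sum ps + triangle (length ps)
partSum-id []       = refl
partSum-id (p ∷ ps) = trans (cong (p + length ps +_) (partSum-id ps)) (regroup p (length ps) (sum ps) _)
  where
  regroup : ∀ p l s t → p + l + (s + t) ≡ p + s + (l + t)
  regroup = solve-∀

-- Removing a rim hook of length e lowers a single bead by e positions.
RemoveRimHook⇒move : ∀ {e p q} ps qs → 0 < e → length ps ≡ length qs →
  (∀ i → row (parts p) i ≡ row ps i) → (∀ i → row (parts q) i ≡ row qs i) →
  sum ps ≡ size p → sum qs ≡ size q → RemoveRimHook e p q →
  ∃[ y ] (∀ F → partSum (position F) ps + F y ≡ partSum (position F) qs + F (y + e))
RemoveRimHook⇒move {e} {p} {q} ps qs 0<e l p≡ q≡ sp sq R = y , λ F →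
  trans (move F) (cong (λ m → partSum (position F) qs + F m) x≡)
  where
  hookSum : sum ps ≡ sum qs + e
  hookSum = trans sp (trans (RemoveRimHook.hookSize R) (cong (_+ e) (sym sq)))
  ps≢qs : ps ≢ qs
  ps≢qs refl = <⇒≢ (m<m+n (sum ps) 0<e) hookSum
  moves = hook-move ps qs l (RemoveRimHook⇒HookLike {p = p} {q} p≡ q≡ R) ps≢qs
  x = proj₁ moves
  y = proj₁ (proj₂ moves)
  move = proj₂ (proj₂ moves)
  open ≡-Reasoning
  x≡ : x ≡ y + e
  -- With the identity for `F` the sum of positions is the size plus a constant, so `x` exceeds `y`
  -- by the number of removed cells.
  x≡ = +-cancelˡ-≡ (sum qs + triangle (length qs)) _ _ (begin
    sum qs + triangle (length qs) + x         ≡⟨ cong (_+ x) (partSum-id qs) ⟨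
    partSum (position id) qs + x              ≡⟨ move id ⟨
    partSum (position id) ps + y              ≡⟨ cong (_+ y) (partSum-id ps) ⟩
    sum ps + triangle (length ps) + y         ≡⟨ cong₂ (λ s m → s + triangle m + y) hookSum l ⟩
    sum qs + e + triangle (length qs) + y     ≡⟨ regroup (sum qs) e (triangle (length qs)) y ⟩
    sum qs + triangle (length qs) + (y + e)   ∎)
    where
    regroup : ∀ s e t y → s + e + t + y ≡ s + t + (y + e)
    regroup = solve-∀

-- From beads to rim hooks

-- The rows met by a hook, given inductively. `next` lets consecutive rows share just one column;
-- `end` makes sure that what remains is still decreasing.
data Chain : List ℕ → List ℕ → Set where
  end  : ∀ {p q zs} → q < p → row zs 0 ≤ q → Chain (p ∷ zs) (q ∷ zs)
  next : ∀ {p q ps qs} → q < p → Chain (suc q ∷ ps) qs → Chain (p ∷ suc q ∷ ps) (q ∷ qs)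

data HookRows : List ℕ → List ℕ → Set where
  here  : ∀ {ps qs} → Chain ps qs → HookRows ps qs
  there : ∀ {x ps qs} → HookRows ps qs → HookRows (x ∷ ps) (x ∷ qs)

Chain-raise : ∀ {p p′ ps qs} → p ≤ p′ → Chain (p ∷ ps) qs → Chain (p′ ∷ ps) qs
Chain-raise p≤p′ (end q<p z)  = end (≤-trans q<p p≤p′) z
Chain-raise p≤p′ (next q<p c) = next (≤-trans q<p p≤p′) c

Chain-below : ∀ {ps qs} → Chain ps qs → ∀ i → row qs i ≤ row ps i
Chain-below (end q<p _)  zero    = <⇒≤ q<p
Chain-below (end q<p _)  (suc i) = ≤-refl
Chain-below (next q<p c) zero    = <⇒≤ q<p
Chain-below (next q<p c) (suc i) = Chain-below c i

Chain-rim : ∀ {ps qs} → Chain ps qs → ∀ i j → ¬ (j < row qs i) → j < row ps i → ¬ (suc j < row ps (suc i))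
Chain-rim (end q<p z)  zero    j j≮q _ lt = j≮q (<-≤-trans (<-trans (n<1+n j) lt) z)
Chain-rim (end q<p z)  (suc i) j j≮q j<p _ = j≮q j<p
Chain-rim (next q<p c) zero    j j≮q _ lt = j≮q (s≤s⁻¹ lt)
Chain-rim (next q<p c) (suc i) j j≮q j<p lt = Chain-rim c i j j≮q j<p lt

down : ∀ {p q ps qs c d} → Star (Step (Skew ps qs)) c d →
       Star (Step (Skew (p ∷ ps) (q ∷ qs))) (suc (proj₁ c) , proj₂ c) (suc (proj₁ d) , proj₂ d)
down = Star.gmap (λ (i , j) → suc i , j) id

walk-left : ∀ {p q ps qs} j → q + j < p → Star (Step (Skew (p ∷ ps) (q ∷ qs))) (0 , q + j) (0 , q)
walk-left {p} {q} {ps} {qs} zero    lt = subst (λ m → Star (Step (Skew (p ∷ ps) (q ∷ qs))) (0 , m) (0 , q)) (sym (+-identityʳ q)) ε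
walk-left {p} {q} (suc j) lt =
  ((lt , ≤⇒≯ (m≤m+n q (suc j))) , (lt′ , ≤⇒≯ (m≤m+n q j)) ,
    trans (cong (λ m → ∣ m - q + j ∣) (+-suc q j)) (left (q + j))) ◅ walk-left j lt′
  where
  lt′ : q + j < p
  lt′ = <-trans (≤-reflexive (sym (+-suc q j))) lt
  left : ∀ m → ∣ suc m - m ∣ ≡ 1
  left zero    = refl
  left (suc m) = left m

-- In each row one walks left to column `q`. The next row has length `suc q`, so the cell underneath
-- is its last cell, and it is removed too.
path-to-foot : ∀ {ps qs} → Chain ps qs → ∃[ f ] (∀ {c} → Skew ps qs c → Star (Step (Skew ps qs)) c f)
path-to-foot {p ∷ zs} {q ∷ zs} (end q<p z) = (0 , q) , path
  where
  path : ∀ {c} → Skew (p ∷ zs) (q ∷ zs) c → Star (Step (Skew (p ∷ zs) (q ∷ zs))) c (0 , q)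
  path {zero , j}  (j<p , j≮q) with m≤n⇒∃[o]m+o≡n (≮⇒≥ j≮q)
  ... | k , refl = walk-left k j<p
  path {suc i , j} (j<z , j≮z) = ⊥-elim (j≮z j<z)
path-to-foot {p ∷ ps@(suc q ∷ ps′)} {q ∷ qs} (next q<p c) = let (b , y) , path′ = path-to-foot c in (suc b , y) , path path′
  where
  head-row : ∀ {ps qs} → Chain ps qs → row qs 0 < row ps 0
  head-row (end q<p _)  = q<p
  head-row (next q<p _) = q<p
  path : ∀ {b y} → (∀ {c} → Skew ps qs c → Star (Step (Skew ps qs)) c (b , y)) →
         ∀ {c} → Skew (p ∷ ps) (q ∷ qs) c → Star (Step (Skew (p ∷ ps) (q ∷ qs))) c (suc b , y)
  path path′ {suc i , j} s = down (path′ s)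
  path path′ {zero , j}  (j<p , j≮q) with m≤n⇒∃[o]m+o≡n (≮⇒≥ j≮q)
  ... | k , refl = walk-left k j<p ◅◅ ((q<p , <-irrefl refl) , corner , cong suc (m≡n⇒∣m-n∣≡0 {q} refl)) ◅ down (path′ corner)
    where
    corner : Skew ps qs (0 , q)
    corner = ≤-refl , ≤⇒≯ (s≤s⁻¹ (head-row c))

Chain-connected : ∀ {ps qs} → Chain ps qs → Connected (Skew ps qs)
Chain-connected {ps} {qs} c s t = let _ , path = path-to-foot c in path s ◅◅ Star.reverse (λ {a} {b} → Step-sym {Skew ps qs} {a} {b}) (path t)

record IsHook (ps qs : List ℕ) : Set where
  constructor isHook
  field
    below     : ∀ i → row qs i ≤ row ps i
    rim       : ∀ i j → ¬ (j < row qs i) → j < row ps i → ¬ (suc j < row ps (suc i))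
    connected : Connected (Skew ps qs)

HookRows⇒IsHook : ∀ {ps qs} → HookRows ps qs → IsHook ps qs
HookRows⇒IsHook (here c) = isHook (Chain-below c) (Chain-rim c) (Chain-connected c)
HookRows⇒IsHook (there {x} {ps} {qs} h) with HookRows⇒IsHook h
... | isHook b r c = isHook below rim connected
  where
  below : ∀ i → row (x ∷ qs) i ≤ row (x ∷ ps) i
  below zero    = ≤-refl
  below (suc i) = b i
  rim : ∀ i j → ¬ (j < row (x ∷ qs) i) → j < row (x ∷ ps) i → ¬ (suc j < row ps i)
  rim zero    j j≮ j< _ = j≮ j<
  rim (suc i) j j≮ j<   = r i j j≮ j<
  connected : Connected (Skew (x ∷ ps) (x ∷ qs))
  connected {zero , _}  {_}         (j< , j≮) _ = ⊥-elim (j≮ j<)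
  connected {suc _ , _} {zero , _}  _ (j< , j≮) = ⊥-elim (j≮ j<)
  connected {suc _ , _} {suc _ , _} s t = down (c s t)

IsHook⇒RemoveRimHook : ∀ {e p q ps qs} → (∀ i → row (parts p) i ≡ row ps i) → (∀ i → row (parts q) i ≡ row qs i) →
  size p ≡ size q + e → IsHook ps qs → RemoveRimHook e p q
IsHook⇒RemoveRimHook {e} {p} {q} {ps} {qs} p≡ q≡ s (isHook b r c) = record
  { contained = λ { {i , j} j<q → <-≤-trans j<q (subst₂ _≤_ (sym (q≡ i)) (sym (p≡ i)) (b i)) }
  ; inRim     = λ { {i , j} (j<p , j≮q) → j<p , λ lt →
      r i j (j≮q ∘ subst (j <_) (sym (q≡ i))) (subst (j <_) (p≡ i) j<p) (subst (suc j <_) (p≡ (suc i)) lt) }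
  ; connected = λ {a} {b} s t → Star.gmap id (λ {a} {b} (u , v , adj) → backward a u , backward b v , adj) (c (forward a s) (forward b t))
  ; hookSize  = s }
  where
  forward : ∀ a → (Diagram p ∖ Diagram q) a → Skew ps qs a
  forward (i , j) (j<p , j≮q) = subst (j <_) (p≡ i) j<p , j≮q ∘ subst (j <_) (sym (q≡ i))
  backward : ∀ a → Skew ps qs a → (Diagram p ∖ Diagram q) a
  backward (i , j) (j<p , j≮q) = subst (j <_) (sym (p≡ i)) j<p , j≮q ∘ subst (j <_) (q≡ i)

#gaps-exchange : ∀ v z → #gaps (v ++ false ∷ z) ≡ suc (#gaps (v ++ true ∷ z))
#gaps-exchange []          z = refl
#gaps-exchange (true  ∷ v) z = #gaps-exchange v z
#gaps-exchange (false ∷ v) z = cong suc (#gaps-exchange v z)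

partsOf-head : ∀ z → row (partsOf z) 0 ≤ #gaps z
partsOf-head []          = z≤n
partsOf-head (true  ∷ z) = ≤-refl
partsOf-head (false ∷ z) = m≤n⇒m≤1+n (partsOf-head z)

-- The moved bead passes those of `v`, so the parts before and after are matched with a shift by
-- one. Every bead of `v` loses one gap below it, which is the `suc` demanded by `next`.
word-chain : ∀ v z → Chain (partsOf (true ∷ v ++ false ∷ z)) (partsOf (v ++ true ∷ z))
word-chain []          z = end ≤-refl (partsOf-head z)
word-chain (false ∷ v) z = Chain-raise (n≤1+n _) (word-chain v z)
word-chain (true  ∷ v) z with #gaps (v ++ false ∷ z) | #gaps-exchange v z | word-chain v z
... | _ | refl | c = next ≤-refl c

word-hook : ∀ u v z → HookRows (partsOf (u ++ true ∷ v ++ false ∷ z)) (partsOf (u ++ false ∷ v ++ true ∷ z))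
word-hook []          v z = here (word-chain v z)
word-hook (false ∷ u) v z = word-hook u v z
word-hook (true  ∷ u) v z = subst (λ g → HookRows (#gaps (u ++ true ∷ v ++ false ∷ z) ∷ partsOf (u ++ true ∷ v ++ false ∷ z)) (g ∷ partsOf (u ++ false ∷ v ++ true ∷ z)))
  (trans (#gaps-++ u _) (trans (cong (#gaps u +_) (#gaps-exchange v z)) (sym (#gaps-++ u _)))) (there (word-hook u v z))

word-move : ∀ F u v z →
  beadSum (position F) (u ++ true ∷ v ++ false ∷ z) + F (length z)
    ≡ beadSum (position F) (u ++ false ∷ v ++ true ∷ z) + F (length z + suc (length v))
word-move F [] v z = begin
  F (length (v ++ false ∷ z)) + beadSum (position F) (v ++ false ∷ z) + F (length z)
    ≡⟨ cong (λ m → F m + beadSum (position F) (v ++ false ∷ z) + F (length z)) (trans (List.length-++ v) (shuffle (length v) (length z))) ⟩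
  F (length z + suc (length v)) + beadSum (position F) (v ++ false ∷ z) + F (length z)
    ≡⟨ +-assoc (F (length z + suc (length v))) _ _ ⟩
  F (length z + suc (length v)) + (beadSum (position F) (v ++ false ∷ z) + F (length z))
    ≡⟨ cong (F (length z + suc (length v)) +_) (insert v) ⟩
  F (length z + suc (length v)) + beadSum (position F) (v ++ true ∷ z)
    ≡⟨ +-comm (F (length z + suc (length v))) _ ⟩
  beadSum (position F) (v ++ true ∷ z) + F (length z + suc (length v)) ∎
  where
  open ≡-Reasoning
  shuffle : ∀ a b → a + suc b ≡ b + suc a
  shuffle = solve-∀
  insert : ∀ v → beadSum (position F) (v ++ false ∷ z) + F (length z) ≡ beadSum (position F) (v ++ true ∷ z)
  insert []          = +-comm _ (F (length z))
  insert (true  ∷ v) = trans (+-assoc (F (length (v ++ false ∷ z))) _ _)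
    (cong₂ (λ m s → F m + s) (trans (List.length-++ v) (sym (List.length-++ v))) (insert v))
  insert (false ∷ v) = insert v
word-move F (false ∷ u) v z = word-move F u v z
word-move F (true  ∷ u) v z = trans (+-assoc (F (length (u ++ true ∷ v ++ false ∷ z))) _ _)
  (trans (cong₂ (λ m s → F m + s) same-length (word-move F u v z)) (sym (+-assoc (F (length (u ++ false ∷ v ++ true ∷ z))) _ _)))
  where
  same-length : length (u ++ true ∷ v ++ false ∷ z) ≡ length (u ++ false ∷ v ++ true ∷ z)
  same-length = trans (List.length-++ u) (trans (cong (λ m → length u + suc m)
    (trans (List.length-++ v) (sym (List.length-++ v)))) (sym (List.length-++ u)))

-- Sorted abaci and cores

infix 4 _⊑_

data _⊑_ : ∀ {n} → Vec Bool n → Vec Bool n → Set where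
  []  : [] ⊑ []
  _∷_ : ∀ {n x y} {r s : Vec Bool n} → (x ≡ true → y ≡ true) → r ⊑ s → x ∷ r ⊑ y ∷ s

-- Lowering the bead by n positions, into the gap, removes a rim hook.
Removable : ℕ → List Bool → Set
Removable n w = ∃[ u ] ∃[ v ] ∃[ z ] (w ≡ u ++ true ∷ v ++ false ∷ z × suc (length v) ≡ n)

-- The same column in two consecutive rows is `n` positions apart: between the two entries lie the
-- rest `B` of the upper row and the beginning `A′` of the lower one.
compare-rows : ∀ {n} (r s : Vec Bool n) → r ⊑ s ⊎
  (∃[ A ] ∃[ B ] ∃[ A′ ] ∃[ B′ ] (toList r ≡ A ++ true ∷ B × toList s ≡ A′ ++ false ∷ B′ × suc (length (B ++ A′)) ≡ n))
compare-rows []      []      = inj₁ []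
compare-rows (x ∷ r) (y ∷ s) with x | y | compare-rows r s
... | true  | false | _      = inj₂ ([] , toList r , [] , toList s , refl , refl ,
  cong suc (trans (cong length (List.++-identityʳ (toList r))) (Vec.length-toList r)))
... | true  | true  | inj₁ p = inj₁ ((λ _ → refl) ∷ p)
... | false | _     | inj₁ p = inj₁ ((λ ()) ∷ p)
... | true  | true  | inj₂ (A , B , A′ , B′ , p , q , l) = inj₂ (true ∷ A , B , true ∷ A′ , B′ , cong (true ∷_) p , cong (true ∷_) q ,
  cong suc (trans (List.length-++-sucʳ B true A′) l))
... | false | y     | inj₂ (A , B , A′ , B′ , p , q , l) = inj₂ (false ∷ A , B , y ∷ A′ , B′ , cong (false ∷_) p , cong (y ∷_) q ,
  cong suc (trans (List.length-++-sucʳ B y A′) l))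

sorted-or-removable : ∀ {n} (M : Abacus n) → Linked _⊑_ M ⊎ Removable n (flat M)
sorted-or-removable []          = inj₁ []
sorted-or-removable (r ∷ [])    = inj₁ [-]
sorted-or-removable (r ∷ s ∷ M) with compare-rows r s | sorted-or-removable (s ∷ M)
... | inj₂ (A , B , A′ , B′ , p , q , l) | _ = inj₂ (A , B ++ A′ , B′ ++ flat M , (begin
  toList r ++ toList s ++ flat M                     ≡⟨ cong₂ (λ a b → a ++ b ++ flat M) p q ⟩
  (A ++ true ∷ B) ++ (A′ ++ false ∷ B′) ++ flat M    ≡⟨ List.++-assoc A (true ∷ B) _ ⟩
  A ++ true ∷ B ++ (A′ ++ false ∷ B′) ++ flat M      ≡⟨ cong (λ a → A ++ true ∷ B ++ a) (List.++-assoc A′ (false ∷ B′) (flat M)) ⟩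
  A ++ true ∷ B ++ A′ ++ false ∷ B′ ++ flat M        ≡⟨ cong (λ a → A ++ true ∷ a) (List.++-assoc B A′ _) ⟨
  A ++ true ∷ (B ++ A′) ++ false ∷ B′ ++ flat M      ∎) , l)
  where open ≡-Reasoning
... | inj₁ r⊑s | inj₁ sorted = inj₁ (r⊑s ∷ sorted)
... | inj₁ r⊑s | inj₂ (u , v , z , e , l) = inj₂ (toList r ++ u , v , z , trans (cong (toList r ++_) e) (sym (List.++-assoc (toList r) u _)) , l)

sorted-excess : ∀ {n} (M : Abacus n) → Linked _⊑_ M → excess M ≡ 0
sorted-excess {zero}  M sorted = refl
sorted-excess {suc n} M sorted = cong₂ _+_ (column (heads M) (sorted-heads M sorted)) (sorted-excess (tails M) (sorted-tails M sorted))
  where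
  _⇒_ : Bool → Bool → Set
  x ⇒ y = x ≡ true → y ≡ true
  sorted-heads : ∀ (M : Abacus (suc n)) → Linked _⊑_ M → Linked _⇒_ (heads M)
  sorted-heads []                        []               = []
  sorted-heads (_ ∷ [])                  [-]              = [-]
  sorted-heads ((_ ∷ _) ∷ (_ ∷ _) ∷ M) ((p ∷ _) ∷ s) = p ∷ sorted-heads _ s
  sorted-tails : ∀ (M : Abacus (suc n)) → Linked _⊑_ M → Linked _⊑_ (tails M)
  sorted-tails []                        []               = []
  sorted-tails (_ ∷ [])                  [-]              = [-]
  sorted-tails ((_ ∷ _) ∷ (_ ∷ _) ∷ M) ((_ ∷ q) ∷ s) = q ∷ sorted-tails _ s
  no-gaps : ∀ xs → Linked _⇒_ (true ∷ xs) → #gaps xs ≡ 0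
  no-gaps []           _       = refl
  no-gaps (true  ∷ xs) (_ ∷ s) = no-gaps xs s
  no-gaps (false ∷ xs) (p ∷ _) with p refl
  ... | ()
  column : ∀ xs → Linked _⇒_ xs → inversions xs ≡ 0
  column []           _ = refl
  column (true  ∷ xs) s = cong₂ _+_ (no-gaps xs s) (column xs (Linked.tail s))
  column (false ∷ xs) s = column xs (Linked.tail s)

-- Without inversions all gaps are above all beads. A word with a bead on top is then full, so it
-- has more beads than a word of the same length with a gap on top.
no-inversions-unique : ∀ xs ys → length xs ≡ length ys → inversions xs ≡ 0 → inversions ys ≡ 0 → #beads xs ≡ #beads ys → xs ≡ ys
no-inversions-unique []           []           _ _ _ _ = refl
no-inversions-unique (true  ∷ xs) (true  ∷ ys) l i j b = cong (true ∷_)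
  (no-inversions-unique xs ys (suc-injective l) (m+n≡0⇒n≡0 (#gaps xs) i) (m+n≡0⇒n≡0 (#gaps ys) j) (suc-injective b))
no-inversions-unique (false ∷ xs) (false ∷ ys) l i j b = cong (false ∷_)
  (no-inversions-unique xs ys (suc-injective l) i j b)
no-inversions-unique (true  ∷ xs) (false ∷ ys) l i j b = ⊥-elim (full-contradiction xs ys l i b)
  where
  full-contradiction : ∀ xs ys → suc (length xs) ≡ suc (length ys) → #gaps xs + inversions xs ≡ 0 → suc (#beads xs) ≡ #beads ys → ⊥
  full-contradiction xs ys l i b = <⇒≱ (≤-reflexive b) (≤-trans (#beads≤length ys) (≤-reflexive (sym
    (trans (sym (+-identityʳ _)) (trans (cong (#beads xs +_) (sym (m+n≡0⇒m≡0 (#gaps xs) i))) (trans (#beads+#gaps xs) (suc-injective l)))))))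
no-inversions-unique (false ∷ xs) (true  ∷ ys) l i j b =
  sym (no-inversions-unique (true ∷ ys) (false ∷ xs) (sym l) j i (sym b))

no-excess-unique : ∀ {n} (M M′ : Abacus n) → length M ≡ length M′ → excess M ≡ 0 → excess M′ ≡ 0 → beads M ≡ beads M′ → M ≡ M′
no-excess-unique {zero}  M M′ l _ _ _ = no-runners M M′ l
  where
  no-runners : ∀ (M M′ : Abacus 0) → length M ≡ length M′ → M ≡ M′
  no-runners []       []        _ = refl
  no-runners ([] ∷ M) ([] ∷ M′) l = cong ([] ∷_) (no-runners M M′ (suc-injective l))
no-excess-unique {suc n} M M′ l i j b = from-runners M M′
  (no-inversions-unique (heads M) (heads M′) (trans (List.length-map Vec.head M) (trans l (sym (List.length-map Vec.head M′))))
    (m+n≡0⇒m≡0 _ i) (m+n≡0⇒m≡0 _ j) (Vec.∷-injectiveˡ b′))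
  (no-excess-unique (tails M) (tails M′) (trans (List.length-map Vec.tail M) (trans l (sym (List.length-map Vec.tail M′))))
    (m+n≡0⇒n≡0 (inversions (heads M)) i) (m+n≡0⇒n≡0 (inversions (heads M′)) j) (Vec.∷-injectiveʳ b′))
  where
  b′ = trans (sym (beads-heads M)) (trans b (beads-heads M′))
  from-runners : ∀ (M M′ : Abacus (suc n)) → heads M ≡ heads M′ → tails M ≡ tails M′ → M ≡ M′
  from-runners []            []             _ _ = refl
  from-runners ((x ∷ v) ∷ M) ((y ∷ u) ∷ M′) p q with List.∷-injective p | List.∷-injective q
  ... | refl , p′ | refl , q′ = cong ((x ∷ v) ∷_) (from-runners M M′ p′ q′)

-- Partitions and abaci

chunk : ∀ n L (w : List Bool) → length w ≡ L * n → ∃[ M ] (flat {n} M ≡ w × length M ≡ L)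
chunk n zero    [] l = [] , refl , refl
chunk n (suc L) w  l =
  let v , v≡ = vector (List.take n w) (trans (List.length-take n w) (m≤n⇒m⊓n≡m (≤-trans (m≤m+n n (L * n)) (≤-reflexive (sym l)))))
      M , M≡ , len = chunk n L (List.drop n w) (trans (List.length-drop n w) (trans (cong (_∸ n) l) (m+n∸m≡n n (L * n))))
  in v ∷ M , trans (cong₂ _++_ v≡ M≡) (List.take++drop≡id n w) , cong suc len
  where
  vector : ∀ {n} (u : List Bool) → length u ≡ n → ∃[ v ] toList {n = n} v ≡ u
  vector []      refl = [] , refl
  vector (x ∷ u) refl = let v , p = vector u refl in x ∷ v , cong (x ∷_) p

partsOf-gaps : ∀ k w → partsOf (List.replicate k false ++ w) ≡ partsOf w
partsOf-gaps zero    w = refl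
partsOf-gaps (suc k) w = partsOf-gaps k w

#gaps-gaps : ∀ k w → #gaps (List.replicate k false ++ w) ≡ k + #gaps w
#gaps-gaps zero    w = refl
#gaps-gaps (suc k) w = cong suc (#gaps-gaps k w)

wordOf : ∀ ps → Linked _≥_ ps → ∃[ w ] (partsOf w ≡ ps × #gaps w ≡ row ps 0)
wordOf []       _ = [] , refl , refl
wordOf (x ∷ ps) s =
  let w , p , g = wordOf ps (Linked.tail s)
      gaps = trans (#gaps-gaps (x ∸ row ps 0) w) (trans (cong (x ∸ row ps 0 +_) g) (m∸n+n≡m (first x ps s)))
  in true ∷ List.replicate (x ∸ row ps 0) false ++ w ,
     cong₂ _∷_ gaps (trans (partsOf-gaps (x ∸ row ps 0) w) p) , gaps
  where
  first : ∀ x ps → Linked _≥_ (x ∷ ps) → row ps 0 ≤ x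
  first x []      _       = z≤n
  first x (_ ∷ _) (p ∷ _) = p

-- Gaps above all beads do not affect the parts, so the word can be lengthened to a multiple of `n`.
abacusOf : ∀ n .{{_ : NonZero n}} ps → Linked _≥_ ps → ∃[ M ] partsOf (flat {n} M) ≡ ps
abacusOf n ps s =
  let w , p , _ = wordOf ps s
      l = length w
      l≤ : l ≤ l * n
      l≤ = m≤m*n l n
      M , M≡ , _ = chunk n l (List.replicate (l * n ∸ l) false ++ w)
        (trans (List.length-++ (List.replicate (l * n ∸ l) false))
          (trans (cong (_+ l) (List.length-replicate (l * n ∸ l))) (m∸n+n≡m l≤)))
  in M , trans (cong partsOf M≡) (trans (partsOf-gaps (l * n ∸ l) w) p)

partsOf-decreasing : ∀ w → Linked _≥_ (partsOf w)
partsOf-decreasing []          = []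
partsOf-decreasing (false ∷ w) = partsOf-decreasing w
partsOf-decreasing (true  ∷ w) = cons (partsOf w) (partsOf-head w) (partsOf-decreasing w)
  where
  cons : ∀ {x} ps → row ps 0 ≤ x → Linked _≥_ ps → Linked _≥_ (x ∷ ps)
  cons []      _ _ = [-]
  cons (_ ∷ _) p s = p ∷ s

partitionOf : ∀ ps → Linked _≥_ ps → ∃₂ λ p k → ps ≡ parts p ++ List.replicate k 0
partitionOf []           s = record { parts = [] ; positive = [] ; decreasing = [] } , 0 , refl
partitionOf (zero  ∷ ps) s = record { parts = [] ; positive = [] ; decreasing = [] } , suc (length ps) , cong (0 ∷_) (zeros ps s)
  where
  zeros : ∀ ps → Linked _≥_ (0 ∷ ps) → ps ≡ List.replicate (length ps) 0
  zeros []          _         = refl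
  zeros (zero ∷ ps) (z≤n ∷ s) = cong (0 ∷_) (zeros ps s)
partitionOf (suc x ∷ ps) s with partitionOf ps (Linked.tail s)
... | p , k , refl = record { parts = suc x ∷ parts p ; positive = z<s ∷ positive p ; decreasing = prefix (parts p) s } , k , refl
  where
  prefix : ∀ xs {y zs} → Linked _≥_ (y ∷ xs ++ zs) → Linked _≥_ (y ∷ xs)
  prefix []       s       = [-]
  prefix (x ∷ xs) (q ∷ s) = q ∷ prefix xs s

parts-injective : ∀ {p q} → parts p ≡ parts q → p ≡ q
parts-injective {record { positive = pos ; decreasing = dec }} {record { positive = pos′ ; decreasing = dec′ }} refl =
  cong₂ (λ a b → record { positive = a ; decreasing = b }) (All.irrelevant ≤-irrelevant pos pos′) (Linked.irrelevant ≤-irrelevant dec dec′)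

padded-injective : ∀ p q {k l} → parts p ++ List.replicate k 0 ≡ parts q ++ List.replicate l 0 → p ≡ q
padded-injective p q e = parts-injective (strip (parts p) (parts q) (positive p) (positive q) e)
  where
  strip : ∀ xs ys {k l} → All (0 <_) xs → All (0 <_) ys → xs ++ List.replicate k 0 ≡ ys ++ List.replicate l 0 → xs ≡ ys
  strip []       []       _ _ _ = refl
  strip []       (y ∷ ys) {suc k} _ (0<y ∷ _) e = ⊥-elim (<⇒≢ 0<y (List.∷-injectiveˡ e))
  strip (x ∷ xs) []       {l = suc l} (0<x ∷ _) _ e = ⊥-elim (<⇒≢ 0<x (sym (List.∷-injectiveˡ e)))
  strip (x ∷ xs) (y ∷ ys) (_ ∷ ps) (_ ∷ qs) e = cong₂ _∷_ (List.∷-injectiveˡ e) (strip xs ys ps qs (List.∷-injectiveʳ e))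

sum-zeros : ∀ xs k → sum (xs ++ List.replicate k 0) ≡ sum xs
sum-zeros (x ∷ xs) k       = cong (x +_) (sum-zeros xs k)
sum-zeros []       zero    = refl
sum-zeros []       (suc k) = sum-zeros [] k

add-hook : ∀ s j e → s + j * e + e ≡ s + suc j * e
add-hook = solve-∀

Shows : ∀ {n} → Abacus n → Partition → ℕ → Set
Shows M p k = partsOf (flat M) ≡ parts p ++ List.replicate k 0

vec-ext : ∀ {A : Set} {n} {u v : Vec A n} → (∀ i → Vec.lookup u i ≡ Vec.lookup v i) → u ≡ v
vec-ext {u = u} {v} p = trans (sym (Vec.tabulate∘lookup u)) (trans (Vec.tabulate-cong p) (Vec.tabulate∘lookup v))

module _ {n : ℕ} .{{_ : NonZero n}} where

  [m+n]/n : ∀ m → (m + n) / n ≡ suc (m / n)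
  [m+n]/n m = trans (+-distrib-/-∣ʳ m (∣-refl {n})) (trans (cong (m / n +_) (n/n≡1 n)) (+-comm (m / n) 1))
    where open import Data.Nat.Divisibility using (∣-refl)

  shifted-runner : ∀ i m → position (λ b → onRunner n i unit b 0) (m + n) 0 ≡ onRunner n i unit m 0
  shifted-runner i m = cong (λ r → Data.Bool.Base.if r ≡ᵇ i then 1 else 0) ([m+n]%n≡m%n m n)

  -- One identity for all functions of the position gives everything: residues yield the bead
  -- counts, quotients the levels, and the identity function the size of the hook.
  remove : ∀ {M : Abacus n} {p k} → Shows M p k → Removable n (flat M) →
    ∃[ M′ ] ∃[ q ] ∃[ l ] (Shows M′ q l × RemoveRimHook n p q × size p ≡ size q + n × beads M ≡ beads M′ × levels M ≡ suc (levels M′))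
  remove {M} {p} {k} shows (u , v , z , e , l) =
    M′ , q , k′ , shows′ , hook , hookSize ,
    vec-ext (λ i → trans (lookup-beads M i) (trans (same-runner (toℕ (opposite i))) (sym (lookup-beads M′ i)))) ,
    trans (levels≡ M) (trans one-level (cong suc (sym (levels≡ M′))))
    where
    open ≡-Reasoning
    w = u ++ true ∷ v ++ false ∷ z
    w′ = u ++ false ∷ v ++ true ∷ z
    lengths : length w′ ≡ length w
    lengths = trans (List.length-++ u) (trans (cong (λ m → length u + suc m)
      (trans (List.length-++ v) (sym (List.length-++ v)))) (sym (List.length-++ u)))
    chunks = chunk n (length M) w′ (trans lengths (trans (cong length (sym e)) (length-flat M)))
    M′ = proj₁ chunks
    M′≡ : flat M′ ≡ w′
    M′≡ = proj₁ (proj₂ chunks)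
    partition = partitionOf (partsOf w′) (partsOf-decreasing w′)
    q = proj₁ partition
    k′ = proj₁ (proj₂ partition)
    shows′ : Shows M′ q k′
    shows′ = trans (cong partsOf M′≡) (proj₂ (proj₂ partition))
    shows-w : partsOf w ≡ parts p ++ List.replicate k 0
    shows-w = trans (cong partsOf (sym e)) shows
    move : ∀ F → beadSum (position F) w + F (length z) ≡ beadSum (position F) w′ + F (length z + n)
    move F = trans (word-move F u v z) (cong (λ m → beadSum (position F) w′ + F (length z + m)) l)
    same-runner : ∀ i → beadSum (onRunner n i unit) (flat M) ≡ beadSum (onRunner n i unit) (flat M′)
    same-runner i = trans (cong (beadSum (onRunner n i unit)) e) (trans
      (+-cancelʳ-≡ (onRunner n i unit (length z) 0) _ _
        (trans (move (λ b → onRunner n i unit b 0)) (cong (beadSum (onRunner n i unit) w′ +_) (shifted-runner i (length z)))))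
      (cong (beadSum (onRunner n i unit)) (sym M′≡)))
    one-level : beadSum onLevel (flat M) ≡ suc (beadSum onLevel (flat M′))
    one-level = trans (cong (beadSum onLevel) e) (trans
      (+-cancelʳ-≡ (length z / n) _ _ (trans (move (_/ n)) (trans (cong (beadSum onLevel w′ +_) ([m+n]/n (length z))) (+-suc _ _))))
      (cong (suc ∘ beadSum onLevel) (sym M′≡)))
    #beads≡ : length (partsOf w) ≡ length (partsOf w′)
    #beads≡ = begin
      length (partsOf w)                     ≡⟨ length-partsOf w ⟩
      #beads w                               ≡⟨ count u ⟩
      #beads w′                              ≡⟨ length-partsOf w′ ⟨
      length (partsOf w′)                    ∎
      where
      inner : ∀ v → suc (#beads (v ++ false ∷ z)) ≡ #beads (v ++ true ∷ z)
      inner []          = refl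
      inner (true  ∷ v) = cong suc (inner v)
      inner (false ∷ v) = inner v
      count : ∀ u → #beads (u ++ true ∷ v ++ false ∷ z) ≡ #beads (u ++ false ∷ v ++ true ∷ z)
      count []      = inner v
      count (x ∷ u) = cong (bit x +_) (count u)
    position-sum : ∀ w → beadSum (position id) w ≡ sum (partsOf w) + triangle (length (partsOf w))
    position-sum w = trans (beadSum≡partSum (position id) w) (partSum-id (partsOf w))
    hookSize : size p ≡ size q + n
    hookSize = +-cancelʳ-≡ (triangle (length (partsOf w)) + length z) _ _ (begin
      size p + (triangle (length (partsOf w)) + length z)
        ≡⟨ cong (_+ (triangle (length (partsOf w)) + length z)) (trans (sym (sum-zeros (parts p) k)) (cong sum (sym shows-w))) ⟩
      sum (partsOf w) + (triangle (length (partsOf w)) + length z)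
        ≡⟨ +-assoc (sum (partsOf w)) _ _ ⟨
      sum (partsOf w) + triangle (length (partsOf w)) + length z
        ≡⟨ cong (_+ length z) (position-sum w) ⟨
      beadSum (position id) w + length z
        ≡⟨ move id ⟩
      beadSum (position id) w′ + (length z + n)
        ≡⟨ cong (_+ (length z + n)) (position-sum w′) ⟩
      sum (partsOf w′) + triangle (length (partsOf w′)) + (length z + n)
        ≡⟨ cong₂ (λ s m → s + triangle m + (length z + n))
             (trans (cong sum (proj₂ (proj₂ partition))) (sum-zeros (parts q) k′)) (sym #beads≡) ⟩
      size q + triangle (length (partsOf w)) + (length z + n)
        ≡⟨ regroup (size q) (triangle (length (partsOf w))) (length z) n ⟩
      size q + n + (triangle (length (partsOf w)) + length z) ∎)
      where
      regroup : ∀ s t z n → s + t + (z + n) ≡ s + n + (t + z)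
      regroup = solve-∀
    hook : RemoveRimHook n p q
    hook = IsHook⇒RemoveRimHook
      (λ i → trans (sym (row-++-zeros (parts p) k i)) (cong (λ xs → row xs i) (sym shows-w)))
      (λ i → trans (sym (row-++-zeros (parts q) k′ i)) (cong (λ xs → row xs i) (sym (proj₂ (proj₂ partition)))))
      hookSize (HookRows⇒IsHook (word-hook u v z))

  core-excess : ∀ {γ} {M : Abacus n} {k} → IsCore n γ → Shows M γ k → excess M ≡ 0
  core-excess {γ} {M} {k} (_ , stuck) shows with sorted-or-removable M
  ... | inj₁ sorted = sorted-excess M sorted
  ... | inj₂ r      = let _ , q , _ , _ , hook , _ = remove {M} {γ} {k} shows r in ⊥-elim (stuck q hook)

  pad-to : ∀ (M : Abacus n) k → length M ≤ k →
    ∃[ M′ ] (length M′ ≡ k × beads M′ ≡ beads M × excess M′ ≡ excess M × partsOf (flat M′) ≡ partsOf (flat M))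
  pad-to M k l≤k = U ++ M ,
    trans (List.length-++ U) (trans (cong (_+ length M) (List.length-replicate j)) (m∸n+n≡m l≤k)) ,
    beads-Empty U M (Empty-replicate j) , excess-Empty U M (Empty-replicate j) , parts≡ j
    where
    j = k ∸ length M
    U = List.replicate j (emptyRow n)
    toList-emptyRow : ∀ m (w : List Bool) → partsOf (toList (emptyRow m) ++ w) ≡ partsOf w
    toList-emptyRow zero    w = refl
    toList-emptyRow (suc m) w = toList-emptyRow m w
    parts≡ : ∀ j → partsOf (flat (List.replicate j (emptyRow n) ++ M)) ≡ partsOf (flat M)
    parts≡ zero    = refl
    parts≡ (suc j) = trans (toList-emptyRow n _) (parts≡ j)

  core-unique : ∀ {p q} (M M′ : Abacus n) {k l} → Shows M p k → Shows M′ q l → excess M ≡ 0 → excess M′ ≡ 0 →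
    beads M ≡ beads M′ → p ≡ q
  core-unique {p} {q} M M′ s s′ i i′ b =
    let L = length M ⊔ length M′
        N , len , bN , iN , pN = pad-to M L (m≤m⊔n _ _)
        N′ , len′ , bN′ , iN′ , pN′ = pad-to M′ L (m≤n⊔m _ _)
        N≡ = no-excess-unique N N′ (trans len (sym len′)) (trans iN i) (trans iN′ i′) (trans bN (trans b (sym bN′)))
    in padded-injective p q (trans (sym s) (trans (sym pN) (trans (cong (partsOf ∘ flat) N≡) (trans pN′ s′))))

  -- Positive excess means that the abacus is not sorted, so some bead can go down. The bead counts
  -- never change, and once no excess is left they determine the partition.
  remove-to-core : ∀ {γ} {Mγ : Abacus n} {l} → Shows Mγ γ l → excess Mγ ≡ 0 →
    ∀ w {M : Abacus n} {p k} → Shows M p k → beads M ≡ beads Mγ → excess M ≡ w →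
    Star (RemoveRimHook n) p γ × size p ≡ size γ + w * n
  remove-to-core {γ} {Mγ} sγ iγ zero {M} {p} s b i =
    subst (λ q → Star (RemoveRimHook n) q γ) (sym p≡γ) ε , trans (cong size p≡γ) (sym (+-identityʳ _))
    where
    p≡γ : p ≡ γ
    p≡γ = core-unique {p} {γ} M Mγ s sγ i iγ b
  remove-to-core {γ} {Mγ} sγ iγ (suc w) {M} {p} {k} s b i with sorted-or-removable M
  ... | inj₁ sorted = ⊥-elim (0≢1+n (trans (sym (sorted-excess M sorted)) i))
  ... | inj₂ r with remove {M} {p} {k} s r
  ...   | M′ , q , k′ , s′ , hook , sz , b′ , lev =
    let star , sz′ = remove-to-core {γ} {Mγ} sγ iγ w {M′} {q} {k′} s′ (trans (sym b′) b) excess′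
    in hook ◅ star , trans sz (trans (cong (_+ n) sz′) (add-hook (size γ) w n))
    where
    excess′ : excess M′ ≡ w
    excess′ = +-cancelʳ-≡ (triangles (beads M)) _ _ (suc-injective (begin
      suc (excess M′ + triangles (beads M))    ≡⟨ cong (λ v → suc (excess M′ + triangles v)) b′ ⟩
      suc (excess M′ + triangles (beads M′))   ≡⟨ cong suc (levels-excess M′) ⟨
      suc (levels M′)                          ≡⟨ lev ⟨
      levels M                                 ≡⟨ levels-excess M ⟩
      excess M + triangles (beads M)           ≡⟨ cong (_+ triangles (beads M)) i ⟩
      suc (w + triangles (beads M))            ∎))
      where open ≡-Reasoning

pad : ℕ → Partition → List ℕ
pad N p = parts p ++ List.replicate (N ∸ length (parts p)) 0

length≤size : ∀ p → length (parts p) ≤ size p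
length≤size p = bound (parts p) (positive p)
  where
  bound : ∀ xs → All (0 <_) xs → length xs ≤ sum xs
  bound []       []         = z≤n
  bound (x ∷ xs) (0<x ∷ ps) = +-mono-≤ 0<x (bound xs ps)

length-pad : ∀ N p → size p ≤ N → length (parts p) + (N ∸ length (parts p)) ≡ N
length-pad N p le = m+[n∸m]≡n (≤-trans (length≤size p) le)

length-pad′ : ∀ N p → size p ≤ N → length (pad N p) ≡ N
length-pad′ N p le = trans (List.length-++ (parts p)) (trans (cong (length (parts p) +_) (List.length-replicate _)) (length-pad N p le))

pad-decreasing : ∀ N p → Linked _≥_ (pad N p)
pad-decreasing N p = extend (parts p) (decreasing p) (N ∸ length (parts p))
  where
  extend : ∀ xs → Linked _≥_ xs → ∀ k → Linked _≥_ (xs ++ List.replicate k 0)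
  extend []           _       zero          = []
  extend []           _       (suc zero)    = [-]
  extend []           _       (suc (suc k)) = z≤n ∷ extend [] [] (suc k)
  extend (x ∷ [])     _       zero          = [-]
  extend (x ∷ [])     _       (suc k)       = z≤n ∷ extend [] [] (suc k)
  extend (x ∷ y ∷ xs) (q ∷ s) k             = q ∷ extend (y ∷ xs) s k

hook-count : ∀ {e p γ} → Star (RemoveRimHook e) p γ → ∃[ j ] size p ≡ size γ + j * e
hook-count ε = 0 , sym (+-identityʳ _)
hook-count {e} {γ = γ} (R ◅ Rs) = let j , s = hook-count Rs in suc j ,
  trans (RemoveRimHook.hookSize R) (trans (cong (_+ e) s) (add-hook (size γ) j e))

module _ {e : ℕ} .{{_ : NonZero e}} where

  -- All partitions on the way are padded to the same length `N`: a removal may delete rows, and it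
  -- is the move of a single bead only between lists of equal length.
  star-invariants : ∀ {p γ} N → Star (RemoveRimHook e) p γ → size p ≤ N → ∃[ j ] (size p ≡ size γ + j * e
    × (∀ i → partSum (onRunner e i unit) (pad N p) ≡ partSum (onRunner e i unit) (pad N γ))
    × partSum (onLevel {e}) (pad N p) ≡ j + partSum (onLevel {e}) (pad N γ))
  star-invariants N ε le = 0 , sym (+-identityʳ _) , (λ _ → refl) , refl
  star-invariants {p} {γ} N (_◅_ {j = q} R Rs) le =
    suc j , trans (RemoveRimHook.hookSize R) (trans (cong (_+ e) sz) (add-hook (size γ) j e)) ,
    (λ i → trans (+-cancelʳ-≡ (onRunner e i unit y 0) _ _ (trans (move (λ b → onRunner e i unit b 0))
      (cong (partSum (onRunner e i unit) (pad N q) +_) (shifted-runner i y)))) (runner i)) ,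
    trans (+-cancelʳ-≡ (y / e) _ _ (trans (move (_/ e)) (trans (cong (partSum (onLevel {e}) (pad N q) +_) ([m+n]/n y)) (+-suc _ _)))) (cong suc level)
    where
    q≤ : size q ≤ N
    q≤ = ≤-trans (m≤m+n (size q) e) (≤-trans (≤-reflexive (sym (RemoveRimHook.hookSize R))) le)
    ih = star-invariants N Rs q≤
    j = proj₁ ih
    sz = proj₁ (proj₂ ih)
    runner = proj₁ (proj₂ (proj₂ ih))
    level = proj₂ (proj₂ (proj₂ ih))
    moves = RemoveRimHook⇒move (pad N p) (pad N q) (>-nonZero⁻¹ e) (trans (length-pad′ N p le) (sym (length-pad′ N q q≤)))
      (λ i → sym (row-++-zeros (parts p) _ i)) (λ i → sym (row-++-zeros (parts q) _ i))
      (sum-zeros (parts p) _) (sum-zeros (parts q) _) R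
    y = proj₁ moves
    move = proj₂ moves

-- Abaci list the runners from the last one down, odd sequences from residue 0 up.
reversed : ∀ {n} → Vec ℕ n → Vec ℕ n
reversed θ = Vec.tabulate (Vec.lookup θ ∘ opposite)

lookup-reversed : ∀ {n} (θ : Vec ℕ n) i → Vec.lookup (reversed θ) i ≡ Vec.lookup θ (opposite i)
lookup-reversed θ i = Vec.lookup∘tabulate _ i

reversed-involutive : ∀ {n} (θ : Vec ℕ n) → reversed (reversed θ) ≡ θ
reversed-involutive θ = vec-ext (λ i → trans (lookup-reversed (reversed θ) i)
  (trans (lookup-reversed θ (opposite i)) (cong (Vec.lookup θ) (Fin.opposite-involutive i))))

reversed-Zero : ∀ {n} (θ : Vec ℕ n) → Zero θ → Zero (reversed θ)
reversed-Zero θ (i , p) = opposite i , trans (lookup-reversed θ (opposite i)) (trans (cong (Vec.lookup θ) (Fin.opposite-involutive i)) p)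

replicate-+ : ∀ {A : Set} m n {x : A} → List.replicate (m + n) x ≡ List.replicate m x ++ List.replicate n x
replicate-+ zero    n = refl
replicate-+ (suc m) n = cong (_ ∷_) (replicate-+ m n)

-- Odd sequences of a block as abaci

module Block (e : ℕ) .{{_ : NonZero e}} (γ : Partition) (core : IsCore e γ) (W : ℕ) where

  -- Enough rows for all partitions of weight at most W, and W + 1 rows of zeros below them.
  N : ℕ
  N = (size γ + W * e + suc W) * e

  private
    N≥ : size γ + W * e ≤ N
    N≥ = ≤-trans (m≤m+n (size γ + W * e) (suc W)) (m≤m*n _ e)
    γ≤N : size γ ≤ N
    γ≤N = ≤-trans (m≤m+n (size γ) (W * e)) N≥
    abacusγ = abacusOf e (pad N γ) (pad-decreasing N γ)

  Mγ : Abacus e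
  Mγ = proj₁ abacusγ

  d : Vec ℕ e
  d = beads Mγ

  private
    showsγ : Shows Mγ γ (N ∸ length (parts γ))
    showsγ = proj₂ abacusγ
    excessγ : excess Mγ ≡ 0
    excessγ = core-excess {γ = γ} {Mγ} core showsγ
    levelsγ : levels Mγ ≡ triangles d
    levelsγ = trans (levels-excess Mγ) (cong (_+ triangles d) excessγ)
    beadSum-pad : ∀ F (M : Abacus e) ps → partsOf (flat M) ≡ ps → beadSum F (flat M) ≡ partSum F ps
    beadSum-pad F M ps s = trans (beadSum≡partSum F (flat M)) (cong (partSum F) s)

  odds≡oddSequence : ∀ {M : Abacus e} {p k} → Shows M p k → length (parts p) + k ≡ N →
    ∀ i → Vec.lookup (odds M) i ≡ Vec.lookup (oddSequence e p) (opposite i)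
  odds≡oddSequence {M} {p} {k} s len i = trans (lookup-odds M i) (trans (beadSum-pad _ M _ s)
    (sym (oddSequence≡ e p k (size γ + W * e + suc W) len (opposite i))))

  OddSeqs⇒Realisable : ∀ {w θ} → w ≤ W → OddSeqs e γ w θ → Realisable d w (reversed θ)
  OddSeqs⇒Realisable {w} w≤W (p , (star , _) , wt , refl) =
    M , realises
      (vec-ext (λ i → trans (lookup-beads M i) (trans (beadSum-pad _ M _ showsM) (trans (runner (toℕ (opposite i)))
        (sym (trans (lookup-beads Mγ i) (beadSum-pad _ Mγ _ showsγ)))))))
      (begin
        levels M                                   ≡⟨ trans (levels≡ M) (beadSum-pad _ M _ showsM) ⟩
        partSum (onLevel {e}) (pad N p)            ≡⟨ level ⟩
        j + partSum (onLevel {e}) (pad N γ)        ≡⟨ cong₂ _+_ (j≡w sz) (sym (trans (levels≡ Mγ) (beadSum-pad _ Mγ _ showsγ))) ⟩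
        w + levels Mγ                              ≡⟨ cong (w +_) levelsγ ⟩
        w + triangles d                            ∎)
      (vec-ext (λ i → trans (odds≡oddSequence {M} {p} showsM (length-pad N p p≤N) i) (sym (lookup-reversed (oddSequence e p) i))))
    where
    open ≡-Reasoning
    j≡w : ∀ {j} → size p ≡ size γ + j * e → j ≡ w
    j≡w {j} s = trans (sym (m*n/n≡m j e)) (trans (cong (_/ e) (sym (trans (cong (_∸ size γ) s) (m+n∸m≡n (size γ) (j * e))))) wt)
    p≤N : size p ≤ N
    p≤N = let j , s = hook-count {e} {p} {γ} star in ≤-trans (≤-reflexive s)
      (≤-trans (+-monoʳ-≤ (size γ) (*-monoˡ-≤ e (≤-trans (≤-reflexive (j≡w {j} s)) w≤W))) N≥)
    inv = star-invariants N star p≤N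
    j = proj₁ inv
    sz = proj₁ (proj₂ inv)
    runner = proj₁ (proj₂ (proj₂ inv))
    level = proj₂ (proj₂ (proj₂ inv))
    abacus = abacusOf e (pad N p) (pad-decreasing N p)
    M = proj₁ abacus
    showsM = proj₂ abacus

  Realisable⇒OddSeqs : ∀ {w θ} → Realisable d w (reversed θ) → OddSeqs e γ w θ
  Realisable⇒OddSeqs {w} {θ} (M , R@(realises b _ o)) with partitionOf (partsOf (flat M)) (partsOf-decreasing (flat M))
  ... | p , k , s =
    let star , sz = remove-to-core {γ = γ} {Mγ} showsγ excessγ w {M} {p} {k} s b (Realises⇒excess R) in
    p , (star , proj₂ core) ,
    trans (cong (_/ e) (trans (cong (_∸ size γ) sz) (m+n∸m≡n (size γ) (w * e)))) (m*n/n≡m w e) ,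
    vec-ext (λ i → begin
      Vec.lookup (oddSequence e p) i                          ≡⟨ cong (Vec.lookup (oddSequence e p)) (Fin.opposite-involutive i) ⟨
      Vec.lookup (oddSequence e p) (opposite (opposite i))    ≡⟨ odds≡oddSequence {M} {p} s len (opposite i) ⟨
      Vec.lookup (odds M) (opposite i)                        ≡⟨ cong (λ v → Vec.lookup v (opposite i)) o ⟩
      Vec.lookup (reversed θ) (opposite i)                    ≡⟨ lookup-reversed θ (opposite i) ⟩
      Vec.lookup θ (opposite (opposite i))                    ≡⟨ cong (Vec.lookup θ) (Fin.opposite-involutive i) ⟩
      Vec.lookup θ i                                          ∎)
    where
    open ≡-Reasoning
    -- `partitionOf` gives no control over the number of zeros; it follows from the total number of
    -- beads, which is that of `Mγ`.
    len : length (parts p) + k ≡ N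
    len = begin
      length (parts p) + k                        ≡⟨ cong (length (parts p) +_) (List.length-replicate k) ⟨
      length (parts p) + length (List.replicate k 0) ≡⟨ List.length-++ (parts p) ⟨
      length (parts p ++ List.replicate k 0)      ≡⟨ cong length s ⟨
      length (partsOf (flat M))                   ≡⟨ trans (length-partsOf (flat M)) (#beads-flat M) ⟩
      Vec.sum (beads M)                           ≡⟨ cong Vec.sum b ⟩
      Vec.sum d                                   ≡⟨ trans (length-partsOf (flat Mγ)) (#beads-flat Mγ) ⟨
      length (partsOf (flat Mγ))                  ≡⟨ cong length showsγ ⟩
      length (pad N γ)                            ≡⟨ length-pad′ N γ γ≤N ⟩
      N                                           ∎

  -- The last `suc W * e` entries of the padded list are zeros. Their beads fill the lowest `suc W`
  -- rows, so the comparison is with an abacus of that many full rows.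
  d-entries : All (suc W ≤_) (toList d)
  d-entries = all-lookup d (λ i → begin
    suc W
      ≡⟨ full-rows (suc W) i ⟨
    Vec.lookup (beads (List.replicate (suc W) (Vec.replicate e true))) i
      ≡⟨ trans (lookup-beads (List.replicate (suc W) (Vec.replicate e true)) i) (beadSum-pad (F i) (List.replicate (suc W) (Vec.replicate e true)) _ (full-parts (suc W))) ⟩
    partSum (F i) (List.replicate (suc W * e) 0)
      ≤⟨ partSum-++ (F i) (parts γ ++ List.replicate r 0) _ ⟩
    partSum (F i) ((parts γ ++ List.replicate r 0) ++ List.replicate (suc W * e) 0)
      ≡⟨ cong (partSum (F i)) (trans (List.++-assoc (parts γ) _ _) (cong (parts γ ++_) (trans (sym (replicate-+ r (suc W * e))) (cong (λ m → List.replicate m 0) r≡)))) ⟩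
    partSum (F i) (pad N γ)
      ≡⟨ trans (lookup-beads Mγ i) (beadSum-pad _ Mγ _ showsγ) ⟨
    Vec.lookup d i ∎)
    where
    open ≤-Reasoning
    F : Fin e → ℕ → ℕ → ℕ
    F i = onRunner e (toℕ (opposite i)) unit
    S = size γ + W * e
    r = S * e ∸ length (parts γ)
    r≡ : r + suc W * e ≡ N ∸ length (parts γ)
    r≡ = trans (sym (+-∸-comm (suc W * e) (≤-trans (length≤size γ) (≤-trans (m≤m+n (size γ) (W * e)) (m≤m*n S e)))))
      (cong (_∸ length (parts γ)) (sym (*-distribʳ-+ e S (suc W))))
    all-lookup : ∀ {n} {P : ℕ → Set} (v : Vec ℕ n) → (∀ i → P (Vec.lookup v i)) → All P (toList v)
    all-lookup []      p = []
    all-lookup (x ∷ v) p = p zero ∷ all-lookup v (p ∘ suc)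
    partSum-++ : ∀ F xs ys → partSum F ys ≤ partSum F (xs ++ ys)
    partSum-++ F []       ys = ≤-refl
    partSum-++ F (x ∷ xs) ys = ≤-trans (partSum-++ F xs ys) (m≤n+m _ _)
    full-rows : ∀ k i → Vec.lookup (beads (List.replicate k (Vec.replicate e true))) i ≡ k
    full-rows zero    i = Vec.lookup-replicate i 0
    full-rows (suc k) i = trans (Vec.lookup-zipWith _+_ i (Vec.map bit (Vec.replicate e true)) _)
      (cong₂ _+_ (trans (Vec.lookup-map i bit (Vec.replicate e true)) (cong bit (Vec.lookup-replicate i true))) (full-rows k i))
    full-row-parts : ∀ m w → #gaps w ≡ 0 → partsOf (toList (Vec.replicate m true) ++ w) ≡ List.replicate m 0 ++ partsOf w × #gaps (toList (Vec.replicate m true) ++ w) ≡ 0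
    full-row-parts zero    w g = refl , g
    full-row-parts (suc m) w g = let p , g′ = full-row-parts m w g in cong₂ _∷_ g′ p , g′
    no-gaps : ∀ k → #gaps (flat (List.replicate k (Vec.replicate e true))) ≡ 0
    no-gaps zero    = refl
    no-gaps (suc k) = proj₂ (full-row-parts e _ (no-gaps k))
    full-parts : ∀ k → partsOf (flat (List.replicate k (Vec.replicate e true))) ≡ List.replicate (k * e) 0
    full-parts zero    = refl
    full-parts (suc k) = trans (proj₁ (full-row-parts e _ (no-gaps k)))
      (trans (cong (List.replicate e 0 ++_) (full-parts k)) (sym (replicate-+ e (k * e))))

-- Counting the odd sequences

runners≡ : ∀ h → runners h ≡ suc (h * 2)
runners≡ zero    = refl
runners≡ (suc h) = cong (2 +_) (runners≡ h)

Odd⇒runners : ∀ e → Odd e → ∃[ h ] e ≡ runners h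
Odd⇒runners zero          odd = ⊥-elim (odd (divides 0 refl))
Odd⇒runners (suc zero)    odd = 0 , refl
Odd⇒runners (suc (suc e)) odd =
  let h , p = Odd⇒runners e (λ { (divides k q) → odd (divides (suc k) (cong (2 +_) q)) })
  in suc h , cong (2 +_) p

module Counts (h : ℕ) .{{_ : NonZero (runners h)}} (γ : Partition) (W c : ℕ) .{{_ : NonZero c}} (W<q : W < RoCK.q c)
  (d : Vec ℕ (runners h)) (E : Equivalent W d (RoCK.rock c (runners h)))
  (OddSeqs⇒Realisable : ∀ {w θ} → w ≤ W → OddSeqs (runners h) γ w θ → Realisable d w (reversed θ))
  (Realisable⇒OddSeqs : ∀ {w θ} → Realisable d w (reversed θ) → OddSeqs (runners h) γ w θ) where

  open RoCK c
  open Equivalent E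

  private
    e = runners h

  sequence : Vec ℕ (suc h) → Vec ℕ e
  sequence ys = reversed (from (Φ h ys))

  sequence-injective : ∀ {ys ys′} → sequence ys ≡ sequence ys′ → ys ≡ ys′
  sequence-injective {ys} {ys′} p = Φ-injective h (begin
    Φ h ys                                    ≡⟨ unfold ys ⟨
    to (reversed (sequence ys))               ≡⟨ cong (to ∘ reversed) p ⟩
    to (reversed (sequence ys′))              ≡⟨ unfold ys′ ⟩
    Φ h ys′                                   ∎)
    where
    open ≡-Reasoning
    unfold : ∀ ys → to (reversed (sequence ys)) ≡ Φ h ys
    unfold ys = trans (cong to (reversed-involutive (from (Φ h ys)))) (to∘from (Φ h ys))

  OddSeqs⇔ : ∀ {w} → w ≤ W → ∀ θ →
             OddSeqs e γ w θ ⇔ (∃[ ys ] (∃[ k ] Vec.sum ys + (k + k) ≡ w) × sequence ys ≡ θ)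
  OddSeqs⇔ {w} w≤W θ = mk⇔
    (λ S → let ys , sum , p = Equivalence.to (rock-Realisable h (≤-<-trans w≤W W<q)) (to-Realisable w≤W (OddSeqs⇒Realisable w≤W S)) in
      ys , sum , trans (cong reversed (trans (cong from p) (from∘to (reversed θ)))) (reversed-involutive θ))
    (λ { (ys , sum , refl) → Realisable⇒OddSeqs (subst (Realisable d w) (sym (reversed-involutive (from (Φ h ys))))
      (from-Realisable w≤W (Equivalence.from (rock-Realisable h (≤-<-trans w≤W W<q)) (ys , sum , refl)))) })

  sequence-Zero : ∀ ys → HasZero e (sequence ys) ⇔ Vec.last ys ≡ 0
  sequence-Zero ys = mk⇔
    (λ z → Equivalence.to (Φ-Zero h ys) (subst Zero (to∘from (Φ h ys)) (to-Zero _
      (subst Zero (reversed-involutive (from (Φ h ys))) (reversed-Zero (sequence ys) z)))))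
    (λ p → reversed-Zero (from (Φ h ys)) (from-Zero (Φ h ys) (Equivalence.from (Φ-Zero h ys) p)))

  -- The map `sequence` is injective and the same for all weights up to `W`, so the sequence of `ys`
  -- occurs first at weight `Vec.sum ys`. A positive surplus `k` means that it has occurred before.
  NewOddSeqs⇔ : ∀ θ → NewOddSeqs e γ W θ ⇔ (∃[ ys ] Vec.sum ys ≡ W × sequence ys ≡ θ)
  NewOddSeqs⇔ θ = mk⇔ forth back
    where
    forth : NewOddSeqs e γ W θ → ∃[ ys ] Vec.sum ys ≡ W × sequence ys ≡ θ
    forth (S , new) with Equivalence.to (OddSeqs⇔ ≤-refl θ) S
    ... | ys , (zero  , sum) , p = ys , trans (sym (+-identityʳ _)) sum , p
    ... | ys , (suc k , sum) , p = ⊥-elim (new (Vec.sum ys) smaller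
          (Equivalence.from (OddSeqs⇔ (<⇒≤ smaller) θ) (ys , (0 , +-identityʳ _) , p)))
      where
      smaller : Vec.sum ys < W
      smaller = ≤-trans (m<m+n (Vec.sum ys) z<s) (≤-reflexive sum)
    back : ∃[ ys ] Vec.sum ys ≡ W × sequence ys ≡ θ → NewOddSeqs e γ W θ
    back (ys , sum , p) = Equivalence.from (OddSeqs⇔ ≤-refl θ) (ys , (0 , trans (+-identityʳ _) sum) , p) , new
      where
      new : ∀ w → w < W → ¬ OddSeqs e γ w θ
      new w w<W S with Equivalence.to (OddSeqs⇔ (<⇒≤ w<W) θ) S
      ... | ys′ , (k , sum′) , p′ with sequence-injective {ys} {ys′} (trans p (sym p′))
      ...   | refl = <⇒≱ w<W (≤-trans (≤-reflexive (sym sum)) (≤-trans (m≤m+n (Vec.sum ys) (k + k)) (≤-reflexive sum′)))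

  -- Restriction to sequences with a zero entry, that is to ys with last entry 0.
  with-Zero : ∀ {P : ℕ → Set} {S : Vec ℕ e → Set} → (∀ θ → S θ ⇔ (∃[ ys ] P (Vec.sum ys) × sequence ys ≡ θ)) →
    ∀ θ → (∃[ zs ] P (Vec.sum zs) × sequence (zs ∷ʳ 0) ≡ θ) ⇔ (S θ × HasZero e θ)
  with-Zero {P} {S} S⇔ θ = mk⇔ forth back
    where
    sum-∷ʳ0 : ∀ {n} (zs : Vec ℕ n) → Vec.sum (zs ∷ʳ 0) ≡ Vec.sum zs
    sum-∷ʳ0 []       = refl
    sum-∷ʳ0 (z ∷ zs) = cong (z +_) (sum-∷ʳ0 zs)
    forth : ∃[ zs ] P (Vec.sum zs) × sequence (zs ∷ʳ 0) ≡ θ → S θ × HasZero e θ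
    forth (zs , sum , refl) = Equivalence.from (S⇔ _) (zs ∷ʳ 0 , subst P (sym (sum-∷ʳ0 zs)) sum , refl) ,
      Equivalence.from (sequence-Zero (zs ∷ʳ 0)) (Vec.last-∷ʳ 0 zs)
    back : S θ × HasZero e θ → ∃[ zs ] P (Vec.sum zs) × sequence (zs ∷ʳ 0) ≡ θ
    back (s , z) with Equivalence.to (S⇔ θ) s
    ... | ys , sum , refl with Vec.initLast ys | Equivalence.to (sequence-Zero ys) z
    ...   | zs , y , refl | refl = zs , subst P (sum-∷ʳ0 zs) sum , refl

  sequence∷ʳ0-injective : ∀ {zs zs′} → sequence (zs ∷ʳ 0) ≡ sequence (zs′ ∷ʳ 0) → zs ≡ zs′
  sequence∷ʳ0-injective p = Vec.∷ʳ-injectiveˡ _ _ (sequence-injective p)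

  countN : HasSize (λ θ → NewOddSeqs e γ W θ × HasZero e θ) (compositions h W)
  countN = HasSize-resp-⇔ (with-Zero {_≡ W} NewOddSeqs⇔) (HasSize-image _ sequence∷ʳ0-injective (HasSize-compositions h W))

  countM : HasSize (NewOddSeqs e γ W) (compositions (suc h) W)
  countM = HasSize-resp-⇔ (⇔-sym ∘ NewOddSeqs⇔) (HasSize-image _ sequence-injective (HasSize-compositions (suc h) W))

  countZ : HasSize (λ θ → OddSeqs e γ W θ × HasZero e θ) (everySecond (compositions h) W)
  countZ = HasSize-resp-⇔ (with-Zero {λ s → ∃[ k ] s + (k + k) ≡ W} (OddSeqs⇔ ≤-refl))
    (HasSize-image _ sequence∷ʳ0-injective (HasSize-everySecond Vec.sum (compositions h) (HasSize-compositions h) W))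

  countT : HasSize (OddSeqs e γ W) (everySecond (compositions (suc h)) W)
  countT = HasSize-resp-⇔ (⇔-sym ∘ OddSeqs⇔ ≤-refl)
    (HasSize-image _ sequence-injective (HasSize-everySecond Vec.sum (compositions (suc h)) (HasSize-compositions (suc h)) W))

module _ (h : ℕ) .{{_ : NonZero (runners h)}} (γ : Partition) (core : IsCore (runners h) γ) (W : ℕ) where

  open Block (runners h) γ core W
  -- With c = W + 1 the zones admit weight `W`, every runner has at least `suc W` beads, and `c` is
  -- positive.
  open RoCK (suc W)

  private
    W<q : W < q
    W<q = ≤-trans (n<1+n W) (m≤m+n (suc W) (suc W))

  open Counts h γ W (suc W) W<q d (all-Equivalent d (rock (runners h)) d-entries (rock-entries (runners h) W<q))
    OddSeqs⇒Realisable Realisable⇒OddSeqs public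

half₀ : ∀ h → (runners h ∸ 1) / 2 ≡ h
half₀ h = trans (cong (λ m → (m ∸ 1) / 2) (runners≡ h)) (m*n/n≡m h 2)

half₁ : ∀ h → (runners h + 1) / 2 ≡ suc h
half₁ h = trans (cong (_/ 2) (trans (cong (_+ 1) (runners≡ h)) (+-comm (suc (h * 2)) 1))) (m*n/n≡m (suc h) 2)

half₃ : ∀ h → (runners h + 3) / 2 ≡ suc (suc h)
half₃ h = trans (cong (_/ 2) (trans (cong (_+ 3) (runners≡ h)) (+-comm (suc (h * 2)) 3))) (m*n/n≡m (suc (suc h)) 2)

theorem6p14 : (e : ℕ) .{{_ : NonZero e}} → 1 < e → Odd e →
    ∃[ N ] ∃[ M ] ∃[ Z ] ∃[ T ]
    ( (∀ γ → IsCore e γ →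
    CountsN e γ N × CountsM e γ M × CountsZ e γ Z × CountsT e γ T)
    × genFun N ≐1/ (one ⊖ X) ^ˢ ((e ∸ 1) / 2)
    × genFun M ≐1/ (one ⊖ X) ^ˢ ((e + 1) / 2)
    × genFun Z ≐1/ (one ⊕ X) ⊛ (one ⊖ X) ^ˢ ((e + 1) / 2)
    × genFun T ≐1/ (one ⊕ X) ⊛ (one ⊖ X) ^ˢ ((e + 3) / 2) )
theorem6p14 e 1<e odd with Odd⇒runners e odd
... | h , refl =
  compositions h , compositions (suc h) , everySecond (compositions h) , everySecond (compositions (suc h)) ,
  (λ γ core → countN h γ core , countM h γ core , countZ h γ core , countT h γ core) ,
  subst (λ k → genFun (compositions h) ≐1/ (one ⊖ X) ^ˢ k) (sym (half₀ h)) (genFun-compositions h) ,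
  subst (λ k → genFun (compositions (suc h)) ≐1/ (one ⊖ X) ^ˢ k) (sym (half₁ h)) (genFun-compositions (suc h)) ,
  subst (λ k → genFun (everySecond (compositions h)) ≐1/ (one ⊕ X) ⊛ (one ⊖ X) ^ˢ k) (sym (half₁ h)) (genFun-everySecond h) ,
  subst (λ k → genFun (everySecond (compositions (suc h))) ≐1/ (one ⊕ X) ⊛ (one ⊖ X) ^ˢ k) (sym (half₃ h)) (genFun-everySecond (suc h))
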